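{- Let $p$ be a prime power and let $n$ be a positive integer. If there exists a weighing matrix $W(n,p)$, then for every positive integer $m$ there exists a weighing matrix $$W\left(\frac{p^{m+1}-1}{p-1}(n-1)+1,\; p^{m+1}\right).$$
   Context: A weighing matrix of order $n$ and weight $k$, denoted $W(n,k)$, is an $n\times n$ matrix $W$ with entries in $\{0,1,-1\}$ such that $WW^t = kI_n$. -}

module Defs where

open import Algebra.Properties.Semiring.Sum using (sum)
open import Data.Bool using (if_then_else_)
open import Data.Fin using (Fin; _≟_)
open import Data.Integer using (ℤ; +_; 0ℤ; 1ℤ; -1ℤ) renaming (_*_ to _*ℤ_)
open import Data.Integer.Properties using (+-*-semiring)
open import Data.Nat using (ℕ; suc; _∸_; _^_; _<_; z<s; NonZero; >-nonZero; nonTrivial⇒n>1)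
open import Data.Nat.Primality using (Prime; prime⇒nonTrivial)
open import Data.Nat.Properties using (m<n⇒0<n∸m; ^-monoʳ-<)
open import Data.Product using (∃; ∃₂; _×_; _,_)
open import Data.Sum using (_⊎_)
open import Data.Vec.Functional using (Vector; transpose)
open import Relation.Binary.PropositionalEquality using (_≡_; refl)
open import Relation.Nullary.Decidable using (⌊_⌋)

IsPrimePower : ℕ → Set
IsPrimePower p = ∃₂ λ q k → Prime q × 0 < k × p ≡ q ^ k

-- Makes the quotient (p ^ (m + 1) ∸ 1) / (p ∸ 1) well formed for a prime power p.
isPrimePower⇒pred-nonZero : ∀ {p} → IsPrimePower p → NonZero (p ∸ 1)
isPrimePower⇒pred-nonZero (q , suc k , q-prime , z<s , refl) =
  >-nonZero (m<n⇒0<n∸m (^-monoʳ-< q 1<q {0} {suc k} z<s))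
  where 1<q = nonTrivial⇒n>1 q {{prime⇒nonTrivial q-prime}}

Matrix : ℕ → ℕ → Set
Matrix m n = Vector (Vector ℤ n) m

infixl 7 _*ᴹ_ _·_

_*ᴹ_ : ∀ {l m n} → Matrix l m → Matrix m n → Matrix l n
(A *ᴹ B) i j = sum +-*-semiring (λ r → A i r *ℤ B r j)

I : ∀ n → Matrix n n
I n i j = if ⌊ i ≟ j ⌋ then 1ℤ else 0ℤ

_·_ : ∀ {m n} → ℤ → Matrix m n → Matrix m n
(c · A) i j = c *ℤ A i j

record IsWeighing (n k : ℕ) (W : Matrix n n) : Set where
  field
    entries : ∀ i j → W i j ≡ 0ℤ ⊎ W i j ≡ 1ℤ ⊎ W i j ≡ -1ℤ
    WWᵗ≡kI  : ∀ i j → (W *ᴹ transpose W) i j ≡ (+ k · I n) i j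

WeighingMatrixExists : ℕ → ℕ → Set
WeighingMatrixExists n k = ∃ λ (W : Matrix n n) → IsWeighing n k W

{-# OPTIONS --safe #-}
module Submission where

-- Delete the first column of W and normalise its entries to 0 and 1: the p rows D_a with a leading
-- 1 satisfy D_a · D_b = p δ_ab - 1, and the other rows E_b are orthogonal to them.
--
-- For odd p let v = (p^(m+1) - 1)/(p - 1).  Distinct words x of the simplex code F_p^(m+1) → F_p^v
-- agree in (v - 1)/p places, so the rows (1 | D_{x_1} | … | D_{x_v}) are orthogonal of weight
-- p^(m+1).  They are completed by the rows (0 | A ⊗ E) for a matrix A = W(v, p^m), which arises by
-- the same construction from the Paley matrix W(p + 1, p).
--
-- For even p no such A need exist (there is no W(5, 4)).  Instead Sylvester matrices W(p^j, p^j)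
-- allow W(v(n-1)+1, p^(m+1)) to be woven from W(v′(n-1)+1, p^m) and W(n, p), where v = v′ + p^m.
--
-- The field with q^k elements is cut out of F_q[C_N], N = q^k - 1, by an idempotent e.  All elements
-- of this ring satisfy a^(q^k) = a, so e can be refined until every element is zero or invertible
-- in the quotient, while the product of x^(q^d) - x over 0 < d < k stays nonzero there.  Then x has
-- k distinct conjugates, whence 1, x, …, x^(k-1) is a basis over F_q.

-- A square W with WWᵗ = pI has columns of weight p; so exactly p rows start with a nonzero entry,
-- and they can be labelled by the letters of a code over a field with p elements. In the product of
-- two codeword rows the leading ones give 1, an agreement gives p - 1 and a disagreement -1, so
-- orthogonality asks for exactly (v - 1)/p agreements. A codeword row has weight 1 + v(p - 1) =
-- p^(m+1), which forces the weight p^m of A; with d = n - p rows in E the row count p^(m+1) + vd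
-- equals v(n - 1) + 1.
--
-- Weaving is closed to odd p: it uses W(p, p), a Hadamard matrix, and p would be its order.
--
-- The field carries the simplex code and the quadratic character. The group ring spares the search
-- for an irreducible polynomial: q^k = 1 modulo N, so the k-fold Frobenius map fixes each group
-- element and, being additive, everything, and this identity descends to every quotient. A
-- primitive idempotent alone might cut out a smaller field; the product of the x^(q^d) - x excludes
-- that. Its degree q + ... + q^(k-1) is below N, so x^N = 1 does not wrap its leading term around.

open import Defs

-- Integer sums over finite types.

module FiniteSums where

  open import Data.Empty using (⊥-elim)
  open import Data.Fin as Fin using (Fin; zero; suc; _↑ˡ_; _↑ʳ_; combine)
  import Data.Fin.Properties as Fin
  open import Data.Integer as ℤ using (ℤ; +_; 0ℤ; 1ℤ; -1ℤ; _+_; _*_; -_)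
  import Data.Integer.Properties as ℤ
  open import Algebra.Properties.Semiring.Sum ℤ.+-*-semiring
    using (sum; sum-cong-≗; sum-permute; *-distribˡ-sum; *-distribʳ-sum; sum-replicate-zero)
    renaming (∑-distrib-+ to sum-distrib-+; ∑-comm to sum-comm)
  open import Data.Nat as ℕ using (ℕ; zero; suc)
  open import Data.Product as Product using (_×_; _,_)
  open import Data.Product.Function.NonDependent.Propositional using (_×-↔_)
  open import Data.Sum as Sum using (_⊎_; inj₁; inj₂)
  open import Data.Sum.Function.Propositional using (_⊎-↔_)
  open import Data.Unit using (⊤; tt)
  open import Function using (_∘_; _↔_; Inverse)
  open import Function.Construct.Composition using (_↔-∘_)
  open import Function.Construct.Identity using (↔-id)
  open import Function.Construct.Symmetry using (↔-sym)
  open import Relation.Binary.PropositionalEquality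
  open import Relation.Nullary using (Dec; yes; no)
  open import Relation.Nullary.Decidable using (map′)

  -- Matrices are indexed by arbitrary finite types, so that blocks are sums and Kronecker factors
  -- are products of types; arithmetic on positions in `Fin n` is left to the conversions at either
  -- end.
  record Finite (A : Set) : Set where
    no-eta-equality
    field
      size : ℕ
      enum : Fin size ↔ A
    open Inverse enum public using () renaming (to to at; from to ix)

    at-ix : ∀ a → at (ix a) ≡ a
    at-ix = Inverse.strictlyInverseˡ enum

    ix-injective : ∀ {a b} → ix a ≡ ix b → a ≡ b
    ix-injective {a} {b} eq = trans (sym (at-ix a)) (trans (cong at eq) (at-ix b))

  open Finite {{...}} public using (at; ix; at-ix; ix-injective)

  size : (A : Set) {{_ : Finite A}} → ℕ
  size A {{fin}} = Finite.size fin

  instance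
    Fin-finite : ∀ {n} → Finite (Fin n)
    Fin-finite {n} .Finite.size = n
    Fin-finite .Finite.enum = ↔-id _

    ⊤-finite : Finite ⊤
    ⊤-finite .Finite.size = 1
    ⊤-finite .Finite.enum = Fin.1↔⊤

    ⊎-finite : ∀ {A B : Set} {{_ : Finite A}} {{_ : Finite B}} → Finite (A ⊎ B)
    ⊎-finite {{a}} {{b}} .Finite.size = Finite.size a ℕ.+ Finite.size b
    ⊎-finite {{a}} {{b}} .Finite.enum = (Finite.enum a ⊎-↔ Finite.enum b) ↔-∘ Fin.+↔⊎

    ×-finite : ∀ {A B : Set} {{_ : Finite A}} {{_ : Finite B}} → Finite (A × B)
    ×-finite {{a}} {{b}} .Finite.size = Finite.size a ℕ.* Finite.size b
    ×-finite {{a}} {{b}} .Finite.enum = (Finite.enum a ×-↔ Finite.enum b) ↔-∘ Fin.*↔×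

  module _ {A : Set} {{_ : Finite A}} where

    infix 4 _≟_
    _≟_ : (a b : A) → Dec (a ≡ b)
    a ≟ b = map′ ix-injective (cong ix) (ix a Fin.≟ ix b)

    opaque
      -- Routed through `I`, so that over `Fin n` it unfolds to the identity matrix of the theorem;
      -- opaque, so that elsewhere only its two values are used.
      δ : A → A → ℤ
      δ a b = I _ (ix a) (ix b)

      δ-≡ : ∀ {a b} → a ≡ b → δ a b ≡ 1ℤ
      δ-≡ {a} refl with ix a Fin.≟ ix a
      ... | yes _ = refl
      ... | no ¬eq = ⊥-elim (¬eq refl)

      δ-≢ : ∀ {a b} → a ≢ b → δ a b ≡ 0ℤ
      δ-≢ {a} {b} ¬eq with ix a Fin.≟ ix b
      ... | yes eq = ⊥-elim (¬eq (ix-injective eq))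
      ... | no _ = refl

    δ-sym : ∀ a b → δ a b ≡ δ b a
    δ-sym a b with a ≟ b
    ... | yes refl = refl
    ... | no ¬eq = trans (δ-≢ ¬eq) (sym (δ-≢ (¬eq ∘ sym)))

    opaque
      unfolding δ

      ∑ : (A → ℤ) → ℤ
      ∑ f = sum (f ∘ at)

      ∑-cong : {f g : A → ℤ} → (∀ x → f x ≡ g x) → ∑ f ≡ ∑ g
      ∑-cong eq = sum-cong-≗ (eq ∘ at)

      ∑-zero : {f : A → ℤ} → (∀ x → f x ≡ 0ℤ) → ∑ f ≡ 0ℤ
      ∑-zero eq = trans (∑-cong eq) (sum-replicate-zero (size A))

      ∑-+ : (f g : A → ℤ) → ∑ (λ x → f x + g x) ≡ ∑ f + ∑ g
      ∑-+ f g = sum-distrib-+ (f ∘ at) (g ∘ at)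

      ∑-*ˡ : ∀ c (f : A → ℤ) → ∑ (λ x → c * f x) ≡ c * ∑ f
      ∑-*ˡ c f = sym (*-distribˡ-sum c (f ∘ at))

      ∑-*ʳ : ∀ c (f : A → ℤ) → ∑ (λ x → f x * c) ≡ ∑ f * c
      ∑-*ʳ c f = sym (*-distribʳ-sum c (f ∘ at))

      ∑-neg : ∀ (f : A → ℤ) → ∑ (λ x → - f x) ≡ - ∑ f
      ∑-neg f = trans (∑-cong (λ x → sym (ℤ.-1*i≡-i (f x))))
                      (trans (∑-*ˡ -1ℤ f) (ℤ.-1*i≡-i _))

      ∑-const : ∀ c → ∑ (λ _ → c) ≡ + size A * c
      ∑-const c = go (size A)
        where
        go : ∀ n → sum {n} (λ _ → c) ≡ + n * c
        go zero = refl
        go (suc n) = trans (cong (_+_ c) (go n)) (sym (ℤ.suc-* (+ n) c))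


      ∑-δ : ∀ a (f : A → ℤ) → ∑ (λ x → δ a x * f x) ≡ f a
      ∑-δ a f = trans (sum-cong-≗ (λ j → cong (λ i → I _ (ix a) i * f (at j))
                                                  (Inverse.strictlyInverseʳ (Finite.enum it) j)))
                      (trans (go (ix a) (f ∘ at)) (cong f (at-ix a)))
        where
        it : {{Finite A}} → Finite A
        it {{x}} = x
        go : ∀ {n} (i : Fin n) (g : Fin n → ℤ) → sum (λ j → I n i j * g j) ≡ g i
        go {suc n} zero g =
          trans (cong₂ _+_ (ℤ.*-identityˡ (g zero)) (sum-replicate-zero n))
                (ℤ.+-identityʳ _)
        go {suc n} (suc i) g = trans (ℤ.+-identityˡ _)
          (trans (sum-cong-≗ (λ j → cong (_* g (suc j)) (I-suc j))) (go i (g ∘ suc)))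
          where
          I-suc : ∀ j → I (suc n) (suc i) (suc j) ≡ I n i j
          I-suc j with i Fin.≟ j
          ... | yes _ = refl
          ... | no _ = refl

      ∑-nonneg : (f : A → ℤ) → (∀ x → 0ℤ ℤ.≤ f x) → 0ℤ ℤ.≤ ∑ f
      ∑-nonneg f = go (f ∘ at) ∘ (_∘ at)
        where
        go : ∀ {n} (g : Fin n → ℤ) → (∀ i → 0ℤ ℤ.≤ g i) → 0ℤ ℤ.≤ sum g
        go {zero} g _ = ℤ.≤-refl
        go {suc n} g h = ℤ.+-mono-≤ (h zero) (go (g ∘ suc) (h ∘ suc))

  sum-split : ∀ m {n} (g : Fin (m ℕ.+ n) → ℤ) →
       sum g ≡ sum (λ i → g (i ↑ˡ n)) + sum (λ j → g (m ↑ʳ j))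
  sum-split zero g = sym (ℤ.+-identityˡ _)
  sum-split (suc m) g = trans (cong (_+_ (g zero)) (sum-split m (g ∘ suc))) (sym (ℤ.+-assoc (g zero) _ _))

  opaque
    unfolding ∑

    ∑-⊤ : (f : ⊤ → ℤ) → ∑ f ≡ f tt
    ∑-⊤ f = ℤ.+-identityʳ (f tt)

  module _ {A B : Set} {{_ : Finite A}} {{_ : Finite B}} where

    δ-injective : (f : A → B) → (∀ {x y} → f x ≡ f y → x ≡ y) →
                  ∀ x y → δ (f x) (f y) ≡ δ x y
    δ-injective f inj x y with x ≟ y
    ... | yes refl = trans (δ-≡ {B} {a = f x} refl) (sym (δ-≡ {A} {a = x} refl))
    ... | no ¬eq = trans (δ-≢ (¬eq ∘ inj)) (sym (δ-≢ ¬eq))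

    opaque
      unfolding ∑

      ∑-comm : (f : A → B → ℤ) → ∑ (λ x → ∑ (f x)) ≡ ∑ (λ y → ∑ (λ x → f x y))
      ∑-comm f = sum-comm (λ i j → f (at i) (at j))

      ∑-⊎ : (f : A ⊎ B → ℤ) → ∑ f ≡ ∑ (f ∘ inj₁) + ∑ (f ∘ inj₂)
      ∑-⊎ f = trans (sum-split (size A) (λ i → f (at i)))
        (cong₂ _+_
          (sum-cong-≗ (λ i → cong (f ∘ image) (Fin.splitAt-↑ˡ (size A) i (size B))))
          (sum-cong-≗ (λ j → cong (f ∘ image) (Fin.splitAt-↑ʳ (size A) (size B) j))))
        where
        image : Fin (size A) ⊎ Fin (size B) → A ⊎ B
        image = Sum.map at at

      ∑-× : (f : A × B → ℤ) → ∑ f ≡ ∑ (λ x → ∑ (λ y → f (x , y)))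
      ∑-× f = trans (go (size A) (λ i → f (at i)))
        (sum-cong-≗ (λ i → sum-cong-≗ (λ j →
          cong (f ∘ image) (Fin.remQuot-combine {size A} {size B} i j))))
        where
        image : Fin (size A) × Fin (size B) → A × B
        image = Product.map at at
        go : ∀ m {n} (g : Fin (m ℕ.* n) → ℤ) → sum g ≡ sum (λ i → sum (λ j → g (combine {m} {n} i j)))
        go zero g = refl
        go (suc m) {n} g = trans (sum-split n g)
          (cong (_+_ (sum (λ j → g (j ↑ˡ m ℕ.* n)))) (go m (λ i → g (n ↑ʳ i))))

      ∑-↔ : (e : A ↔ B) (f : B → ℤ) → ∑ f ≡ ∑ (f ∘ Inverse.to e)
      ∑-↔ e f = trans (sum-permute (f ∘ at) (↔-sym (Finite.enum it) ↔-∘ (e ↔-∘ Finite.enum it)))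
                      (∑-cong (λ x → cong f (at-ix (Inverse.to e x))))
        where
        it : {X : Set} {{_ : Finite X}} → Finite X
        it {{x}} = x

-- Weighing matrices over finite types: sums, Kronecker products and weaving.

module WeighingMatrices where

  open FiniteSums
  open import Data.Empty using (⊥-elim)
  open import Data.Fin as Fin using (Fin; zero; suc)
  import Data.Fin.Properties as Fin
  open import Data.Integer as ℤ using (ℤ; +_; 0ℤ; 1ℤ; -1ℤ; _+_; _*_)
  import Data.Integer.Properties as ℤ
  open import Algebra.Properties.CommutativeSemigroup ℤ.*-commutativeSemigroup
    using (interchange; x∙yz≈z∙yx)
  open import Data.Maybe using (Maybe; just; nothing)
  open import Data.Nat as ℕ using (ℕ; zero; suc)
  import Data.Nat.Properties as ℕ
  open import Data.Product using (_×_; _,_; proj₁; proj₂; ∃)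
  open import Data.Sum using (_⊎_; inj₁; inj₂)
  open import Function using (_∘_; _↔_; Inverse; Injection)
  open import Function.Properties.Inverse using (↔⇒↣)
  open import Function.Construct.Symmetry using (↔-sym)
  open import Relation.Binary.PropositionalEquality
  open import Relation.Nullary using (Dec; yes; no)
  open import Relation.Nullary.Decidable using (map′; ¬?; decidable-stable)

  module _ {A : Set} {{_ : Finite A}} where

    any? : {P : A → Set} → (∀ x → Dec (P x)) → Dec (∃ P)
    any? {P} P? = map′ (λ (i , h) → at i , h) (λ (x , h) → ix x , subst P (sym (at-ix x)) h)
                       (Fin.any? (P? ∘ at))

    ∑-single : ∀ a (f : A → ℤ) → (∀ x → a ≢ x → f x ≡ 0ℤ) → ∑ f ≡ f a
    ∑-single a f f≡0 = trans (∑-cong concentrated) (∑-δ a f)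
      where
      concentrated : ∀ x → f x ≡ δ a x * f x
      concentrated x with a ≟ x
      ... | yes eq = sym (trans (cong (_* f x) (δ-≡ eq)) (ℤ.*-identityˡ (f x)))
      ... | no ¬eq = trans (f≡0 x ¬eq) (sym (trans (cong (δ a x *_) (f≡0 x ¬eq)) (ℤ.*-zeroʳ (δ a x))))

  ∑-*-∑ : {A B : Set} {{_ : Finite A}} {{_ : Finite B}} (f : A → ℤ) (g : B → ℤ) →
          ∑ f * ∑ g ≡ ∑ (λ x → ∑ (λ y → f x * g y))
  ∑-*-∑ f g = trans (sym (∑-*ʳ (∑ g) f)) (∑-cong (λ x → sym (∑-*ˡ (f x) g)))

  Ternary : ℤ → Set
  Ternary x = x ≡ 0ℤ ⊎ x ≡ 1ℤ ⊎ x ≡ -1ℤ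

  Ternary-* : ∀ {x y} → Ternary x → Ternary y → Ternary (x * y)
  Ternary-* (inj₁ refl) _ = inj₁ refl
  Ternary-* {y = y} (inj₂ (inj₁ refl)) t = subst Ternary (sym (ℤ.*-identityˡ y)) t
  Ternary-* (inj₂ (inj₂ refl)) (inj₁ refl) = inj₁ refl
  Ternary-* (inj₂ (inj₂ refl)) (inj₂ (inj₁ refl)) = inj₂ (inj₂ refl)
  Ternary-* (inj₂ (inj₂ refl)) (inj₂ (inj₂ refl)) = inj₂ (inj₁ refl)

  Ternary-δ : {A : Set} {{_ : Finite A}} (a b : A) → Ternary (δ a b)
  Ternary-δ a b with a ≟ b
  ... | yes eq = inj₂ (inj₁ (δ-≡ eq))
  ... | no ¬eq = inj₁ (δ-≢ ¬eq)

  -- Rows and columns carry their own types, since a construction may label rows by codewords and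
  -- columns by positions. Squareness enters through the sizes in `toMatrix` and `column-weight`.
  record Weighing (R C : Set) {{_ : Finite R}} {{_ : Finite C}} (k : ℕ) : Set where
    field
      entry      : R → C → ℤ
      ternary    : ∀ r c → Ternary (entry r c)
      orthogonal : ∀ r s → ∑ (λ c → entry r c * entry s c) ≡ + k * δ r s

  open Weighing

  reindex : {R C R′ C′ : Set} {{_ : Finite R}} {{_ : Finite C}} {{_ : Finite R′}} {{_ : Finite C′}} →
            {k : ℕ} → R′ ↔ R → C′ ↔ C → Weighing R C k → Weighing R′ C′ k
  reindex {k = k} ρ γ W = record
    { entry = λ r c → entry W (to ρ r) (to γ c)
    ; ternary = λ r c → ternary W (to ρ r) (to γ c)
    ; orthogonal = λ r s →
        trans (sym (∑-↔ γ (λ c → entry W (to ρ r) c * entry W (to ρ s) c)))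
       (trans (orthogonal W (to ρ r) (to ρ s))
              (cong (+ k *_) (δ-injective (to ρ) (Injection.injective (↔⇒↣ ρ)) r s)))
    }
    where open Inverse using (to)

  Fin≡size : (A : Set) {{_ : Finite A}} → ∀ {n} → size A ≡ n → Fin n ↔ A
  Fin≡size A {{fin}} refl = Finite.enum fin

  opaque
    -- With `∑` and `δ` unfolded, orthogonality over `Fin n` is the matrix equation by definition.
    unfolding ∑

    toMatrix : {R C : Set} {{_ : Finite R}} {{_ : Finite C}} → ∀ {n k} → size R ≡ n → size C ≡ n →
               Weighing R C k → WeighingMatrixExists n k
    toMatrix {R} {C} {n} {k} r c W = entry W′ , record { entries = ternary W′ ; WWᵗ≡kI = orthogonal W′ }
      where
      W′ : Weighing (Fin n) (Fin n) k
      W′ = reindex (Fin≡size R r) (Fin≡size C c) W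

    fromMatrix : {R C : Set} {{_ : Finite R}} {{_ : Finite C}} → ∀ {n k} → size R ≡ n → size C ≡ n →
                 WeighingMatrixExists n k → Weighing R C k
    fromMatrix {R} {C} r c (W , isW) = reindex (↔-sym (Fin≡size R r)) (↔-sym (Fin≡size C c)) (record
      { entry = W ; ternary = IsWeighing.entries isW ; orthogonal = IsWeighing.WWᵗ≡kI isW })

  identity : (A : Set) {{_ : Finite A}} → Weighing A A 1
  identity A = record
    { entry = δ
    ; ternary = Ternary-δ
    ; orthogonal = λ r s → trans (∑-δ r (δ s)) (trans (δ-sym s r) (sym (ℤ.*-identityˡ _)))
    }

  δ-⊎₁ : {A B : Set} {{_ : Finite A}} {{_ : Finite B}} (x y : A) → δ {A ⊎ B} (inj₁ x) (inj₁ y) ≡ δ x y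
  δ-⊎₁ = δ-injective inj₁ λ { refl → refl }

  δ-⊎₂ : {A B : Set} {{_ : Finite A}} {{_ : Finite B}} (x y : B) → δ {A ⊎ B} (inj₂ x) (inj₂ y) ≡ δ x y
  δ-⊎₂ = δ-injective inj₂ λ { refl → refl }

  δ-× : {A B : Set} {{_ : Finite A}} {{_ : Finite B}} (x x′ : A) (y y′ : B) →
        δ (x , y) (x′ , y′) ≡ δ x x′ * δ y y′
  δ-× x x′ y y′ with x ≟ x′ | y ≟ y′
  ... | yes refl | yes refl =
    trans (δ-≡ {a = x , y} refl) (sym (cong₂ _*_ (δ-≡ {a = x} refl) (δ-≡ {a = y} refl)))
  ... | no ¬eq | _ =
    trans (δ-≢ (¬eq ∘ cong proj₁)) (sym (cong (_* δ y y′) (δ-≢ ¬eq)))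
  ... | yes _ | no ¬eq =
    trans (δ-≢ (¬eq ∘ cong proj₂)) (sym (trans (cong (δ x x′ *_) (δ-≢ ¬eq)) (ℤ.*-zeroʳ (δ x x′))))

  module _ {R C R′ C′ : Set} {{_ : Finite R}} {{_ : Finite C}} {{_ : Finite R′}} {{_ : Finite C′}} where

    infixr 7 _⊗_
    _⊗_ : ∀ {a b} → Weighing R C a → Weighing R′ C′ b → Weighing (R × R′) (C × C′) (a ℕ.* b)
    _⊗_ {a} {b} W V = record
      { entry = ent
      ; ternary = λ (r , r′) (c , c′) → Ternary-* (ternary W r c) (ternary V r′ c′)
      ; orthogonal = orth
      }
      where
      ent : R × R′ → C × C′ → ℤ
      ent (r , r′) (c , c′) = entry W r c * entry V r′ c′
      open ≡-Reasoning
      orth : ∀ r s → ∑ (λ c → ent r c * ent s c) ≡ + (a ℕ.* b) * δ r s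
      orth (r , r′) (s , s′) = begin
        ∑ (λ c → ent (r , r′) c * ent (s , s′) c)
          ≡⟨ ∑-× (λ c → ent (r , r′) c * ent (s , s′) c) ⟩
        ∑ (λ c → ∑ (λ c′ → ent (r , r′) (c , c′) * ent (s , s′) (c , c′)))
          ≡⟨ ∑-cong (λ c → ∑-cong (λ c′ →
               interchange (entry W r c) (entry V r′ c′) (entry W s c) (entry V s′ c′))) ⟩
        ∑ (λ c → ∑ (λ c′ → (entry W r c * entry W s c) * (entry V r′ c′ * entry V s′ c′)))
          ≡⟨ ∑-*-∑ (λ c → entry W r c * entry W s c) (λ c′ → entry V r′ c′ * entry V s′ c′) ⟨
        ∑ (λ c → entry W r c * entry W s c) * ∑ (λ c′ → entry V r′ c′ * entry V s′ c′)
          ≡⟨ cong₂ _*_ (orthogonal W r s) (orthogonal V r′ s′) ⟩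
        (+ a * δ r s) * (+ b * δ r′ s′)
          ≡⟨ interchange (+ a) (δ r s) (+ b) (δ r′ s′) ⟩
        (+ a * + b) * (δ r s * δ r′ s′)
          ≡⟨ cong₂ _*_ (ℤ.pos-* a b) (δ-× r s r′ s′) ⟨
        + (a ℕ.* b) * δ (r , r′) (s , s′) ∎

    infixr 6 _⊕_
    _⊕_ : ∀ {k} → Weighing R C k → Weighing R′ C′ k → Weighing (R ⊎ R′) (C ⊎ C′) k
    _⊕_ {k} W V = record { entry = ent ; ternary = tern ; orthogonal = orth }
      where
      ent : R ⊎ R′ → C ⊎ C′ → ℤ
      ent (inj₁ r) (inj₁ c) = entry W r c
      ent (inj₂ r) (inj₂ c) = entry V r c
      ent _ _ = 0ℤ
      tern : ∀ r c → Ternary (ent r c)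
      tern (inj₁ r) (inj₁ c) = ternary W r c
      tern (inj₁ r) (inj₂ c) = inj₁ refl
      tern (inj₂ r) (inj₁ c) = inj₁ refl
      tern (inj₂ r) (inj₂ c) = ternary V r c
      orth : ∀ r s → ∑ (λ c → ent r c * ent s c) ≡ + k * δ r s
      orth r s = trans (∑-⊎ (λ c → ent r c * ent s c)) (split r s)
        where
        split : ∀ r s → ∑ (λ c → ent r (inj₁ c) * ent s (inj₁ c)) +
                        ∑ (λ c → ent r (inj₂ c) * ent s (inj₂ c)) ≡ + k * δ r s
        split (inj₁ r) (inj₁ s) =
          trans (cong₂ _+_ (orthogonal W r s) (∑-zero (λ _ → refl)))
                (trans (ℤ.+-identityʳ _) (cong (+ k *_) (sym (δ-⊎₁ r s))))
        split (inj₂ r) (inj₂ s) =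
          trans (cong₂ _+_ (∑-zero (λ _ → refl)) (orthogonal V r s))
                (trans (ℤ.+-identityˡ _) (cong (+ k *_) (sym (δ-⊎₂ r s))))
        split (inj₁ r) (inj₂ s) =
          trans (cong₂ _+_ (∑-zero (λ c → ℤ.*-zeroʳ (entry W r c))) (∑-zero (λ _ → refl)))
                (sym (trans (cong (+ k *_) (δ-≢ {a = inj₁ r} {b = inj₂ s} λ ())) (ℤ.*-zeroʳ (+ k))))
        split (inj₂ r) (inj₁ s) =
          trans (cong₂ _+_ (∑-zero (λ _ → refl)) (∑-zero (λ c → ℤ.*-zeroʳ (entry V r c))))
                (sym (trans (cong (+ k *_) (δ-≢ {a = inj₂ r} {b = inj₁ s} λ ())) (ℤ.*-zeroʳ (+ k))))

  module _ {P Q S : Set} {{_ : Finite P}} {{_ : Finite Q}} {{_ : Finite S}} {α β : ℕ} where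

    -- At most one term of each entry of the matrix product AB is nonzero.
    product : (A : Weighing P Q α) (B : Weighing Q S β) →
              (∀ x z {y y′} → entry A x y * entry B y z ≢ 0ℤ → entry A x y′ * entry B y′ z ≢ 0ℤ → y ≡ y′) →
              Weighing P S (α ℕ.* β)
    product A B unique = record { entry = ent ; ternary = tern ; orthogonal = orth }
      where
      ent : P → S → ℤ
      ent x z = ∑ (λ y → entry A x y * entry B y z)
      tern : ∀ x z → Ternary (ent x z)
      tern x z with any? {P = λ y → entry A x y * entry B y z ≢ 0ℤ} (λ y → ¬? (_ ℤ.≟ _))
      ... | no none =
        inj₁ (∑-zero (λ y → decidable-stable (_ ℤ.≟ _) (λ ¬0 → none (y , ¬0))))
      ... | yes (y , ¬0) = subst Ternary
        (sym (∑-single y (λ y → entry A x y * entry B y z)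
               (λ y′ y≢y′ → decidable-stable (_ ℤ.≟ _) (y≢y′ ∘ unique x z ¬0))))
        (Ternary-* (ternary A x y) (ternary B y z))
      open ≡-Reasoning
      orth : ∀ r s → ∑ (λ z → ent r z * ent s z) ≡ + (α ℕ.* β) * δ r s
      -- This is A(BBᵗ)Aᵗ = β AAᵗ = αβ I: the sum over z is moved innermost, where the rows of B
      -- collapse it.
      orth r s = begin
        ∑ (λ z → ent r z * ent s z)
          ≡⟨ ∑-cong (λ z → trans (∑-*-∑ (λ y → entry A r y * entry B y z) (λ y → entry A s y * entry B y z))
               (∑-cong (λ y → ∑-cong (λ y′ →
                  interchange (entry A r y) (entry B y z) (entry A s y′) (entry B y′ z))))) ⟩
        ∑ (λ z → ∑ (λ y → ∑ (λ y′ → a y y′ * b y y′ z)))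
          ≡⟨ trans (∑-comm (λ z y → ∑ (λ y′ → a y y′ * b y y′ z)))
               (∑-cong (λ y → ∑-comm (λ z y′ → a y y′ * b y y′ z))) ⟩
        ∑ (λ y → ∑ (λ y′ → ∑ (λ z → a y y′ * b y y′ z)))
          ≡⟨ ∑-cong (λ y → ∑-cong (λ y′ → trans (∑-*ˡ (a y y′) (b y y′))
               (trans (cong (a y y′ *_) (orthogonal B y y′)) (x∙yz≈z∙yx (a y y′) (+ β) (δ y y′))))) ⟩
        ∑ (λ y → ∑ (λ y′ → δ y y′ * (+ β * a y y′)))
          ≡⟨ ∑-cong (λ y → ∑-δ y (λ y′ → + β * a y y′)) ⟩
        ∑ (λ y → + β * a y y)
          ≡⟨ trans (∑-*ˡ (+ β) (λ y → a y y)) (cong (+ β *_) (orthogonal A r s)) ⟩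
        + β * (+ α * δ r s)
          ≡⟨ trans (sym (ℤ.*-assoc (+ β) (+ α) (δ r s)))
               (cong (_* δ r s) (trans (ℤ.*-comm (+ β) (+ α)) (sym (ℤ.pos-* α β)))) ⟩
        + (α ℕ.* β) * δ r s ∎
        where
        a : Q → Q → ℤ
        a y y′ = entry A r y * entry A s y′
        b : Q → Q → S → ℤ
        b y y′ z = entry B y z * entry B y′ z

  -- One block has its own index type X, all others share Z: in the pattern to be woven the first
  -- row and the first column have a length of their own.
  blockOf : {X Y Z : Set} → X ⊎ (Y × Z) → Maybe Y
  blockOf (inj₁ _) = nothing
  blockOf (inj₂ (y , _)) = just y

  module _ {X Y Z : Set} {{_ : Finite X}} {{_ : Finite Y}} {{_ : Finite Z}} {α : ℕ} where

    blockDiagonal : Weighing X X α → Weighing Z Z α → Weighing (X ⊎ (Y × Z)) (X ⊎ (Y × Z)) α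
    blockDiagonal W V = W ⊕ subst (Weighing (Y × Z) (Y × Z)) (ℕ.*-identityˡ α) (identity Y ⊗ V)

    blockDiagonal-support : ∀ W V x y → entry (blockDiagonal W V) x y ≢ 0ℤ → blockOf x ≡ blockOf y
    blockDiagonal-support W V (inj₁ _) (inj₁ _) _ = refl
    blockDiagonal-support W V (inj₁ _) (inj₂ _) ¬0 = ⊥-elim (¬0 refl)
    blockDiagonal-support W V (inj₂ _) (inj₁ _) ¬0 = ⊥-elim (¬0 refl)
    blockDiagonal-support W V (inj₂ (y , z)) (inj₂ (y′ , z′)) ¬0 with y ≟ y′
    ... | yes eq = cong just eq
    ... | no ¬eq = ⊥-elim (¬0 (trans (entry-subst (ℕ.*-identityˡ α)) (cong (_* entry V z z′) (δ-≢ ¬eq))))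
      where
      entry-subst : ∀ {k} (eq : 1 ℕ.* α ≡ k) →
                    entry (subst (Weighing (Y × Z) (Y × Z)) eq (identity Y ⊗ V)) (y , z) (y′ , z′) ≡
                    δ y y′ * entry V z z′
      entry-subst refl = refl

  module _ {P X Y Z X′ Y′ Z′ : Set} {{_ : Finite P}}
           {{_ : Finite X}} {{_ : Finite Y}} {{_ : Finite Z}}
           {{_ : Finite X′}} {{_ : Finite Y′}} {{_ : Finite Z′}} where

    -- Craigen's weaving: the points of P are the ones of a 0/1 matrix, cut into rows by ρ and into
    -- columns by γ.  One factor acts inside the rows and the other inside the columns.
    weave : ∀ {α β} (ρ : P ↔ (X ⊎ (Y × Z))) (γ : P ↔ (X′ ⊎ (Y′ × Z′))) →
            (∀ {x y} → blockOf (Inverse.to ρ x) ≡ blockOf (Inverse.to ρ y) →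
                       blockOf (Inverse.to γ x) ≡ blockOf (Inverse.to γ y) → x ≡ y) →
            Weighing X X α → Weighing Z Z α → Weighing X′ X′ β → Weighing Z′ Z′ β →
            Weighing P P (α ℕ.* β)
    weave ρ γ determined W V W′ V′ = product A B unique
      where
      A = reindex ρ ρ (blockDiagonal {Y = Y} W V)
      B = reindex γ γ (blockDiagonal {Y = Y′} W′ V′)
      unique : ∀ x z {y y′} → entry A x y * entry B y z ≢ 0ℤ → entry A x y′ * entry B y′ z ≢ 0ℤ → y ≡ y′
      -- A nonzero term through y puts y in the row of x and in the column of z, and a row meets a
      -- column at most once.
      unique x z {y} {y′} ¬0 ¬0′ = determined
        (trans (sym (left y ¬0)) (left y′ ¬0′)) (trans (right y ¬0) (sym (right y′ ¬0′)))
        where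
        left : ∀ y → entry A x y * entry B y z ≢ 0ℤ → blockOf (Inverse.to ρ x) ≡ blockOf (Inverse.to ρ y)
        left y ¬0 = blockDiagonal-support W V _ _ (λ ≡0 → ¬0 (cong (_* entry B y z) ≡0))
        right : ∀ y → entry A x y * entry B y z ≢ 0ℤ → blockOf (Inverse.to γ y) ≡ blockOf (Inverse.to γ z)
        right y ¬0 = blockDiagonal-support W′ V′ _ _
          (λ ≡0 → ¬0 (trans (cong (entry A x y *_) ≡0) (ℤ.*-zeroʳ (entry A x y))))

-- Cyclic groups, Sylvester matrices and the woven circulants.

module Weaving where

  open FiniteSums
  open WeighingMatrices
  open import Algebra.Bundles using (AbelianGroup)
  open import Data.Fin as Fin using (Fin; zero; suc; toℕ)
  import Data.Fin.Properties as Fin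
  open import Data.Integer as ℤ using (ℤ; +_; 1ℤ; -1ℤ)
  open import Data.Maybe using (Maybe)
  open import Data.Nat as ℕ using (ℕ; zero; suc; _+_; _*_; _∸_; _^_; _≤_; _<_)
  import Data.Nat.Properties as ℕ
  open import Data.Maybe.Properties using (just-injective)
  open import Data.Nat.DivMod
  open import Data.Nat.Tactic.RingSolver using (solve-∀)
  open import Data.Product using (_×_; _,_; proj₁; proj₂)
  open import Data.Sum using (_⊎_; inj₁; inj₂)
  open import Data.Unit using (⊤; tt)
  open import Function using (_↔_; Inverse; mk↔ₛ′)
  open import Level using (0ℓ)
  open import Relation.Binary.PropositionalEquality

  module _ (n : ℕ) where

    private
      N = suc n

      toℕ-mod : ∀ a → toℕ (a mod N) ≡ a % N
      toℕ-mod a = Fin.toℕ-fromℕ< (m%n<n a N)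

      %-+ˡ : ∀ a b → (a % N + b) % N ≡ (a + b) % N
      %-+ˡ a b = trans (%-distribˡ-+ (a % N) b N)
        (trans (cong (λ x → (x + b % N) % N) (m%n%n≡m%n a N)) (sym (%-distribˡ-+ a b N)))

    infixl 6 _+ᶜ_
    infix 8 -ᶜ_
    _+ᶜ_ : Fin N → Fin N → Fin N
    i +ᶜ j = (toℕ i + toℕ j) mod N

    -ᶜ_ : Fin N → Fin N
    -ᶜ i = (N ∸ toℕ i) mod N

    toℕ-+ᶜ : ∀ i j → toℕ (i +ᶜ j) ≡ (toℕ i + toℕ j) % N
    toℕ-+ᶜ i j = toℕ-mod (toℕ i + toℕ j)

    private
      comm : ∀ i j → i +ᶜ j ≡ j +ᶜ i
      comm i j = cong (_mod N) (ℕ.+-comm (toℕ i) (toℕ j))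

      assoc : ∀ i j k → (i +ᶜ j) +ᶜ k ≡ i +ᶜ (j +ᶜ k)
      assoc i j k = Fin.toℕ-injective (begin
        toℕ ((i +ᶜ j) +ᶜ k)                 ≡⟨ toℕ-+ᶜ (i +ᶜ j) k ⟩
        (toℕ (i +ᶜ j) + toℕ k) % N          ≡⟨ cong (λ x → (x + toℕ k) % N) (toℕ-+ᶜ i j) ⟩
        ((toℕ i + toℕ j) % N + toℕ k) % N   ≡⟨ %-+ˡ (toℕ i + toℕ j) (toℕ k) ⟩
        (toℕ i + toℕ j + toℕ k) % N         ≡⟨ cong (_% N) (trans (ℕ.+-assoc (toℕ i) _ _) (ℕ.+-comm (toℕ i) _)) ⟩
        (toℕ j + toℕ k + toℕ i) % N         ≡⟨ %-+ˡ (toℕ j + toℕ k) (toℕ i) ⟨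
        ((toℕ j + toℕ k) % N + toℕ i) % N   ≡⟨ cong (λ x → (x + toℕ i) % N) (toℕ-+ᶜ j k) ⟨
        (toℕ (j +ᶜ k) + toℕ i) % N          ≡⟨ cong (_% N) (ℕ.+-comm _ (toℕ i)) ⟩
        (toℕ i + toℕ (j +ᶜ k)) % N          ≡⟨ toℕ-+ᶜ i (j +ᶜ k) ⟨
        toℕ (i +ᶜ (j +ᶜ k))                 ∎)
        where open ≡-Reasoning

      identityˡ : ∀ i → zero +ᶜ i ≡ i
      identityˡ i = Fin.toℕ-injective (trans (toℕ-+ᶜ zero i) (m<n⇒m%n≡m (Fin.toℕ<n i)))

      inverseˡ : ∀ i → -ᶜ i +ᶜ i ≡ zero
      inverseˡ i = Fin.toℕ-injective (begin
        toℕ (-ᶜ i +ᶜ i)               ≡⟨ toℕ-+ᶜ (-ᶜ i) i ⟩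
        (toℕ (-ᶜ i) + toℕ i) % N      ≡⟨ cong (λ x → (x + toℕ i) % N) (toℕ-mod (N ∸ toℕ i)) ⟩
        ((N ∸ toℕ i) % N + toℕ i) % N ≡⟨ %-+ˡ (N ∸ toℕ i) (toℕ i) ⟩
        (N ∸ toℕ i + toℕ i) % N       ≡⟨ cong (_% N) (ℕ.m∸n+n≡m (ℕ.<⇒≤ (Fin.toℕ<n i))) ⟩
        N % N                         ≡⟨ n%n≡0 N ⟩
        0                             ∎)
        where open ≡-Reasoning

    mod-+ᶜ : ∀ a b → (a mod N) +ᶜ (b mod N) ≡ (a + b) mod N
    mod-+ᶜ a b = Fin.toℕ-injective (begin
      toℕ ((a mod N) +ᶜ (b mod N))          ≡⟨ toℕ-+ᶜ (a mod N) (b mod N) ⟩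
      (toℕ (a mod N) + toℕ (b mod N)) % N   ≡⟨ cong₂ (λ x y → (x + y) % N) (toℕ-mod a) (toℕ-mod b) ⟩
      (a % N + b % N) % N                   ≡⟨ %-distribˡ-+ a b N ⟨
      (a + b) % N                           ≡⟨ toℕ-mod (a + b) ⟨
      toℕ ((a + b) mod N)                   ∎)
      where open ≡-Reasoning

    mod-toℕ : ∀ i → toℕ i mod N ≡ i
    mod-toℕ i = Fin.toℕ-injective (trans (toℕ-mod (toℕ i)) (m<n⇒m%n≡m (Fin.toℕ<n i)))

    mod-cong : ∀ {a b} → a % N ≡ b % N → a mod N ≡ b mod N
    mod-cong {a} {b} eq = Fin.toℕ-injective (trans (toℕ-mod a) (trans eq (sym (toℕ-mod b))))

    toℕ-mod-< : ∀ {a} → a < N → toℕ (a mod N) ≡ a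
    toℕ-mod-< {a} a<N = trans (toℕ-mod a) (m<n⇒m%n≡m a<N)

    cyclicGroup : AbelianGroup 0ℓ 0ℓ
    cyclicGroup = record
      { Carrier = Fin N ; _≈_ = _≡_ ; _∙_ = _+ᶜ_ ; ε = zero ; _⁻¹ = -ᶜ_
      ; isAbelianGroup = record
        { isGroup = record
          { isMonoid = record
            { isSemigroup = record
              { isMagma = record { isEquivalence = isEquivalence ; ∙-cong = cong₂ _+ᶜ_ }
              ; assoc = assoc }
            ; identity = identityˡ , λ i → trans (comm i zero) (identityˡ i) }
          ; inverse = inverseˡ , λ i → trans (comm i (-ᶜ i)) (inverseˡ i)
          ; ⁻¹-cong = cong -ᶜ_ }
        ; comm = comm } }

  module Cyclic (n : ℕ) where
    open import Algebra.Properties.AbelianGroup (cyclicGroup n) public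
      using (∙-cancelˡ; //-rightDividesˡ; //-rightDividesʳ)

  -- p^m + … + p + 1 = (p^(m+1) − 1)/(p − 1).
  geometric : ℕ → ℕ → ℕ
  geometric p zero = 1
  geometric p (suc m) = geometric p m * p + 1

  -- The geometric sum formula with p = t + 1, arranged so that nothing is subtracted or divided.
  1+geometric*t≡power : ∀ t m → suc (geometric (suc t) m * t) ≡ suc t ^ (m + 1)
  1+geometric*t≡power t zero = cong suc (trans (ℕ.+-identityʳ t) (sym (ℕ.*-identityʳ t)))
  1+geometric*t≡power t (suc m) = trans (expand (geometric (suc t) m) t)
                                        (cong (suc t *_) (1+geometric*t≡power t m))
    where
    expand : ∀ v t → suc ((v * suc t + 1) * t) ≡ suc t * suc (v * t)
    expand = solve-∀

  sylvester : ∀ k → WeighingMatrixExists (2 ^ k) (2 ^ k)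
  sylvester zero = toMatrix {R = ⊤} {C = ⊤} refl refl (identity ⊤)
  sylvester (suc k) = 
    toMatrix refl refl (hadamard₂ ⊗ fromMatrix {R = Fin (2 ^ k)} {C = Fin (2 ^ k)} refl refl (sylvester k))
    where
    H : Fin 2 → Fin 2 → ℤ
    H (suc zero) (suc zero) = -1ℤ
    H _ _ = 1ℤ
    hadamard₂ : Weighing (Fin 2) (Fin 2) 2
    hadamard₂ = record
      { entry = H
      ; ternary = λ { zero zero → inj₂ (inj₁ refl) ; zero (suc zero) → inj₂ (inj₁ refl)
                    ; (suc zero) zero → inj₂ (inj₁ refl) ; (suc zero) (suc zero) → inj₂ (inj₂ refl) }
      ; orthogonal = orth
      }
      where
      opaque
        unfolding ∑
        orth : ∀ r s → ∑ (λ c → H r c ℤ.* H s c) ≡ + 2 ℤ.* δ r s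
        orth zero zero = refl
        orth zero (suc zero) = refl
        orth (suc zero) zero = refl
        orth (suc zero) (suc zero) = refl

  module _ (v n t : ℕ) (t≤n : t ≤ suc n) where

    private
      V = Fin v
      N = Fin (suc n)
      S = Fin t
      -- The cells holding a one: the corner, the rest of the first row, the rest of the first
      -- column, and the cells (i, (j, s)), where row i of circulant j has its s-th one in column i
      -- + s.
      P = ⊤ ⊎ ((V × N) ⊎ (N ⊎ (N × (V × S))))
      infixl 6 _⊞_ _⊟_
      _⊞_ : N → S → N
      i ⊞ s = _+ᶜ_ n i (Fin.inject≤ s t≤n)
      _⊟_ : N → S → N
      i ⊟ s = _+ᶜ_ n i (-ᶜ_ n (Fin.inject≤ s t≤n))

      rows : P ↔ ((⊤ ⊎ (V × N)) ⊎ (N × (⊤ ⊎ (V × S))))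
      rows = mk↔ₛ′
        (λ { (inj₁ tt) → inj₁ (inj₁ tt)
           ; (inj₂ (inj₁ x)) → inj₁ (inj₂ x)
           ; (inj₂ (inj₂ (inj₁ i))) → inj₂ (i , inj₁ tt)
           ; (inj₂ (inj₂ (inj₂ (i , x)))) → inj₂ (i , inj₂ x) })
        (λ { (inj₁ (inj₁ tt)) → inj₁ tt
           ; (inj₁ (inj₂ x)) → inj₂ (inj₁ x)
           ; (inj₂ (i , inj₁ tt)) → inj₂ (inj₂ (inj₁ i))
           ; (inj₂ (i , inj₂ x)) → inj₂ (inj₂ (inj₂ (i , x))) })
        (λ { (inj₁ (inj₁ tt)) → refl ; (inj₁ (inj₂ x)) → refl
           ; (inj₂ (i , inj₁ tt)) → refl ; (inj₂ (i , inj₂ x)) → refl })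
        (λ { (inj₁ tt) → refl ; (inj₂ (inj₁ x)) → refl
           ; (inj₂ (inj₂ (inj₁ i))) → refl ; (inj₂ (inj₂ (inj₂ (i , x)))) → refl })

      columns : P ↔ ((⊤ ⊎ N) ⊎ ((V × N) × (⊤ ⊎ S)))
      columns = mk↔ₛ′
        (λ { (inj₁ tt) → inj₁ (inj₁ tt)
           ; (inj₂ (inj₁ x)) → inj₂ (x , inj₁ tt)
           ; (inj₂ (inj₂ (inj₁ i))) → inj₁ (inj₂ i)
           ; (inj₂ (inj₂ (inj₂ (i , (j , s))))) → inj₂ ((j , i ⊞ s) , inj₂ s) })
        (λ { (inj₁ (inj₁ tt)) → inj₁ tt
           ; (inj₂ (x , inj₁ tt)) → inj₂ (inj₁ x)
           ; (inj₁ (inj₂ i)) → inj₂ (inj₂ (inj₁ i))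
           ; (inj₂ ((j , i) , inj₂ s)) → inj₂ (inj₂ (inj₂ (i ⊟ s , (j , s)))) })
        (λ { (inj₁ (inj₁ tt)) → refl ; (inj₂ (x , inj₁ tt)) → refl ; (inj₁ (inj₂ i)) → refl
           ; (inj₂ ((j , i) , inj₂ s)) →
               cong (λ i → inj₂ ((j , i) , inj₂ s)) (Cyclic.//-rightDividesˡ n _ i) })
        (λ { (inj₁ tt) → refl ; (inj₂ (inj₁ x)) → refl ; (inj₂ (inj₂ (inj₁ i))) → refl
           ; (inj₂ (inj₂ (inj₂ (i , (j , s))))) →
               cong (λ i → inj₂ (inj₂ (inj₂ (i , (j , s))))) (Cyclic.//-rightDividesʳ n _ i) })

      -- A cell is known from its row and column. Within a circulant, cancelling the row index
      -- leaves the shift s modulo the size of the circulant, and t ≤ n + 1 makes distinct shifts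
      -- distinct there.
      determined : ∀ {x y} → blockOf (Inverse.to rows x) ≡ blockOf (Inverse.to rows y) →
                   blockOf (Inverse.to columns x) ≡ blockOf (Inverse.to columns y) → x ≡ y
      determined {inj₁ tt} {inj₁ tt} _ _ = refl
      determined {inj₁ tt} {inj₂ (inj₁ _)} _ ()
      determined {inj₁ tt} {inj₂ (inj₂ (inj₁ _))} ()
      determined {inj₁ tt} {inj₂ (inj₂ (inj₂ _))} ()
      determined {inj₂ (inj₁ _)} {inj₁ tt} _ ()
      determined {inj₂ (inj₁ x)} {inj₂ (inj₁ .x)} _ refl = refl
      determined {inj₂ (inj₁ x)} {inj₂ (inj₂ (inj₁ _))} ()
      determined {inj₂ (inj₁ x)} {inj₂ (inj₂ (inj₂ _))} ()
      determined {inj₂ (inj₂ (inj₁ _))} {inj₁ tt} ()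
      determined {inj₂ (inj₂ (inj₁ _))} {inj₂ (inj₁ _)} ()
      determined {inj₂ (inj₂ (inj₁ i))} {inj₂ (inj₂ (inj₁ .i))} refl _ = refl
      determined {inj₂ (inj₂ (inj₁ _))} {inj₂ (inj₂ (inj₂ _))} _ ()
      determined {inj₂ (inj₂ (inj₂ _))} {inj₁ tt} ()
      determined {inj₂ (inj₂ (inj₂ _))} {inj₂ (inj₁ _)} ()
      determined {inj₂ (inj₂ (inj₂ _))} {inj₂ (inj₂ (inj₁ _))} _ ()
      determined {inj₂ (inj₂ (inj₂ (i , j , s)))} {inj₂ (inj₂ (inj₂ (i′ , j′ , s′)))} eq eq′
        with just-injective eq | just-injective eq′
      ... | refl | eq″ with cong proj₁ eq″ | Fin.inject≤-injective t≤n t≤n s s′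
                              (Cyclic.∙-cancelˡ n i _ _ (cong proj₂ eq″))
      ... | refl | refl = refl

    -- The ones of the matrix are a full first row, a full first column, and v circulants of weight t.
    weave-circulants : ∀ {α β} →
      WeighingMatrixExists (v * suc n + 1) α → WeighingMatrixExists (suc (v * t)) α →
      WeighingMatrixExists (suc (suc n)) β → WeighingMatrixExists (suc t) β →
      WeighingMatrixExists ((v * suc t + 1) * suc n + 1) (α * β)
    weave-circulants {α} {β} W H W′ H′ = toMatrix {R = P} {C = P} size-P size-P woven
      where
      woven : Weighing P P (α * β)
      -- `W` acts on the first row and `H` on every other row; `W′` acts on the first column and
      -- `H′` on every other column.
      woven = weave {Y = N} {Y′ = V × N} rows columns (λ {x} {y} → determined {x} {y})
        (fromMatrix {R = ⊤ ⊎ (V × N)} {C = ⊤ ⊎ (V × N)} (ℕ.+-comm 1 _) (ℕ.+-comm 1 _) W)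
        (fromMatrix {R = ⊤ ⊎ (V × S)} {C = ⊤ ⊎ (V × S)} refl refl H)
        (fromMatrix {R = ⊤ ⊎ N} {C = ⊤ ⊎ N} refl refl W′)
        (fromMatrix {R = ⊤ ⊎ S} {C = ⊤ ⊎ S} refl refl H′)
      count : ∀ v n t → 1 + (v * suc n + (suc n + suc n * (v * t))) ≡ (v * suc t + 1) * suc n + 1
      count = solve-∀
      size-P : size P ≡ (v * suc t + 1) * suc n + 1
      size-P = count v n t

-- Splitting a weighing matrix along a column, and concatenating its rows along a code.

module Concatenation where

  open FiniteSums
  open WeighingMatrices
  open import Data.Empty using (⊥-elim)
  open import Data.Fin as Fin using (Fin; zero; suc)
  import Data.Fin.Properties as Fin
  open import Data.Integer as ℤ using (ℤ; +_; 0ℤ; 1ℤ; -1ℤ; _+_; _*_; -_; _-_)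
  import Data.Integer.Properties as ℤ
  open import Algebra.Properties.CommutativeSemigroup ℤ.*-commutativeSemigroup
    using (interchange; x∙yz≈z∙yx; x∙yz≈y∙xz)
  open import Data.Integer.Tactic.RingSolver using (solve-∀)
  open import Data.Nat as ℕ using (ℕ; zero; suc)
  open import Data.Product using (_×_; _,_; ∃)
  open import Data.Sum as Sum using (_⊎_; inj₁; inj₂)
  open import Data.Unit using (⊤; tt)
  open import Function using (_∘_; _↔_; Inverse; mk↔ₛ′)
  open import Data.Fin.Permutation using (↔⇒≡)
  open import Function.Construct.Composition using (_↔-∘_)
  open import Function.Construct.Identity using (↔-id)
  open import Relation.Binary.PropositionalEquality
  open import Relation.Nullary using (Dec; yes; no; ¬_)
  open import Relation.Nullary.Decidable using (¬?; decidable-stable)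

  open Weighing

  nonneg-square : ∀ x → 0ℤ ℤ.≤ x * x
  nonneg-square x@(+ n) = subst (0ℤ ℤ.≤_) (ℤ.pos-* n n) (ℤ.+≤+ ℕ.z≤n)
  nonneg-square x@(ℤ.-[1+ n ]) = ℤ.+≤+ ℕ.z≤n

  -- Deleting the term at `a` leaves nonnegative terms whose sum is `- f a`, so `f a` is also at
  -- most zero.
  ∑-nonneg-zero : {A : Set} {{_ : Finite A}} (f : A → ℤ) → (∀ x → 0ℤ ℤ.≤ f x) → ∑ f ≡ 0ℤ → ∀ x → f x ≡ 0ℤ
  ∑-nonneg-zero f f≥0 ∑f≡0 a = ℤ.≤-antisym fa≤0 (f≥0 a)
    where
    rest≥0 : ∀ x → 0ℤ ℤ.≤ f x - δ a x * f x
    rest≥0 x with a ≟ x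
    ... | yes eq = ℤ.≤-reflexive (sym (trans (cong (λ d → f x - d * f x) (δ-≡ eq)) (lemma (f x))))
      where
      lemma : ∀ y → y - 1ℤ * y ≡ 0ℤ
      lemma = solve-∀
    ... | no ¬eq = subst (0ℤ ℤ.≤_) (sym (trans (cong (λ d → f x - d * f x) (δ-≢ ¬eq)) (lemma (f x)))) (f≥0 x)
      where
      lemma : ∀ y → y - 0ℤ * y ≡ y
      lemma = solve-∀
    ∑rest : ∑ (λ x → f x - δ a x * f x) ≡ 0ℤ - f a
    ∑rest = trans (∑-+ f (λ x → - (δ a x * f x)))
                  (cong₂ _+_ ∑f≡0 (trans (∑-neg (λ x → δ a x * f x)) (cong -_ (∑-δ a f))))
    fa≤0 : f a ℤ.≤ 0ℤ
    fa≤0 = ℤ.0≤i-j⇒j≤i (subst (0ℤ ℤ.≤_) ∑rest (∑-nonneg _ rest≥0))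

  Ternary-square : ∀ {x} → Ternary x → x ≢ 0ℤ → x * x ≡ 1ℤ
  Ternary-square (inj₁ eq) ¬0 = ⊥-elim (¬0 eq)
  Ternary-square (inj₂ (inj₁ refl)) _ = refl
  Ternary-square (inj₂ (inj₂ refl)) _ = refl

  module _ {R C : Set} {{_ : Finite R}} {{_ : Finite C}} {p : ℕ} {{_ : ℕ.NonZero p}} where

    private
      instance
        +p-positive : ℤ.Positive (+ p)
        +p-positive = ℤ.positive (ℤ.+<+ (ℕ.>-nonZero⁻¹ p))

    module _ (W : Weighing R C p) where

      -- The left-hand side is |p e_j - Σ_i W_ij W_i|² for the rows W_i.
      bessel : ∀ j → 0ℤ ℤ.≤ + p * (+ p - ∑ (λ i → entry W i j * entry W i j))
      bessel j = subst (0ℤ ℤ.≤_) ∑u² (∑-nonneg _ (λ c → nonneg-square (u c)))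
        where
        w = ∑ (λ i → entry W i j * entry W i j)
        s : C → ℤ
        s c = ∑ (λ i → entry W i j * entry W i c)
        u : C → ℤ
        u c = δ j c * + p - s c
        open ≡-Reasoning
        -- The squared length of Σ_i W_ij W_i, whose cross terms vanish because the rows are
        -- orthogonal.
        ∑s² : ∑ (λ c → s c * s c) ≡ + p * w
        ∑s² = begin
          ∑ (λ c → s c * s c)
            ≡⟨ ∑-cong (λ c → trans (∑-*-∑ (λ i → entry W i j * entry W i c) (λ i → entry W i j * entry W i c))
                 (∑-cong (λ i → ∑-cong (λ i′ →
                    interchange (entry W i j) (entry W i c) (entry W i′ j) (entry W i′ c))))) ⟩
          ∑ (λ c → ∑ (λ i → ∑ (λ i′ → (entry W i j * entry W i′ j) * (entry W i c * entry W i′ c))))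
            ≡⟨ trans (∑-comm (λ c i → ∑ (λ i′ → (entry W i j * entry W i′ j) * (entry W i c * entry W i′ c))))
                 (∑-cong (λ i → ∑-comm (λ c i′ → (entry W i j * entry W i′ j) * (entry W i c * entry W i′ c)))) ⟩
          ∑ (λ i → ∑ (λ i′ → ∑ (λ c → (entry W i j * entry W i′ j) * (entry W i c * entry W i′ c))))
            ≡⟨ ∑-cong (λ i → ∑-cong (λ i′ →
                 trans (∑-*ˡ (entry W i j * entry W i′ j) (λ c → entry W i c * entry W i′ c))
                (trans (cong (entry W i j * entry W i′ j *_) (orthogonal W i i′))
                       (x∙yz≈z∙yx (entry W i j * entry W i′ j) (+ p) (δ i i′))))) ⟩
          ∑ (λ i → ∑ (λ i′ → δ i i′ * (+ p * (entry W i j * entry W i′ j))))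
            ≡⟨ ∑-cong (λ i → ∑-δ i (λ i′ → + p * (entry W i j * entry W i′ j))) ⟩
          ∑ (λ i → + p * (entry W i j * entry W i j))
            ≡⟨ ∑-*ˡ (+ p) (λ i → entry W i j * entry W i j) ⟩
          + p * w ∎
        expand : ∀ d p s → (d * p - s) * (d * p - s) ≡ d * (p * (d * p - s - s)) + s * s
        expand = solve-∀
        collect : ∀ p w → p * (1ℤ * p - w - w) + p * w ≡ p * (p - w)
        collect = solve-∀
        ∑u² : ∑ (λ c → u c * u c) ≡ + p * (+ p - w)
        ∑u² = begin
          ∑ (λ c → u c * u c)
            ≡⟨ ∑-cong (λ c → expand (δ j c) (+ p) (s c)) ⟩
          ∑ (λ c → δ j c * (+ p * (δ j c * + p - s c - s c)) + s c * s c)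
            ≡⟨ ∑-+ (λ c → δ j c * (+ p * (δ j c * + p - s c - s c))) (λ c → s c * s c) ⟩
          ∑ (λ c → δ j c * (+ p * (δ j c * + p - s c - s c))) + ∑ (λ c → s c * s c)
            ≡⟨ cong₂ _+_ (∑-δ j (λ c → + p * (δ j c * + p - s c - s c))) ∑s² ⟩
          + p * (δ j j * + p - w - w) + + p * w
            ≡⟨ cong (λ d → + p * (d * + p - w - w) + + p * w) (δ-≡ {a = j} refl) ⟩
          + p * (1ℤ * + p - w - w) + + p * w
            ≡⟨ collect (+ p) w ⟩
          + p * (+ p - w) ∎

      -- `bessel` bounds every column weight by p, while counting by rows shows that the weights
      -- total p times the number of rows. As there are equally many columns, no deficit is
      -- possible. This yields the diagonal of WᵗW = pI without inverting a matrix.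
      column-weight : size R ≡ size C → ∀ j → ∑ (λ i → entry W i j * entry W i j) ≡ + p
      column-weight R≡C j =
        sym (ℤ.i-j≡0⇒i≡j (+ p) _ (∑-nonneg-zero deficit deficit≥0 ∑deficit j))
        where
        weight : C → ℤ
        weight j = ∑ (λ i → entry W i j * entry W i j)
        deficit : C → ℤ
        deficit j = + p - weight j
        deficit≥0 : ∀ j → 0ℤ ℤ.≤ deficit j
        deficit≥0 j = ℤ.*-cancelˡ-≤-pos 0ℤ (deficit j) (+ p)
          (subst (ℤ._≤ + p * deficit j) (sym (ℤ.*-zeroʳ (+ p))) (bessel j))
        open ≡-Reasoning
        ∑weight : ∑ weight ≡ + size C * + p
        ∑weight = begin
          ∑ weight
            ≡⟨ ∑-comm (λ j i → entry W i j * entry W i j) ⟩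
          ∑ (λ i → ∑ (λ j → entry W i j * entry W i j))
            ≡⟨ ∑-cong (λ i → trans (orthogonal W i i)
                 (trans (cong (+ p *_) (δ-≡ {a = i} refl)) (ℤ.*-identityʳ (+ p)))) ⟩
          ∑ {R} (λ _ → + p)
            ≡⟨ ∑-const {R} (+ p) ⟩
          + size R * + p
            ≡⟨ cong (λ n → + n * + p) R≡C ⟩
          + size C * + p ∎
        ∑deficit : ∑ deficit ≡ 0ℤ
        ∑deficit = begin
          ∑ deficit                     ≡⟨ ∑-+ (λ _ → + p) (λ j → - weight j) ⟩
          ∑ {C} (λ _ → + p) + ∑ (λ j → - weight j)
                                        ≡⟨ cong₂ _+_ (∑-const {C} (+ p)) (∑-neg weight) ⟩
          + size C * + p - ∑ weight     ≡⟨ cong (λ x → + size C * + p - x) ∑weight ⟩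
          + size C * + p - + size C * + p ≡⟨ ℤ.i≡j⇒i-j≡0 {+ size C * + p} refl ⟩
          0ℤ ∎

  -- A bijection rather than two sublists, so that it can permute the rows of a matrix through
  -- `reindex`.
  record Partition {n : ℕ} (P : Fin n → Set) : Set where
    field
      {#yes #no} : ℕ
      split : (Fin #yes ⊎ Fin #no) ↔ Fin n
      holds : ∀ x → P (Inverse.to split (inj₁ x))
      fails : ∀ y → ¬ P (Inverse.to split (inj₂ y))

  partition : ∀ {n} {P : Fin n → Set} → (∀ i → Dec (P i)) → Partition P
  partition {zero} P? = record
    { #yes = 0 ; #no = 0
    ; split = mk↔ₛ′ (λ { (inj₁ ()) ; (inj₂ ()) }) (λ ()) (λ ()) (λ { (inj₁ ()) ; (inj₂ ()) })
    ; holds = λ () ; fails = λ () }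
  partition {suc n} {P} P? with partition (P? ∘ suc) | P? zero
  ... | record { #yes = a ; #no = b ; split = e ; holds = h ; fails = f } | yes p = record
    { split = mk↔ₛ′ to from to-from from-to
    ; holds = λ { zero → p ; (suc x) → h x } ; fails = f }
    where
    to : Fin (suc a) ⊎ Fin b → Fin (suc n)
    to (inj₁ zero) = zero
    to (inj₁ (suc x)) = suc (Inverse.to e (inj₁ x))
    to (inj₂ y) = suc (Inverse.to e (inj₂ y))
    from : Fin (suc n) → Fin (suc a) ⊎ Fin b
    from zero = inj₁ zero
    from (suc i) = Sum.map₁ suc (Inverse.from e i)
    to-from : ∀ i → to (from i) ≡ i
    to-from zero = refl
    to-from (suc i) with Inverse.from e i | Inverse.strictlyInverseˡ e i
    ... | inj₁ x | eq = cong suc eq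
    ... | inj₂ y | eq = cong suc eq
    from-to : ∀ x → from (to x) ≡ x
    from-to (inj₁ zero) = refl
    from-to (inj₁ (suc x)) = cong (Sum.map₁ suc) (Inverse.strictlyInverseʳ e (inj₁ x))
    from-to (inj₂ y) = cong (Sum.map₁ suc) (Inverse.strictlyInverseʳ e (inj₂ y))
  ... | record { #yes = a ; #no = b ; split = e ; holds = h ; fails = f } | no ¬p = record
    { split = mk↔ₛ′ to from to-from from-to
    ; holds = h ; fails = λ { zero → ¬p ; (suc y) → f y } }
    where
    to : Fin a ⊎ Fin (suc b) → Fin (suc n)
    to (inj₂ zero) = zero
    to (inj₂ (suc y)) = suc (Inverse.to e (inj₂ y))
    to (inj₁ x) = suc (Inverse.to e (inj₁ x))
    from : Fin (suc n) → Fin a ⊎ Fin (suc b)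
    from zero = inj₂ zero
    from (suc i) = Sum.map₂ suc (Inverse.from e i)
    to-from : ∀ i → to (from i) ≡ i
    to-from zero = refl
    to-from (suc i) with Inverse.from e i | Inverse.strictlyInverseˡ e i
    ... | inj₁ x | eq = cong suc eq
    ... | inj₂ y | eq = cong suc eq
    from-to : ∀ x → from (to x) ≡ x
    from-to (inj₂ zero) = refl
    from-to (inj₂ (suc y)) = cong (Sum.map₂ suc) (Inverse.strictlyInverseʳ e (inj₂ y))
    from-to (inj₁ x) = cong (Sum.map₂ suc) (Inverse.strictlyInverseʳ e (inj₁ x))

  -- An equidistant code: the (v - 1)/p agreements of two distinct words are stated without the
  -- denominator, in the shape in which they enter the product of two codeword rows.
  record Code (X V : Set) {{_ : Finite X}} {{_ : Finite V}} (p : ℕ) : Set where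
    field
      letter : X → V → Fin p
      agreements : ∀ {x y} → x ≢ y → + p * ∑ (λ j → δ (letter x j) (letter y j)) + 1ℤ ≡ + size V

  -- A weighing matrix split along its first column, normalised to entries 0 and 1: the rows with
  -- a leading 1 continue with a row of D, the others with a row of E.
  record Split (C : Set) {{_ : Finite C}} (p d : ℕ) : Set where
    field
      D : Fin p → C → ℤ
      E : Fin d → C → ℤ
      D-ternary : ∀ a c → Ternary (D a c)
      E-ternary : ∀ b c → Ternary (E b c)
      DD : ∀ a a′ → ∑ (λ c → D a c * D a′ c) ≡ + p * δ a a′ - 1ℤ
      DE : ∀ a b → ∑ (λ c → D a c * E b c) ≡ 0ℤ
      EE : ∀ b b′ → ∑ (λ c → E b c * E b′ c) ≡ + p * δ b b′

  module _ {C : Set} {{_ : Finite C}} {p a b : ℕ} (W : Weighing (Fin a ⊎ Fin b) (⊤ ⊎ C) p) where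

    private
      first : Fin a ⊎ Fin b → ℤ
      first i = entry W i (inj₁ tt)

      rest : Fin a ⊎ Fin b → C → ℤ
      rest i c = entry W i (inj₂ c)

      rest-product : ∀ i j → ∑ (λ c → rest i c * rest j c) ≡ + p * δ i j - first i * first j
      rest-product i j = begin
        ∑ (λ c → rest i c * rest j c)
          ≡⟨ shift (first i * first j) _ ⟩
        first i * first j + ∑ (λ c → rest i c * rest j c) - first i * first j
          ≡⟨ cong (_- first i * first j) (begin
               first i * first j + ∑ (λ c → rest i c * rest j c)
                 ≡⟨ cong (_+ ∑ (λ c → rest i c * rest j c)) (∑-⊤ _) ⟨
               ∑ {⊤} (λ _ → first i * first j) + ∑ (λ c → rest i c * rest j c)
                 ≡⟨ ∑-⊎ (λ c → entry W i c * entry W j c) ⟨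
               ∑ (λ c → entry W i c * entry W j c)
                 ≡⟨ orthogonal W i j ⟩
               + p * δ i j ∎) ⟩
        + p * δ i j - first i * first j ∎
        where
        open ≡-Reasoning
        shift : ∀ x y → y ≡ x + y - x
        shift = solve-∀

    -- A leading entry is ±1, so multiplying its row by it makes the row start with 1. Cutting off
    -- the first column then lowers the products of such rows by 1 and leaves all products with the
    -- other rows unchanged.
    splitRows : (∀ x → first (inj₁ x) ≢ 0ℤ) → (∀ y → first (inj₂ y) ≡ 0ℤ) → a ≡ p → Split C p b
    splitRows nonzero vanishes refl = record
      { D = λ x c → f x * rest (inj₁ x) c
      ; E = λ y c → rest (inj₂ y) c
      ; D-ternary = λ x c → Ternary-* (ternary W _ _) (ternary W _ _)
      ; E-ternary = λ y c → ternary W _ _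
      ; DD = λ x x′ → begin
          ∑ (λ c → (f x * rest (inj₁ x) c) * (f x′ * rest (inj₁ x′) c))
            ≡⟨ ∑-cong (λ c → interchange (f x) (rest (inj₁ x) c) (f x′) (rest (inj₁ x′) c)) ⟩
          ∑ (λ c → (f x * f x′) * (rest (inj₁ x) c * rest (inj₁ x′) c))
            ≡⟨ ∑-*ˡ (f x * f x′) (λ c → rest (inj₁ x) c * rest (inj₁ x′) c) ⟩
          (f x * f x′) * ∑ (λ c → rest (inj₁ x) c * rest (inj₁ x′) c)
            ≡⟨ cong (f x * f x′ *_) (rest-product (inj₁ x) (inj₁ x′)) ⟩
          (f x * f x′) * (+ p * δ (inj₁ x) (inj₁ x′) - f x * f x′)
            ≡⟨ cong (λ d → (f x * f x′) * (+ p * d - f x * f x′)) (δ-⊎₁ x x′) ⟩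
          (f x * f x′) * (+ p * δ x x′ - f x * f x′)
            ≡⟨ regroup (f x) (f x′) (+ p) (δ x x′) ⟩
          + p * ((f x * f x′) * δ x x′) - (f x * f x) * (f x′ * f x′)
            ≡⟨ cong₂ (λ u v → + p * u - v) (diagonal x x′) (cong₂ _*_ (square x) (square x′)) ⟩
          + p * δ x x′ - 1ℤ ∎
      ; DE = λ x y → begin
          ∑ (λ c → (f x * rest (inj₁ x) c) * rest (inj₂ y) c)
            ≡⟨ ∑-cong (λ c → ℤ.*-assoc (f x) (rest (inj₁ x) c) (rest (inj₂ y) c)) ⟩
          ∑ (λ c → f x * (rest (inj₁ x) c * rest (inj₂ y) c))
            ≡⟨ ∑-*ˡ (f x) (λ c → rest (inj₁ x) c * rest (inj₂ y) c) ⟩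
          f x * ∑ (λ c → rest (inj₁ x) c * rest (inj₂ y) c)
            ≡⟨ cong (f x *_) (rest-product (inj₁ x) (inj₂ y)) ⟩
          f x * (+ p * δ (inj₁ x) (inj₂ y) - f x * first (inj₂ y))
            ≡⟨ cong₂ (λ u v → f x * (+ p * u - f x * v)) (δ-≢ {a = inj₁ x} {b = inj₂ y} λ ()) (vanishes y) ⟩
          f x * (+ p * 0ℤ - f x * 0ℤ)
            ≡⟨ annihilate (f x) (+ p) ⟩
          0ℤ ∎
      ; EE = λ y y′ → begin
          ∑ (λ c → rest (inj₂ y) c * rest (inj₂ y′) c)
            ≡⟨ rest-product (inj₂ y) (inj₂ y′) ⟩
          + p * δ (inj₂ y) (inj₂ y′) - first (inj₂ y) * first (inj₂ y′)
            ≡⟨ cong₂ (λ u v → + p * u - v * first (inj₂ y′)) (δ-⊎₂ y y′) (vanishes y) ⟩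
          + p * δ y y′ - 0ℤ * first (inj₂ y′)
            ≡⟨ drop (+ p * δ y y′) (first (inj₂ y′)) ⟩
          + p * δ y y′ ∎
      }
      where
      open ≡-Reasoning
      f : Fin a → ℤ
      f x = first (inj₁ x)
      square : ∀ x → f x * f x ≡ 1ℤ
      square x = Ternary-square (ternary W _ _) (nonzero x)
      diagonal : ∀ x x′ → (f x * f x′) * δ x x′ ≡ δ x x′
      diagonal x x′ with x ≟ x′
      ... | yes refl = trans (cong (_* δ x x) (square x)) (ℤ.*-identityˡ (δ x x))
      ... | no ¬eq = trans (cong (f x * f x′ *_) (δ-≢ ¬eq)) (trans (ℤ.*-zeroʳ (f x * f x′)) (sym (δ-≢ ¬eq)))
      regroup : ∀ x y p d → (x * y) * (p * d - x * y) ≡ p * ((x * y) * d) - (x * x) * (y * y)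
      regroup = solve-∀
      annihilate : ∀ x p → x * (p * 0ℤ - x * 0ℤ) ≡ 0ℤ
      annihilate = solve-∀
      drop : ∀ x y → x - 0ℤ * y ≡ x
      drop = solve-∀

  -- For entries 0 and ±1 the sum of squares of the first column counts its nonzero entries, so
  -- `column-weight` says that there are p of them: as many rows of D as a code has letters.
  splitFirst : ∀ {c p} {{_ : ℕ.NonZero p}} → Weighing (Fin (suc c)) (⊤ ⊎ Fin c) p →
               ∃ λ d → p ℕ.+ d ≡ suc c × Split (Fin c) p d
  splitFirst {c} {p} W with partition (λ i → ¬? (entry W i (inj₁ tt) ℤ.≟ 0ℤ))
  ... | record { #yes = a ; #no = b ; split = e ; holds = nonzero ; fails = f } =
    b , trans (cong (ℕ._+ b) (sym a≡p)) (↔⇒≡ (e ↔-∘ Fin.+↔⊎)) , splitRows W′ nonzero vanishes a≡p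
    where
    W′ : Weighing (Fin a ⊎ Fin b) (⊤ ⊎ Fin c) p
    W′ = reindex e (↔-id _) W
    vanishes : ∀ y → entry W′ (inj₂ y) (inj₁ tt) ≡ 0ℤ
    vanishes y = decidable-stable (_ ℤ.≟ _) (f y)
    square : Fin (suc c) → ℤ
    square i = entry W i (inj₁ tt) * entry W i (inj₁ tt)
    open ≡-Reasoning
    a≡p : a ≡ p
    a≡p = ℤ.+-injective (begin
      + a
        ≡⟨ trans (ℤ.+-identityʳ _) (ℤ.*-identityʳ (+ a)) ⟨
      + a * 1ℤ + 0ℤ
        ≡⟨ cong₂ _+_ (trans (∑-cong (λ x → Ternary-square (ternary W _ _) (nonzero x))) (∑-const {Fin a} 1ℤ))
             (∑-zero (λ y → cong (λ x → x * x) (vanishes y))) ⟨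
      ∑ (λ x → square (Inverse.to e (inj₁ x))) + ∑ (λ y → square (Inverse.to e (inj₂ y)))
        ≡⟨ ∑-⊎ (λ x → square (Inverse.to e x)) ⟨
      ∑ (λ x → square (Inverse.to e x))
        ≡⟨ ∑-↔ e square ⟨
      ∑ square
        ≡⟨ column-weight W refl (inj₁ tt) ⟩
      + p ∎)

  module _ {X V C : Set} {{_ : Finite X}} {{_ : Finite V}} {{_ : Finite C}} {p d α : ℕ} where

    -- Rows (1 | D_{x_1} | … | D_{x_v}) for the codewords x, and rows (0 | A ⊗ E).
    concatenate : Code X V p → Weighing V V α → Split C p d →
                  1 ℕ.+ size V ℕ.* p ≡ α ℕ.* p ℕ.+ size V →
                  Weighing (X ⊎ (V × Fin d)) (⊤ ⊎ (V × C)) (α ℕ.* p)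
    concatenate code A split weight = record { entry = ent ; ternary = tern ; orthogonal = orth }
      where
      open Code code
      open Split split
      ent : X ⊎ (V × Fin d) → ⊤ ⊎ (V × C) → ℤ
      ent (inj₁ x) (inj₁ tt) = 1ℤ
      ent (inj₁ x) (inj₂ (j , c)) = D (letter x j) c
      ent (inj₂ _) (inj₁ tt) = 0ℤ
      ent (inj₂ (i , b)) (inj₂ (j , c)) = entry A i j * E b c
      tern : ∀ r c → Ternary (ent r c)
      tern (inj₁ x) (inj₁ tt) = inj₂ (inj₁ refl)
      tern (inj₁ x) (inj₂ (j , c)) = D-ternary (letter x j) c
      tern (inj₂ _) (inj₁ tt) = inj₁ refl
      tern (inj₂ (i , b)) (inj₂ (j , c)) = Ternary-* (ternary A i j) (E-ternary b c)

      K = + (α ℕ.* p)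
      v = + size V
      open ≡-Reasoning

      expand : ∀ r s → ∑ (λ c → ent r c * ent s c) ≡
               ent r (inj₁ tt) * ent s (inj₁ tt) + ∑ (λ j → ∑ (λ c → ent r (inj₂ (j , c)) * ent s (inj₂ (j , c))))
      expand r s = trans (∑-⊎ (λ c → ent r c * ent s c))
        (cong₂ _+_ (∑-⊤ _) (∑-× (λ c → ent r (inj₂ c) * ent s (inj₂ c))))

      -- By `DD` an agreement contributes p - 1 and a disagreement -1; the leading entries add 1.
      words : ∀ x y → ∑ (λ c → ent (inj₁ x) c * ent (inj₁ y) c) ≡
                      + p * ∑ (λ j → δ (letter x j) (letter y j)) + 1ℤ - v
      words x y = begin
        ∑ (λ c → ent (inj₁ x) c * ent (inj₁ y) c)
          ≡⟨ expand (inj₁ x) (inj₁ y) ⟩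
        1ℤ + ∑ (λ j → ∑ (λ c → D (letter x j) c * D (letter y j) c))
          ≡⟨ cong (_+_ 1ℤ) (trans (∑-cong (λ j → DD (letter x j) (letter y j)))
               (trans (∑-+ (λ j → + p * δ (letter x j) (letter y j)) (λ _ → -1ℤ))
                      (cong₂ _+_ (∑-*ˡ (+ p) (λ j → δ (letter x j) (letter y j))) (∑-const {V} -1ℤ)))) ⟩
        1ℤ + (+ p * ∑ (λ j → δ (letter x j) (letter y j)) + v * -1ℤ)
          ≡⟨ collect (+ p * ∑ (λ j → δ (letter x j) (letter y j))) v ⟩
        + p * ∑ (λ j → δ (letter x j) (letter y j)) + 1ℤ - v ∎
        where
        collect : ∀ s v → 1ℤ + (s + v * -1ℤ) ≡ s + 1ℤ - v
        collect = solve-∀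

      mixed : ∀ x i b → ∑ (λ c → ent (inj₁ x) c * ent (inj₂ (i , b)) c) ≡ 0ℤ
      mixed x i b = begin
        ∑ (λ c → ent (inj₁ x) c * ent (inj₂ (i , b)) c)
          ≡⟨ expand (inj₁ x) (inj₂ (i , b)) ⟩
        0ℤ + ∑ (λ j → ∑ (λ c → D (letter x j) c * (entry A i j * E b c)))
          ≡⟨ ℤ.+-identityˡ _ ⟩
        ∑ (λ j → ∑ (λ c → D (letter x j) c * (entry A i j * E b c)))
          ≡⟨ ∑-zero (λ j → begin
               ∑ (λ c → D (letter x j) c * (entry A i j * E b c))
                 ≡⟨ ∑-cong (λ c → x∙yz≈y∙xz (D (letter x j) c) (entry A i j) (E b c)) ⟩
               ∑ (λ c → entry A i j * (D (letter x j) c * E b c))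
                 ≡⟨ ∑-*ˡ (entry A i j) (λ c → D (letter x j) c * E b c) ⟩
               entry A i j * ∑ (λ c → D (letter x j) c * E b c)
                 ≡⟨ cong (entry A i j *_) (DE (letter x j) b) ⟩
               entry A i j * 0ℤ
                 ≡⟨ ℤ.*-zeroʳ (entry A i j) ⟩
               0ℤ ∎) ⟩
        0ℤ ∎

      tails : ∀ i b i′ b′ → ∑ (λ c → ent (inj₂ (i , b)) c * ent (inj₂ (i′ , b′)) c) ≡
                            K * (δ i i′ * δ b b′)
      tails i b i′ b′ = begin
        ∑ (λ c → ent (inj₂ (i , b)) c * ent (inj₂ (i′ , b′)) c)
          ≡⟨ expand (inj₂ (i , b)) (inj₂ (i′ , b′)) ⟩
        0ℤ + ∑ (λ j → ∑ (λ c → (entry A i j * E b c) * (entry A i′ j * E b′ c)))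
          ≡⟨ trans (ℤ.+-identityˡ _) (∑-cong (λ j → ∑-cong (λ c →
               interchange (entry A i j) (E b c) (entry A i′ j) (E b′ c)))) ⟩
        ∑ (λ j → ∑ (λ c → (entry A i j * entry A i′ j) * (E b c * E b′ c)))
          ≡⟨ ∑-*-∑ (λ j → entry A i j * entry A i′ j) (λ c → E b c * E b′ c) ⟨
        ∑ (λ j → entry A i j * entry A i′ j) * ∑ (λ c → E b c * E b′ c)
          ≡⟨ cong₂ _*_ (orthogonal A i i′) (EE b b′) ⟩
        (+ α * δ i i′) * (+ p * δ b b′)
          ≡⟨ interchange (+ α) (δ i i′) (+ p) (δ b b′) ⟩
        (+ α * + p) * (δ i i′ * δ b b′)
          ≡⟨ cong (_* (δ i i′ * δ b b′)) (ℤ.pos-* α p) ⟨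
        K * (δ i i′ * δ b b′) ∎

      -- A codeword agrees with itself in all v places; subtracting v gives the weight 1 + v(p - 1)
      -- of its row, which has to be αp.
      weight-ℤ : + p * (v * 1ℤ) + 1ℤ ≡ K + v
      weight-ℤ = begin
        + p * (v * 1ℤ) + 1ℤ         ≡⟨ cong (λ x → + p * x + 1ℤ) (ℤ.*-identityʳ v) ⟩
        + p * v + 1ℤ                ≡⟨ cong (_+ 1ℤ) (ℤ.*-comm (+ p) v) ⟩
        v * + p + 1ℤ                ≡⟨ cong (_+ 1ℤ) (ℤ.pos-* (size V) p) ⟨
        + (size V ℕ.* p) + 1ℤ       ≡⟨ ℤ.+-comm (+ (size V ℕ.* p)) 1ℤ ⟩
        1ℤ + + (size V ℕ.* p)       ≡⟨ ℤ.pos-+ 1 (size V ℕ.* p) ⟨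
        + (1 ℕ.+ size V ℕ.* p)      ≡⟨ cong +_ weight ⟩
        + (α ℕ.* p ℕ.+ size V)      ≡⟨ ℤ.pos-+ (α ℕ.* p) (size V) ⟩
        K + v                       ∎

      orth : ∀ r s → ∑ (λ c → ent r c * ent s c) ≡ K * δ r s
      orth (inj₁ x) (inj₁ y) with x ≟ y
      ... | yes refl = begin
        ∑ (λ c → ent (inj₁ x) c * ent (inj₁ x) c)
          ≡⟨ words x x ⟩
        + p * ∑ (λ j → δ (letter x j) (letter x j)) + 1ℤ - v
          ≡⟨ cong (λ s → + p * s + 1ℤ - v)
               (trans (∑-cong (λ j → δ-≡ {a = letter x j} refl)) (∑-const {V} 1ℤ)) ⟩
        + p * (v * 1ℤ) + 1ℤ - v
          ≡⟨ cong (_- v) weight-ℤ ⟩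
        K + v - v
          ≡⟨ cancel K v ⟩
        K * 1ℤ
          ≡⟨ cong (K *_) (δ-≡ {a = inj₁ x} refl) ⟨
        K * δ (inj₁ x) (inj₁ x) ∎
        where
        cancel : ∀ k v → k + v - v ≡ k * 1ℤ
        cancel = solve-∀
      ... | no x≢y = begin
        ∑ (λ c → ent (inj₁ x) c * ent (inj₁ y) c)
          ≡⟨ words x y ⟩
        + p * ∑ (λ j → δ (letter x j) (letter y j)) + 1ℤ - v
          ≡⟨ cong (_- v) (agreements x≢y) ⟩
        v - v
          ≡⟨ cancel K v ⟩
        K * 0ℤ
          ≡⟨ cong (K *_) (δ-≢ (λ { refl → x≢y refl })) ⟨
        K * δ (inj₁ x) (inj₁ y) ∎
        where
        cancel : ∀ k v → v - v ≡ k * 0ℤ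
        cancel = solve-∀
      orth (inj₁ x) (inj₂ (i , b)) =
        trans (mixed x i b) (sym (trans (cong (K *_) (δ-≢ {a = inj₁ x} {b = inj₂ (i , b)} λ ())) (ℤ.*-zeroʳ K)))
      orth (inj₂ (i , b)) (inj₁ x) =
        trans (∑-cong (λ c → ℤ.*-comm (ent (inj₂ (i , b)) c) (ent (inj₁ x) c)))
       (trans (mixed x i b) (sym (trans (cong (K *_) (δ-≢ {a = inj₂ (i , b)} {b = inj₁ x} λ ())) (ℤ.*-zeroʳ K))))
      orth (inj₂ (i , b)) (inj₂ (i′ , b′)) =
        trans (tails i b i′ b′) (cong (K *_) (sym (trans (δ-⊎₂ (i , b) (i′ , b′)) (δ-× i i′ b b′))))

-- Roots of polynomials, finite fields and simplex codes.

module FiniteFields where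

  open FiniteSums
  open WeighingMatrices
  open Weaving using (geometric)
  open Concatenation
  open import Algebra.Bundles using (CommutativeRing)
  import Algebra.Properties.Semiring.Exp as Exponentiation
  open import Algebra.Structures using (IsCommutativeRing)
  open import Data.Empty using (⊥-elim)
  open import Data.Fin as Fin using (Fin; zero; suc)
  import Data.Fin.Properties as Fin
  open import Data.Integer as ℤ using (ℤ; +_; 0ℤ; 1ℤ; -1ℤ)
  import Data.Integer.Properties as ℤ
  import Data.Integer.Tactic.RingSolver as ℤ-Solver
  open import Data.Nat as ℕ using (ℕ; zero; suc)
  import Data.Nat.Properties as ℕ
  open import Data.Product using (_×_; _,_; proj₁; proj₂; ∃)
  open import Data.Sum using (_⊎_; inj₁; inj₂; [_,_])
  open import Data.Unit using (⊤; tt)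
  open import Data.Vec using (Vec; []; _∷_)
  open import Data.Vec.Relation.Unary.All using (All; []; _∷_)
  open import Function using (_∘_; _↔_; Inverse; Injection; mk↔ₛ′)
  open import Data.Fin.Permutation using (↔⇒≡)
  open import Function using (case_of_)
  open import Function.Construct.Composition using (_↔-∘_)
  open import Function.Construct.Symmetry using (↔-sym)
  open import Function.Properties.Inverse using (↔⇒↣)
  open import Level using (0ℓ)
  open import Relation.Nullary.Decidable using (¬?; _×-dec_; decidable-stable)
  open import Relation.Binary.PropositionalEquality as ≡ using (_≡_; _≢_; cong; cong₂)
  open import Relation.Nullary using (Dec; yes; no)

  module Roots {c ℓ} (R : CommutativeRing c ℓ) where
    open CommutativeRing R hiding (zero)
    open import Algebra.Properties.Ring ring public using (x[y-z]≈xy-xz; [y-z]x≈yx-zx)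
    open import Algebra.Properties.AbelianGroup +-abelianGroup using (xyx⁻¹≈y)
    open import Algebra.Properties.Group +-group using (x∙y⁻¹≈ε⇒x≈y; x≈y⇒x∙y⁻¹≈ε)
    open import Algebra.Properties.CommutativeSemiring.Exp commutativeSemiring using (_^_)
    open import Relation.Binary.Reasoning.Setoid setoid

    x-y≈0⇒x≈y : ∀ {x y} → x - y ≈ 0# → x ≈ y
    x-y≈0⇒x≈y = x∙y⁻¹≈ε⇒x≈y _ _

    x≈y⇒x-y≈0 : ∀ {x y} → x ≈ y → x - y ≈ 0#
    x≈y⇒x-y≈0 = x≈y⇒x∙y⁻¹≈ε

    eval : ∀ {n} → Vec Carrier n → Carrier → Carrier
    eval [] t = 0#
    eval (c ∷ cs) t = c + t * eval cs t

    -- Synthetic division by t - r: the coefficients of the quotient are the intermediate values of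
    -- Horner's scheme at r. Constant terms come first.
    quotient : ∀ {n} → Carrier → Vec Carrier (suc n) → Vec Carrier n
    quotient r (c ∷ []) = []
    quotient r (c ∷ cs@(_ ∷ _)) = eval cs r ∷ quotient r cs

    eval-quotient : ∀ {n} r (cs : Vec Carrier (suc n)) t →
                    eval cs t ≈ eval cs r + (t - r) * eval (quotient r cs) t
    eval-quotient r (c ∷ []) t = begin
      c + t * 0#                       ≈⟨ +-congˡ (trans (zeroʳ t) (sym (zeroʳ r))) ⟩
      c + r * 0#                       ≈⟨ +-identityʳ _ ⟨
      (c + r * 0#) + 0#                ≈⟨ +-congˡ (zeroʳ (t - r)) ⟨
      (c + r * 0#) + (t - r) * 0#      ∎
    eval-quotient r (c ∷ cs@(_ ∷ _)) t = begin
      c + t * f t                              ≈⟨ +-congˡ tf ⟩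
      c + (r * f r + (t - r) * (f r + t * q))  ≈⟨ +-assoc _ _ _ ⟨
      (c + r * f r) + (t - r) * (f r + t * q)  ∎
      where
      f = eval cs
      q = eval (quotient r cs) t
      t≈ : t ≈ r + (t - r)
      t≈ = trans (sym (xyx⁻¹≈y r t)) (+-assoc r t (- r))
      tf : t * f t ≈ r * f r + (t - r) * (f r + t * q)
      tf = begin
        t * f t                                      ≈⟨ *-congˡ (eval-quotient r cs t) ⟩
        t * (f r + (t - r) * q)                      ≈⟨ distribˡ t (f r) ((t - r) * q) ⟩
        t * f r + t * ((t - r) * q)                  ≈⟨ +-cong (trans (*-congʳ t≈) (distribʳ (f r) r (t - r)))
                                                         (trans (sym (*-assoc t (t - r) q))
                                                           (trans (*-congʳ (*-comm t (t - r))) (*-assoc (t - r) t q))) ⟩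
        (r * f r + (t - r) * f r) + (t - r) * (t * q) ≈⟨ +-assoc _ _ _ ⟩
        r * f r + ((t - r) * f r + (t - r) * (t * q)) ≈⟨ +-congˡ (distribˡ (t - r) (f r) (t * q)) ⟨
        r * f r + (t - r) * (f r + t * q)            ∎

    -- The statement concerns coefficients, not values: later a leading coefficient and the digits
    -- of field elements are read off from it.
    quotient-zero : ∀ {n} r (cs : Vec Carrier (suc n)) → eval cs r ≈ 0# →
                    All (_≈ 0#) (quotient r cs) → All (_≈ 0#) cs
    quotient-zero r (c ∷ []) eq [] = trans (sym (trans (+-congˡ (zeroʳ r)) (+-identityʳ c))) eq ∷ []
    quotient-zero r (c ∷ cs@(_ ∷ _)) eq (z ∷ zs) =
      trans (sym (trans (+-congˡ (trans (*-congˡ z) (zeroʳ r))) (+-identityʳ c))) eq ∷ quotient-zero r cs z zs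

    module Domain (domain : ∀ {x y} → x * y ≈ 0# → x ≈ 0# ⊎ y ≈ 0#) where

      -- Dividing by t - r₀ for the first root r₀ leaves the remaining roots as roots of the
      -- quotient, since their differences from r₀ are nonzero in a domain.
      vanishing : ∀ {n} (cs : Vec Carrier n) (r : Fin n → Carrier) → (∀ {i j} → r i ≈ r j → i ≡ j) →
                  (∀ i → eval cs (r i) ≈ 0#) → All (_≈ 0#) cs
      vanishing [] r _ _ = []
      vanishing {suc n} cs@(_ ∷ _) r distinct root =
        quotient-zero (r zero) cs (root zero)
          (vanishing (quotient (r zero) cs) (r ∘ suc) (Fin.suc-injective ∘ distinct) root′)
        where
        root′ : ∀ i → eval (quotient (r zero) cs) (r (suc i)) ≈ 0#
        root′ i with domain (begin
            (r (suc i) - r zero) * eval (quotient (r zero) cs) (r (suc i))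
              ≈⟨ +-identityˡ _ ⟨
            0# + (r (suc i) - r zero) * eval (quotient (r zero) cs) (r (suc i))
              ≈⟨ +-congʳ (root zero) ⟨
            eval cs (r zero) + (r (suc i) - r zero) * eval (quotient (r zero) cs) (r (suc i))
              ≈⟨ eval-quotient (r zero) cs (r (suc i)) ⟨
            eval cs (r (suc i))
              ≈⟨ root (suc i) ⟩
            0# ∎)
        ... | inj₁ eq with distinct (x-y≈0⇒x≈y eq)
        ...   | ()
        root′ i | inj₂ eq = eq

      monomial : ∀ k → Vec Carrier (suc k)
      monomial zero = 1# ∷ []
      monomial (suc k) = 0# ∷ monomial k

      eval-monomial : ∀ k t → eval (monomial k) t ≈ t ^ k
      eval-monomial zero t = trans (+-congˡ (zeroʳ t)) (+-identityʳ 1#)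
      eval-monomial (suc k) t = trans (+-identityˡ _) (*-congˡ (eval-monomial k t))

      monomial≉0 : ∀ k → All (_≈ 0#) (monomial k) → 1# ≈ 0#
      monomial≉0 zero (eq ∷ []) = eq
      monomial≉0 (suc k) (_ ∷ zs) = monomial≉0 k zs

      -- Fixed points are roots of t^(2+k) - t, which has 3 + k coefficients; with as many roots
      -- even its leading coefficient 1 would vanish.
      few-fixed-points : ∀ k (r : Fin (3 ℕ.+ k) → Carrier) → (∀ {i j} → r i ≈ r j → i ≡ j) →
                         (∀ i → r i ^ (2 ℕ.+ k) ≈ r i) → 1# ≈ 0#
      few-fixed-points k r distinct fixed
        with vanishing (0# ∷ - 1# ∷ monomial k) r distinct (λ i → begin
          0# + r i * (- 1# + r i * eval (monomial k) (r i))
            ≈⟨ trans (+-identityˡ _) (*-congˡ (trans (+-comm _ _) (+-congʳ (*-congˡ (eval-monomial k (r i)))))) ⟩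
          r i * (r i ^ suc k - 1#)
            ≈⟨ x[y-z]≈xy-xz (r i) (r i ^ suc k) 1# ⟩
          r i ^ (2 ℕ.+ k) - r i * 1#
            ≈⟨ x≈y⇒x-y≈0 (trans (fixed i) (sym (*-identityʳ (r i)))) ⟩
          0# ∎)
      ... | _ ∷ _ ∷ zs = monomial≉0 k zs

  -- The carrier is `Fin p` itself, so that elements serve as letters of a code and as row labels of
  -- D. `fermat` is part of the structure: the construction of the field delivers it, and the order
  -- of the multiplicative group never has to be discussed.
  record FiniteField (p : ℕ) : Set where
    infixl 6 _+_
    infixl 7 _*_
    infix 8 -_
    field
      _+_ _*_ : Fin p → Fin p → Fin p
      -_      : Fin p → Fin p
      0# 1#   : Fin p
      isCommutativeRing : IsCommutativeRing _≡_ _+_ _*_ -_ 0# 1#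

    commutativeRing : CommutativeRing 0ℓ 0ℓ
    commutativeRing = record { isCommutativeRing = isCommutativeRing }

    field
      1≢0     : 1# ≢ 0#
      inverse : ∀ {x} → x ≢ 0# → ∃ λ y → x * y ≡ 1#
      fermat  : ∀ x → Exponentiation._^_ (CommutativeRing.semiring commutativeRing) x p ≡ x

  module FieldProperties {p : ℕ} (F : FiniteField p) where
    open FiniteField F public
    open CommutativeRing commutativeRing public
      hiding (Carrier; zero; _≈_; _+_; _*_; -_; 0#; 1#; refl; sym; trans; isCommutativeRing)
    open Roots commutativeRing public using (module Domain; x-y≈0⇒x≈y; x≈y⇒x-y≈0; x[y-z]≈xy-xz; [y-z]x≈yx-zx)
    open import Algebra.Properties.CommutativeSemiring.Exp commutativeSemiring public
    open import Algebra.Properties.Group +-group public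
      using ()
      renaming (∙-cancelʳ to +-cancelʳ; ∙-cancelˡ to +-cancelˡ
               ; //-rightDividesˡ to x-y+y≡x; //-rightDividesʳ to x+y-y≡x)
    open ≡ using (refl; sym; trans)
    open ≡.≡-Reasoning

    -- With 0 sent to 0, inversion permutes the whole field and can reindex a sum.
    inv : Fin p → Fin p
    inv x with x Fin.≟ 0#
    ... | yes _ = 0#
    ... | no x≢0 = proj₁ (inverse x≢0)

    inv-zero : inv 0# ≡ 0#
    inv-zero with 0# Fin.≟ 0#
    ... | yes _ = refl
    ... | no ¬eq = ⊥-elim (¬eq refl)

    *-inv : ∀ {x} → x ≢ 0# → x * inv x ≡ 1#
    *-inv {x} x≢0 with x Fin.≟ 0#
    ... | yes eq = ⊥-elim (x≢0 eq)
    ... | no x≢0 = proj₂ (inverse x≢0)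

    domain : ∀ {x y} → x * y ≡ 0# → x ≡ 0# ⊎ y ≡ 0#
    domain {x} {y} xy≡0 with x Fin.≟ 0#
    ... | yes eq = inj₁ eq
    ... | no x≢0 = inj₂ (begin
      y                ≡⟨ *-identityˡ y ⟨
      1# * y           ≡⟨ cong (_* y) (trans (*-comm (inv x) x) (*-inv x≢0)) ⟨
      inv x * x * y    ≡⟨ *-assoc (inv x) x y ⟩
      inv x * (x * y)  ≡⟨ cong (inv x *_) xy≡0 ⟩
      inv x * 0#       ≡⟨ zeroʳ (inv x) ⟩
      0#               ∎)

    *-≢0 : ∀ {x y} → x ≢ 0# → y ≢ 0# → x * y ≢ 0#
    *-≢0 x≢0 y≢0 eq = [ x≢0 , y≢0 ] (domain eq)

    *-cancelˡ : ∀ {x y z} → x ≢ 0# → x * y ≡ x * z → y ≡ z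
    *-cancelˡ {x} {y} {z} x≢0 eq with domain (trans (x[y-z]≈xy-xz x y z) (x≈y⇒x-y≈0 eq))
    ... | inj₁ x≡0 = ⊥-elim (x≢0 x≡0)
    ... | inj₂ y-z≡0 = x-y≈0⇒x≈y y-z≡0

    inv-involutive : ∀ x → inv (inv x) ≡ x
    inv-involutive x with x Fin.≟ 0#
    ... | yes refl = inv-zero
    ... | no x≢0 = *-cancelˡ y≢0 (trans (*-inv y≢0) (sym (trans (*-comm _ x) (proj₂ (inverse x≢0)))))
      where
      y≢0 : proj₁ (inverse x≢0) ≢ 0#
      y≢0 eq = 1≢0 (trans (sym (proj₂ (inverse x≢0))) (trans (cong (x *_) eq) (zeroʳ x)))

    scaling : ∀ {g} → g ≢ 0# → Fin p ↔ Fin p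
    scaling {g} g≢0 = mk↔ₛ′ (g *_) (inv g *_) (cancel g (inv g) (*-inv g≢0))
                           (cancel (inv g) g (trans (*-comm (inv g) g) (*-inv g≢0)))
      where
      cancel : ∀ a b → a * b ≡ 1# → ∀ x → a * (b * x) ≡ x
      cancel a b ab≡1 x = trans (sym (*-assoc a b x)) (trans (cong (_* x) ab≡1) (*-identityˡ x))

    shifting : Fin p → Fin p ↔ Fin p
    shifting c = mk↔ₛ′ (_+ c) (_- c) (x-y+y≡x c) (x+y-y≡x c)

    inverting : Fin p ↔ Fin p
    inverting = mk↔ₛ′ inv inv inv-involutive inv-involutive

  module _ {p : ℕ} (F : FiniteField p) where
    open FieldProperties F
    open ≡ using (refl; sym; trans)
    open ≡.≡-Reasoning

    -- Two lines of different slopes meet once, at t = (y - x)/(a - b).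
    line : ∀ {a b x y} → a ≢ b → ∑ (λ t → δ (x + t * a) (y + t * b)) ≡ 1ℤ
    line {a} {b} {x} {y} a≢b =
      trans (∑-single t₀ (λ t → δ (x + t * a) (y + t * b)) (λ t t₀≢t → δ-≢ (t₀≢t ∘ sym ∘ unique t)))
            (δ-≡ meets)
      where
      d = a - b
      d≢0 : d ≢ 0#
      d≢0 = a≢b ∘ x-y≈0⇒x≈y
      t₀ = inv d * (y - x)
      transpose : ∀ {t} → t * d ≡ y - x → x + t * a ≡ y + t * b
      transpose {t} eq = begin
        x + t * a                     ≡⟨ cong (λ u → x + u) (x-y+y≡x (t * b) (t * a)) ⟨
        x + (t * a - t * b + t * b)   ≡⟨ cong (λ u → x + (u + t * b)) (trans (sym (x[y-z]≈xy-xz t a b)) eq) ⟩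
        x + (y - x + t * b)           ≡⟨ +-assoc x (y - x) (t * b) ⟨
        x + (y - x) + t * b           ≡⟨ cong (_+ t * b) (trans (+-comm x (y - x)) (x-y+y≡x x y)) ⟩
        y + t * b                     ∎
      meets : x + t₀ * a ≡ y + t₀ * b
      meets = transpose (begin
        inv d * (y - x) * d    ≡⟨ *-comm _ d ⟩
        d * (inv d * (y - x))  ≡⟨ *-assoc d (inv d) (y - x) ⟨
        d * inv d * (y - x)    ≡⟨ cong (_* (y - x)) (*-inv d≢0) ⟩
        1# * (y - x)           ≡⟨ *-identityˡ (y - x) ⟩
        y - x                  ∎)
      unique : ∀ t → x + t * a ≡ y + t * b → t ≡ t₀
      unique t eq = *-cancelˡ d≢0 (trans (*-comm d t) (trans difference (sym (begin
        d * (inv d * (y - x))  ≡⟨ *-assoc d (inv d) (y - x) ⟨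
        d * inv d * (y - x)    ≡⟨ cong (_* (y - x)) (*-inv d≢0) ⟩
        1# * (y - x)           ≡⟨ *-identityˡ (y - x) ⟩
        y - x                  ∎))))
        where
        difference : t * d ≡ y - x
        difference = +-cancelˡ x _ _ (+-cancelʳ (t * b) _ _ (begin
          x + t * d + t * b             ≡⟨ +-assoc x (t * d) (t * b) ⟩
          x + (t * d + t * b)           ≡⟨ cong (λ u → x + (u + t * b)) (x[y-z]≈xy-xz t a b) ⟩
          x + (t * a - t * b + t * b)   ≡⟨ cong (λ u → x + u) (x-y+y≡x (t * b) (t * a)) ⟩
          x + t * a                     ≡⟨ eq ⟩
          y + t * b                     ≡⟨ cong (_+ t * b) (trans (+-comm x (y - x)) (x-y+y≡x x y)) ⟨
          x + (y - x) + t * b           ∎))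

    -- Each place j becomes a line with slope a, and one place at infinity records a. Different
    -- slopes agree once on each of the v lines and not at infinity. Equal slopes preserve the (v -
    -- 1)/p agreements, p times each, and agree at infinity. Either way v places of vp + 1 agree.
    extend : {X V : Set} {{_ : Finite X}} {{_ : Finite V}} → Code X V p →
             Code (Fin p × X) ((V × Fin p) ⊎ ⊤) p
    extend {X} {V} code = record { letter = letter′ ; agreements = agreements′ }
      where
      open Code code
      letter′ : Fin p × X → (V × Fin p) ⊎ ⊤ → Fin p
      letter′ (a , x) (inj₁ (j , t)) = letter x j + t * a
      letter′ (a , x) (inj₂ tt) = a
      v = size V
      finish : ∀ {s} → s ≡ + v → + p ℤ.* s ℤ.+ 1ℤ ≡ + size ((V × Fin p) ⊎ ⊤)
      finish refl = cong (ℤ._+ 1ℤ) (trans (≡.sym (ℤ.pos-* p v)) (cong +_ (ℕ.*-comm p v)))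
      agreements′ : ∀ {x y} → x ≢ y →
                    + p ℤ.* ∑ (λ j → δ (letter′ x j) (letter′ y j)) ℤ.+ 1ℤ ≡ + size ((V × Fin p) ⊎ ⊤)
      agreements′ {a , x} {b , y} x≢y with a Fin.≟ b
      ... | no a≢b = finish (begin
        ∑ (λ j → δ (letter′ (a , x) j) (letter′ (b , y) j))
          ≡⟨ ∑-⊎ (λ j → δ (letter′ (a , x) j) (letter′ (b , y) j)) ⟩
        ∑ (λ (j , t) → δ (letter x j + t * a) (letter y j + t * b)) ℤ.+ ∑ {⊤} (λ _ → δ a b)
          ≡⟨ cong₂ ℤ._+_ (∑-× (λ (j , t) → δ (letter x j + t * a) (letter y j + t * b)))
                         (trans (∑-⊤ _) (δ-≢ a≢b)) ⟩
        ∑ (λ j → ∑ (λ t → δ (letter x j + t * a) (letter y j + t * b))) ℤ.+ 0ℤ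
          ≡⟨ trans (ℤ.+-identityʳ _) (∑-cong (λ j → line a≢b)) ⟩
        ∑ {V} (λ _ → 1ℤ)
          ≡⟨ trans (∑-const {V} 1ℤ) (ℤ.*-identityʳ (+ v)) ⟩
        + v ∎)
      ... | yes refl = finish (begin
        ∑ (λ j → δ (letter′ (a , x) j) (letter′ (a , y) j))
          ≡⟨ ∑-⊎ (λ j → δ (letter′ (a , x) j) (letter′ (a , y) j)) ⟩
        ∑ (λ (j , t) → δ (letter x j + t * a) (letter y j + t * a)) ℤ.+ ∑ {⊤} (λ _ → δ a a)
          ≡⟨ cong₂ ℤ._+_ (∑-× (λ (j , t) → δ (letter x j + t * a) (letter y j + t * a)))
                         (trans (∑-⊤ _) (δ-≡ {a = a} refl)) ⟩
        ∑ (λ j → ∑ (λ t → δ (letter x j + t * a) (letter y j + t * a))) ℤ.+ 1ℤ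
          ≡⟨ cong (ℤ._+ 1ℤ) (∑-cong (λ j → trans
               (∑-cong (λ t → δ-injective (_+ t * a) (+-cancelʳ (t * a) _ _) (letter x j) (letter y j)))
               (∑-const {Fin p} (δ (letter x j) (letter y j))))) ⟩
        ∑ (λ j → + p ℤ.* δ (letter x j) (letter y j)) ℤ.+ 1ℤ
          ≡⟨ cong (ℤ._+ 1ℤ) (∑-*ˡ (+ p) (λ j → δ (letter x j) (letter y j))) ⟩
        + p ℤ.* ∑ (λ j → δ (letter x j) (letter y j)) ℤ.+ 1ℤ
          ≡⟨ agreements (x≢y ∘ cong (a ,_)) ⟩
        + v ∎)

    repetition : Code (Fin p) ⊤ p
    repetition = record
      { letter = λ a _ → a
      ; agreements = λ {a} {b} a≢b → begin
          + p ℤ.* ∑ {⊤} (λ _ → δ a b) ℤ.+ 1ℤ ≡⟨ cong (λ s → + p ℤ.* s ℤ.+ 1ℤ) (trans (∑-⊤ _) (δ-≢ a≢b)) ⟩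
          + p ℤ.* 0ℤ ℤ.+ 1ℤ                  ≡⟨ cong (ℤ._+ 1ℤ) (ℤ.*-zeroʳ (+ p)) ⟩
          1ℤ                                 ∎
      }

    reindexCode : {X V X′ V′ : Set} {{_ : Finite X}} {{_ : Finite V}} {{_ : Finite X′}} {{_ : Finite V′}} →
                  X′ ↔ X → V′ ↔ V → Code X V p → Code X′ V′ p
    reindexCode ξ ν code = record
      { letter = λ x j → letter (Inverse.to ξ x) (Inverse.to ν j)
      ; agreements = λ {x} {y} x≢y → trans
          (cong (λ s → + p ℤ.* s ℤ.+ 1ℤ)
                (sym (∑-↔ ν (λ j → δ (letter (Inverse.to ξ x) j) (letter (Inverse.to ξ y) j)))))
          (trans (agreements (x≢y ∘ Injection.injective (↔⇒↣ ξ)))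
                 (cong +_ (↔⇒≡ (↔-sym (Finite.enum it) ↔-∘ (↔-sym ν ↔-∘ Finite.enum it)))))
      }
      where
      open Code code
      it : {A : Set} {{_ : Finite A}} → Finite A
      it {{x}} = x

    simplexCode : ∀ m → Code (Fin (p ℕ.^ suc m)) (Fin (geometric p m)) p
    simplexCode zero = reindexCode (Fin≡size (Fin p) (sym (ℕ.*-identityʳ p))) (Fin≡size ⊤ refl) repetition
    simplexCode (suc m) = reindexCode
      (Fin≡size (Fin p × Fin (p ℕ.^ suc m)) refl) (Fin≡size ((Fin (geometric p m) × Fin p) ⊎ ⊤) refl)
      (extend (simplexCode m))

  -- The quadratic character and the Paley matrix.

  module QuadraticCharacter (h : ℕ) (F : FiniteField (3 ℕ.+ (h ℕ.+ h))) where
    private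
      p = 3 ℕ.+ (h ℕ.+ h)
    open FieldProperties F
    open ≡ using (refl; sym; trans)
    open ≡.≡-Reasoning

    opaque
      -- Defined by Euler's criterion rather than by squares: `suc h` is (p - 1)/2, and
      -- multiplicativity then comes from that of powers.
      χ : Fin p → ℤ
      χ z with z Fin.≟ 0# | (z ^ suc h) Fin.≟ 1#
      ... | yes _ | _ = 0ℤ
      ... | no _ | yes _ = 1ℤ
      ... | no _ | no _ = -1ℤ

      χ-ternary : ∀ z → Ternary (χ z)
      χ-ternary z with z Fin.≟ 0# | (z ^ suc h) Fin.≟ 1#
      ... | yes _ | _ = inj₁ refl
      ... | no _ | yes _ = inj₂ (inj₁ refl)
      ... | no _ | no _ = inj₂ (inj₂ refl)

      χ-zero : χ 0# ≡ 0ℤ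
      χ-zero with 0# Fin.≟ 0#
      ... | yes _ = refl
      ... | no ¬eq = ⊥-elim (¬eq refl)

      χ-residue : ∀ {z} → z ≢ 0# → z ^ suc h ≡ 1# → χ z ≡ 1ℤ
      χ-residue {z} z≢0 eq with z Fin.≟ 0# | (z ^ suc h) Fin.≟ 1#
      ... | yes z≡0 | _ = ⊥-elim (z≢0 z≡0)
      ... | no _ | yes _ = refl
      ... | no _ | no ¬eq = ⊥-elim (¬eq eq)

      χ-nonresidue : ∀ {z} → z ≢ 0# → z ^ suc h ≢ 1# → χ z ≡ -1ℤ
      χ-nonresidue {z} z≢0 ¬eq with z Fin.≟ 0# | (z ^ suc h) Fin.≟ 1#
      ... | yes z≡0 | _ = ⊥-elim (z≢0 z≡0)
      ... | no _ | yes eq = ⊥-elim (¬eq eq)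
      ... | no _ | no _ = refl

    -- The power w satisfies w² = z^(p-1) = 1 by `fermat`, hence (w - 1)(w + 1) = 0.
    euler : ∀ {z} → z ≢ 0# → z ^ suc h ≢ 1# → z ^ suc h ≡ - 1#
    euler {z} z≢0 ¬1 with domain (begin
        (w - 1#) * (w + 1#)       ≡⟨ [y-z]x≈yx-zx (w + 1#) w 1# ⟩
        w * (w + 1#) - 1# * (w + 1#) ≡⟨ cong₂ (λ u v → u - v) (trans (distribˡ w w 1#)
                                                            (cong₂ _+_ w*w≡1 (*-identityʳ w)))
                                                          (*-identityˡ (w + 1#)) ⟩
        1# + w - (w + 1#)         ≡⟨ x≈y⇒x-y≈0 (+-comm 1# w) ⟩
        0#                        ∎)
      where
      w = z ^ suc h
      w*w≡1 : w * w ≡ 1#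
      w*w≡1 = trans (sym (^-homo-* z (suc h) (suc h)))
        (trans (cong (z ^_) (cong suc (ℕ.+-suc h h))) (*-cancelˡ z≢0 (trans (fermat z) (sym (*-identityʳ z)))))
    ... | inj₁ w-1≡0 = ⊥-elim (¬1 (x-y≈0⇒x≈y w-1≡0))
    ... | inj₂ w+1≡0 = +-cancelʳ 1# _ _ (trans w+1≡0 (sym (-‿inverseˡ 1#)))

    -- Otherwise every element would be fixed by the power 2 + h = (p + 1)/2, which allows at most 2
    -- + h fixed points; the field contains 3 + h elements and more.
    nonresidue : ∃ λ g → g ≢ 0# × g ^ suc h ≢ 1#
    nonresidue with any? {P = λ g → g ≢ 0# × g ^ suc h ≢ 1#} (λ g → ¬? (g Fin.≟ 0#) ×-dec ¬? (g ^ suc h Fin.≟ 1#))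
    ... | yes found = found
    ... | no none = ⊥-elim (1≢0 (Domain.few-fixed-points domain h
        (λ i → Fin.inject≤ i (ℕ.+-monoʳ-≤ 3 (ℕ.m≤m+n h h))) (Fin.inject≤-injective _ _ _ _) (λ i → fixed _)))
      where
      fixed : ∀ z → z ^ (2 ℕ.+ h) ≡ z
      fixed z with z Fin.≟ 0#
      ... | yes refl = zeroˡ _
      ... | no z≢0 = trans (cong (z *_) (decidable-stable (z ^ suc h Fin.≟ 1#) (λ ¬1 → none (z , z≢0 , ¬1))))
                           (*-identityʳ z)

    -1*-1≡1 : - 1# * - 1# ≡ 1#
    -1*-1≡1 = begin
      - 1# * - 1#      ≡⟨ -1*x≈-x (- 1#) ⟩
      - - 1#           ≡⟨ -‿involutive 1# ⟩
      1#               ∎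
      where open import Algebra.Properties.Ring ring using (-1*x≈-x; -‿involutive)

    -- That the characteristic is not 2 is read off from a nonresidue, whose power (p - 1)/2 is -1
    -- and not 1.
    -1≢1 : - 1# ≢ 1#
    -1≢1 eq = let (g , g≢0 , ¬1) = nonresidue in ¬1 (trans (euler g≢0 ¬1) eq)

    χ-* : ∀ x y → χ (x * y) ≡ χ x ℤ.* χ y
    χ-* x y with x Fin.≟ 0# | y Fin.≟ 0#
    ... | yes refl | _ = trans (trans (cong χ (zeroˡ y)) χ-zero) (sym (cong (ℤ._* χ y) χ-zero))
    ... | no _ | yes refl =
      trans (trans (cong χ (zeroʳ x)) χ-zero) (sym (trans (cong (χ x ℤ.*_) χ-zero) (ℤ.*-zeroʳ (χ x))))
    ... | no x≢0 | no y≢0 = by (x ^ suc h Fin.≟ 1#) (y ^ suc h Fin.≟ 1#)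
      where
      power : ∀ {u v} → x ^ suc h ≡ u → y ^ suc h ≡ v → (x * y) ^ suc h ≡ u * v
      power refl refl = ^-distrib-* x y (suc h)
      combine : ∀ {a b} → χ (x * y) ≡ a ℤ.* b → χ x ≡ a → χ y ≡ b → χ (x * y) ≡ χ x ℤ.* χ y
      combine eq refl refl = eq
      by : Dec (x ^ suc h ≡ 1#) → Dec (y ^ suc h ≡ 1#) → χ (x * y) ≡ χ x ℤ.* χ y
      by (yes xr) (yes yr) = combine
        (χ-residue (*-≢0 x≢0 y≢0) (trans (power xr yr) (*-identityˡ 1#)))
        (χ-residue x≢0 xr) (χ-residue y≢0 yr)
      by (yes xr) (no yn) = combine
        (χ-nonresidue (*-≢0 x≢0 y≢0) (-1≢1 ∘ trans (sym (trans (power xr (euler y≢0 yn)) (*-identityˡ (- 1#))))))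
        (χ-residue x≢0 xr) (χ-nonresidue y≢0 yn)
      by (no xn) (yes yr) = combine
        (χ-nonresidue (*-≢0 x≢0 y≢0) (-1≢1 ∘ trans (sym (trans (power (euler x≢0 xn) yr) (*-identityʳ (- 1#))))))
        (χ-nonresidue x≢0 xn) (χ-residue y≢0 yr)
      by (no xn) (no yn) = combine
        (χ-residue (*-≢0 x≢0 y≢0) (trans (power (euler x≢0 xn) (euler y≢0 yn))
          (-1*-1≡1)))
        (χ-nonresidue x≢0 xn) (χ-nonresidue y≢0 yn)

    χ-one : χ 1# ≡ 1ℤ
    χ-one = χ-residue 1≢0 (one^ (suc h))
      where
      one^ : ∀ k → 1# ^ k ≡ 1#
      one^ zero = refl
      one^ (suc k) = trans (*-identityˡ _) (one^ k)

    -- Multiplication by a nonresidue permutes the field and flips every sign, so the sum is its own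
    -- negative.
    ∑χ≡0 : ∑ χ ≡ 0ℤ
    ∑χ≡0 = 2x≡0 (∑ χ) (begin
      ∑ χ                            ≡⟨ ∑-↔ (scaling g≢0) χ ⟩
      ∑ (λ z → χ (g * z))            ≡⟨ ∑-cong (λ z → trans (χ-* g z) (cong (ℤ._* χ z) (χ-nonresidue g≢0 ¬1))) ⟩
      ∑ (λ z → -1ℤ ℤ.* χ z)          ≡⟨ trans (∑-*ˡ -1ℤ χ) (ℤ.-1*i≡-i (∑ χ)) ⟩
      ℤ.- ∑ χ                        ∎)
      where
      g = proj₁ nonresidue
      g≢0 = proj₁ (proj₂ nonresidue)
      ¬1 = proj₂ (proj₂ nonresidue)
      2x≡0 : ∀ x → x ≡ ℤ.- x → x ≡ 0ℤ
      2x≡0 (+ 0) _ = refl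
      2x≡0 ℤ.+[1+ n ] ()
      2x≡0 ℤ.-[1+ n ] ()

    -- For z ≠ 0, χ(z) χ(z + c) = χ(1 + c/z); the junk value inv 0 = 0 contributes an extra χ(1).
    χ-autocorrelation : ∀ {c} → c ≢ 0# → ∑ (λ z → χ z ℤ.* χ (z + c)) ≡ -1ℤ
    χ-autocorrelation {c} c≢0 = begin
      ∑ (λ z → χ z ℤ.* χ (z + c))
        ≡⟨ ∑-cong (λ z → term z (z Fin.≟ 0#)) ⟩
      ∑ (λ z → χ (c * inv z + 1#) ℤ.+ ℤ.- δ 0# z)
        ≡⟨ ∑-+ (λ z → χ (c * inv z + 1#)) (λ z → ℤ.- δ 0# z) ⟩
      ∑ (λ z → χ (c * inv z + 1#)) ℤ.+ ∑ (λ z → ℤ.- δ 0# z)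
        -- Inversion, scaling by c and shifting by 1 are permutations, so χ(c · inv z + 1) runs
        -- through the same values as χ.
        ≡⟨ cong₂ ℤ._+_
             (sym (trans (∑-↔ (shifting 1#) χ) (trans (∑-↔ (scaling c≢0) (λ z → χ (z + 1#)))
                  (∑-↔ inverting (λ z → χ (c * z + 1#))))))
             (trans (∑-cong (λ z → trans (sym (ℤ.-1*i≡-i (δ 0# z))) (ℤ.*-comm -1ℤ (δ 0# z))))
                    (∑-δ 0# (λ _ → -1ℤ))) ⟩
      ∑ χ ℤ.+ -1ℤ
        ≡⟨ cong (ℤ._+ -1ℤ) ∑χ≡0 ⟩
      -1ℤ ∎
      where
      term : ∀ z → Dec (z ≡ 0#) → χ z ℤ.* χ (z + c) ≡ χ (c * inv z + 1#) ℤ.+ ℤ.- δ 0# z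
      term z (yes refl) = trans (cong (ℤ._* χ (0# + c)) χ-zero) (sym (cong₂ (λ u v → u ℤ.+ ℤ.- v)
        (trans (cong χ (trans (cong (_+ 1#) (trans (cong (c *_) inv-zero) (zeroʳ c))) (+-identityˡ 1#))) χ-one)
        (δ-≡ {a = 0#} refl)))
      term z (no z≢0) = begin
        χ z ℤ.* χ (z + c)
          ≡⟨ cong (λ u → χ z ℤ.* χ u) (begin
               z + c                          ≡⟨ +-comm z c ⟩
               c + z                          ≡⟨ cong₂ _+_ (trans (sym (*-identityʳ c))
                 (cong (c *_) (sym (trans (*-comm (inv z) z) (*-inv z≢0))))) (sym (*-identityˡ z)) ⟩
               c * (inv z * z) + 1# * z       ≡⟨ cong (_+ 1# * z) (*-assoc c (inv z) z) ⟨
               c * inv z * z + 1# * z         ≡⟨ distribʳ z (c * inv z) 1# ⟨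
               (c * inv z + 1#) * z           ∎) ⟩
        χ z ℤ.* χ ((c * inv z + 1#) * z)
          ≡⟨ cong (χ z ℤ.*_) (χ-* (c * inv z + 1#) z) ⟩
        χ z ℤ.* (χ (c * inv z + 1#) ℤ.* χ z)
          ≡⟨ rotate (χ z) (χ (c * inv z + 1#)) ⟩
        χ (c * inv z + 1#) ℤ.* (χ z ℤ.* χ z)
          ≡⟨ cong (χ (c * inv z + 1#) ℤ.*_) (Ternary-square (χ-ternary z) (χ-≢0 z≢0)) ⟩
        χ (c * inv z + 1#) ℤ.* 1ℤ
          ≡⟨ rescale (χ (c * inv z + 1#)) ⟩
        χ (c * inv z + 1#) ℤ.+ ℤ.- 0ℤ
          ≡⟨ cong (λ v → χ (c * inv z + 1#) ℤ.+ ℤ.- v) (δ-≢ (z≢0 ∘ sym)) ⟨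
        χ (c * inv z + 1#) ℤ.+ ℤ.- δ 0# z ∎
        where
        rotate : ∀ a b → a ℤ.* (b ℤ.* a) ≡ b ℤ.* (a ℤ.* a)
        rotate = ℤ-Solver.solve-∀
        rescale : ∀ a → a ℤ.* 1ℤ ≡ a ℤ.+ ℤ.- 0ℤ
        rescale = ℤ-Solver.solve-∀
        χ-≢0 : ∀ {z} → z ≢ 0# → χ z ≢ 0ℤ
        χ-≢0 {z} z≢0 with z ^ suc h Fin.≟ 1#
        ... | yes r = λ eq → case trans (sym eq) (χ-residue z≢0 r) of λ ()
        ... | no n = λ eq → case trans (sym eq) (χ-nonresidue z≢0 n) of λ ()

    -- The bordered Jacobsthal matrix W(p + 1, p): p rows (1 | χ(z - a)) and one row (0 | 1 ... 1).
    -- Its orthogonality is the autocorrelation -1 together with the vanishing sum of χ.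
    paley : Split (Fin p) p 1
    paley = record
      { D = λ a z → χ (z - a)
      ; E = λ _ _ → 1ℤ
      ; D-ternary = λ a z → χ-ternary (z - a)
      ; E-ternary = λ _ _ → inj₂ (inj₁ refl)
      ; DD = DD
      ; DE = λ a _ → trans (∑-cong (λ z → ℤ.*-identityʳ (χ (z - a)))) (trans (sym (∑-↔ (shifting (- a)) χ)) ∑χ≡0)
      ; EE = λ { zero zero → trans (∑-const {Fin p} 1ℤ) (cong (+ p ℤ.*_) (sym (δ-≡ {Fin 1} {a = zero} refl))) }
      }
      where
      DD : ∀ a b → ∑ (λ z → χ (z - a) ℤ.* χ (z - b)) ≡ + p ℤ.* δ a b ℤ.- 1ℤ
      DD a b with a Fin.≟ b
      ... | yes refl = begin
        ∑ (λ z → χ (z - a) ℤ.* χ (z - a))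
          ≡⟨ ∑-↔ (shifting (- a)) (λ z → χ z ℤ.* χ z) ⟨
        ∑ (λ z → χ z ℤ.* χ z)
          ≡⟨ ∑-cong (λ z → square z (z Fin.≟ 0#)) ⟩
        ∑ (λ z → 1ℤ ℤ.+ δ 0# z ℤ.* -1ℤ)
          ≡⟨ trans (∑-+ (λ _ → 1ℤ) (λ z → δ 0# z ℤ.* -1ℤ))
               (cong₂ ℤ._+_ (∑-const {Fin p} 1ℤ) (∑-δ 0# (λ _ → -1ℤ))) ⟩
        + p ℤ.* 1ℤ ℤ.- 1ℤ
          ≡⟨ cong (λ d → + p ℤ.* d ℤ.- 1ℤ) (δ-≡ {a = a} refl) ⟨
        + p ℤ.* δ a a ℤ.- 1ℤ ∎
        where
        square : ∀ z → Dec (z ≡ 0#) → χ z ℤ.* χ z ≡ 1ℤ ℤ.+ δ 0# z ℤ.* -1ℤ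
        square z (yes refl) =
          trans (cong (λ u → u ℤ.* u) χ-zero) (sym (cong (λ d → 1ℤ ℤ.+ d ℤ.* -1ℤ) (δ-≡ {a = 0#} refl)))
        square z (no z≢0) with z ^ suc h Fin.≟ 1#
        ... | yes r =
          trans (cong (λ u → u ℤ.* u) (χ-residue z≢0 r)) (sym (cong (λ d → 1ℤ ℤ.+ d ℤ.* -1ℤ) (δ-≢ (z≢0 ∘ sym))))
        ... | no n =
          trans (cong (λ u → u ℤ.* u) (χ-nonresidue z≢0 n)) (sym (cong (λ d → 1ℤ ℤ.+ d ℤ.* -1ℤ) (δ-≢ (z≢0 ∘ sym))))
      ... | no a≢b = begin
        ∑ (λ z → χ (z - a) ℤ.* χ (z - b))
          ≡⟨ ∑-cong (λ z → cong (λ u → χ (z - a) ℤ.* χ u) (telescope z)) ⟩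
        ∑ (λ z → χ (z - a) ℤ.* χ (z - a + (a - b)))
          ≡⟨ ∑-↔ (shifting (- a)) (λ z → χ z ℤ.* χ (z + (a - b))) ⟨
        ∑ (λ z → χ z ℤ.* χ (z + (a - b)))
          ≡⟨ χ-autocorrelation (a≢b ∘ x-y≈0⇒x≈y) ⟩
        0ℤ ℤ.- 1ℤ
          ≡⟨ cong (ℤ._- 1ℤ) (ℤ.*-zeroʳ (+ p)) ⟨
        + p ℤ.* 0ℤ ℤ.- 1ℤ
          ≡⟨ cong (λ d → + p ℤ.* d ℤ.- 1ℤ) (δ-≢ a≢b) ⟨
        + p ℤ.* δ a b ℤ.- 1ℤ ∎
        where
        telescope : ∀ z → z - b ≡ z - a + (a - b)
        telescope z = sym (trans (sym (+-assoc (z - a) a (- b))) (cong (_- b) (x-y+y≡x a z)))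

-- The Frobenius map, quotient rings, and residue fields cut out by idempotents.

module RingQuotients where

  open import Algebra.Bundles using (CommutativeRing)
  import Algebra.Properties.Semiring.Exp as Exponentiation
  import Algebra.Properties.Semiring.Mult as Multiplication
  open import Data.Empty using (⊥-elim)
  open import Data.Fin as Fin using (Fin; zero; suc; toℕ)
  import Data.Fin.Properties as Fin
  open import Data.List using (List; []; _∷_; tabulate)
  open import Data.List.Relation.Unary.All as All using (All; []; _∷_)
  import Data.List.Relation.Unary.All.Properties as All
  open import Data.Nat as ℕ using (ℕ; zero; suc; s≤s; z≤n; _!)
  import Data.Nat.Properties as ℕ
  open import Data.Nat.Combinatorics using (_C_; nCk≡nC[n∸k]; nCn≡1; k![n∸k]!∣n!)
  open import Data.Nat.Combinatorics.Specification using (nCk≡n!/k![n-k]!)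
  open import Data.Nat.Divisibility as ℕ using (_∣_; ∣⇒≤; m∣m*n)
  open import Data.Nat.DivMod using (m/n*n≡m)

  open import Data.Nat.Primality using (Prime; euclidsLemma; prime⇒nonTrivial)
  open import Data.Product using (_×_; _,_; ∃)
  open import Data.Sum using (_⊎_; inj₁; inj₂)
  open import Function using (_∘_)
  import Level
  open import Relation.Binary.PropositionalEquality as ≡ using (_≡_; cong; subst)
  open import Relation.Nullary using (Dec; yes; no; ¬_)
  open import Relation.Nullary.Decidable using (map′)

  prime∣!⇒≤ : ∀ {q} → Prime q → ∀ k → q ∣ k ! → q ℕ.≤ k
  prime∣!⇒≤ {q} q-prime zero q∣1 = ⊥-elim (ℕ.<⇒≱ (ℕ.nonTrivial⇒n>1 q {{prime⇒nonTrivial q-prime}}) (∣⇒≤ q∣1))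
  prime∣!⇒≤ q-prime (suc k) q∣ with euclidsLemma (suc k) (k !) q-prime q∣
  ... | inj₁ q∣k+1 = ∣⇒≤ q∣k+1
  ... | inj₂ q∣k! = ℕ.m≤n⇒m≤1+n (prime∣!⇒≤ q-prime k q∣k!)

  -- The binomial times k!(q - k)! is q!, and q divides neither factorial because k and q - k are
  -- both below q.
  prime∣binomial : ∀ {q} → Prime q → ∀ {k} → 0 ℕ.< k → k ℕ.< q → q ∣ q C k
  prime∣binomial {suc q} q-prime {k} 0<k k<q
    with euclidsLemma (suc q C k) (k ! ℕ.* (suc q ℕ.∸ k) !) q-prime
           (subst (suc q ∣_) (≡.sym factorials) (m∣m*n (q !)))
    where
    instance _ = ℕ.m*n≢0 (k !) ((suc q ℕ.∸ k) !) {{k ℕ.!≢0}} {{(suc q ℕ.∸ k) ℕ.!≢0}}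
    factorials : (suc q C k) ℕ.* (k ! ℕ.* (suc q ℕ.∸ k) !) ≡ suc q !
    factorials = ≡.trans (cong (ℕ._* (k ! ℕ.* (suc q ℕ.∸ k) !)) (nCk≡n!/k![n-k]! (ℕ.<⇒≤ k<q)))
                         (m/n*n≡m (k![n∸k]!∣n! (ℕ.<⇒≤ k<q)))
  ... | inj₁ q∣nCk = q∣nCk
  ... | inj₂ q∣k![q-k]! with euclidsLemma (k !) ((suc q ℕ.∸ k) !) q-prime q∣k![q-k]!
  ...   | inj₁ q∣k! = ⊥-elim (ℕ.<⇒≱ k<q (prime∣!⇒≤ q-prime k q∣k!))
  ...   | inj₂ q∣[q-k]! = ⊥-elim (ℕ.<⇒≱ (ℕ.∸-monoʳ-< 0<k (ℕ.<⇒≤ k<q)) (prime∣!⇒≤ q-prime _ q∣[q-k]!))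

  HasCharacteristic : ∀ {c ℓ} → CommutativeRing c ℓ → ℕ → Set ℓ
  HasCharacteristic R q = q • 1# ≈ 0#
    where
    open CommutativeRing R
    open Multiplication semiring using () renaming (_×_ to _•_)

  -- An identity in a, so it descends to every quotient; there it supplies inverses and later
  -- `fermat`.
  Periodic : ∀ {c ℓ} → CommutativeRing c ℓ → ℕ → Set (c Level.⊔ ℓ)
  Periodic R n = ∀ a → a ^ n ≈ a
    where
    open CommutativeRing R
    open Exponentiation semiring using (_^_)

  module Frobenius {c ℓ} (R : CommutativeRing c ℓ) {q : ℕ} (q-prime : Prime q)
                   (characteristic : HasCharacteristic R q) where
    open CommutativeRing R hiding (zero)
    open import Algebra.Properties.CommutativeSemiring.Exp commutativeSemiring
    open import Algebra.Properties.Semiring.Mult semiring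
      using (×-congʳ; ×-congˡ; ×-homo-1; ×-assocˡ; ×-assoc-*) renaming (_×_ to _•_)
    open import Algebra.Properties.Semiring.Sum semiring using (sum; sum-cong-≋; sum-replicate-zero; sum-init-last)
    open import Algebra.Properties.CommutativeSemiring.Binomial commutativeSemiring
      using (theorem; binomialTerm)
    open import Relation.Binary.Reasoning.Setoid setoid

    private
      nC0≡1 : ∀ n → n C 0 ≡ 1
      nC0≡1 n = ≡.trans (nCk≡nC[n∸k] {n = n} z≤n) (nCn≡1 n)

    multiple-of-q : ∀ {n} → q ∣ n → ∀ x → n • x ≈ 0#
    multiple-of-q (ℕ.divides m ≡.refl) x = begin
      (m ℕ.* q) • x        ≈⟨ ×-assocˡ x m q ⟨
      m • (q • x)          ≈⟨ ×-congʳ m (begin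
        q • x              ≈⟨ ×-congʳ q (*-identityˡ x) ⟨
        q • (1# * x)       ≈⟨ ×-assoc-* q 1# x ⟨
        (q • 1#) * x       ≈⟨ *-congʳ characteristic ⟩
        0# * x             ≈⟨ zeroˡ x ⟩
        0#                 ∎) ⟩
      m • 0#               ≈⟨ multiple-of-0 m ⟩
      0#                   ∎
      where
      multiple-of-0 : ∀ m → m • 0# ≈ 0#
      multiple-of-0 zero = refl
      multiple-of-0 (suc m) = trans (+-identityˡ _) (multiple-of-0 m)

    freshman : ∀ x y → (x + y) ^ q ≈ x ^ q + y ^ q
    freshman x y = go q-prime ≡.refl
      where
      -- Matching on m shows q as a successor, so that the first and last binomial terms can be
      -- split off.
      go : ∀ {m} → Prime m → q ≡ m → (x + y) ^ q ≈ x ^ q + y ^ q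
      go {suc n} q-prime′ ≡.refl = begin
        (x + y) ^ q
          ≈⟨ theorem q x y ⟩
        t zero + sum (λ i → t (suc i))
          ≈⟨ +-congˡ (sum-init-last (λ i → t (suc i))) ⟩
        t zero + (sum (λ i → t (suc (Fin.inject₁ i))) + t (suc (Fin.fromℕ n)))
          ≈⟨ +-cong first (+-cong middle last) ⟩
        y ^ q + (0# + x ^ q)
          ≈⟨ trans (+-congˡ (+-identityˡ (x ^ q))) (+-comm (y ^ q) (x ^ q)) ⟩
        x ^ q + y ^ q ∎
        where
        t = binomialTerm x y q
        first : t zero ≈ y ^ q
        first = trans (×-congˡ (nC0≡1 q)) (trans (×-homo-1 _) (*-identityˡ (y ^ q)))
        last : t (suc (Fin.fromℕ n)) ≈ x ^ q
        last = begin
          (q C toℕ (Fin.fromℕ q)) • (x ^ toℕ (Fin.fromℕ q) * y ^ (q ℕ.∸ toℕ (Fin.fromℕ q)))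
            ≡⟨ cong (λ k → (q C k) • (x ^ k * y ^ (q ℕ.∸ k))) (Fin.toℕ-fromℕ q) ⟩
          (q C q) • (x ^ q * y ^ (q ℕ.∸ q))
            ≈⟨ ×-congˡ (nCn≡1 q) ⟩
          1 • (x ^ q * y ^ (q ℕ.∸ q))
            ≈⟨ ×-homo-1 _ ⟩
          x ^ q * y ^ (q ℕ.∸ q)
            ≡⟨ cong (λ k → x ^ q * y ^ k) (ℕ.n∸n≡0 q) ⟩
          x ^ q * 1#
            ≈⟨ *-identityʳ (x ^ q) ⟩
          x ^ q ∎
        middle : sum (λ i → t (suc (Fin.inject₁ i))) ≈ 0#
        middle = trans (sum-cong-≋ {n = n} (λ i → multiple-of-q
          (prime∣binomial q-prime (s≤s z≤n)
            (subst (λ k → suc k ℕ.< q) (≡.sym (Fin.toℕ-inject₁ i)) (s≤s (Fin.toℕ<n i)))) _))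
          (sum-replicate-zero n)

    freshman^ : ∀ k x y → (x + y) ^ (q ℕ.^ k) ≈ x ^ (q ℕ.^ k) + y ^ (q ℕ.^ k)
    freshman^ zero x y = trans (*-identityʳ (x + y)) (sym (+-cong (*-identityʳ x) (*-identityʳ y)))
    freshman^ (suc k) x y = begin
      (x + y) ^ (q ℕ.* q ℕ.^ k)                       ≈⟨ ^-assocʳ (x + y) q (q ℕ.^ k) ⟨
      ((x + y) ^ q) ^ (q ℕ.^ k)                       ≈⟨ ^-congˡ (q ℕ.^ k) (freshman x y) ⟩
      (x ^ q + y ^ q) ^ (q ℕ.^ k)                     ≈⟨ freshman^ k (x ^ q) (y ^ q) ⟩
      (x ^ q) ^ (q ℕ.^ k) + (y ^ q) ^ (q ℕ.^ k)       ≈⟨ +-cong (^-assocʳ x q (q ℕ.^ k)) (^-assocʳ y q (q ℕ.^ k)) ⟩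
      x ^ (q ℕ.* q ℕ.^ k) + y ^ (q ℕ.* q ℕ.^ k)       ∎

  module Quotient {c ℓ} (R : CommutativeRing c ℓ) where
    open CommutativeRing R hiding (zero)

    module Ideal {ℓ′} (In : Carrier → Set ℓ′)
                 (In-resp : ∀ {x y} → x ≈ y → In x → In y)
                 (In-0 : In 0#)
                 (In-+ : ∀ {x y} → In x → In y → In (x + y))
                 (In-* : ∀ x {y} → In y → In (x * y)) where
      open import Algebra.Properties.Ring ring using (x[y-z]≈xy-xz; [y-z]x≈yx-zx; -1*x≈-x)
      open import Algebra.Properties.AbelianGroup +-abelianGroup
        using (⁻¹-anti-homo‿-; ⁻¹-∙-comm)
      open import Algebra.Properties.CommutativeSemigroup +-commutativeSemigroup using (interchange)
      open import Algebra.Properties.Group +-group using (x≈y⇒x∙y⁻¹≈ε; //-rightDividesˡ)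
      open import Relation.Binary.Reasoning.Setoid setoid

      infix 4 _~_
      -- The quotient keeps the carrier and coarsens equality. A record, unlike a synonym for
      -- membership of x - y, lets x and y be inferred.
      record _~_ (x y : Carrier) : Set ℓ′ where
        constructor congruent
        field
          difference : In (x - y)

      open _~_ public

      ≈⇒~ : ∀ {x y} → x ≈ y → x ~ y
      ≈⇒~ eq = congruent (In-resp (sym (x≈y⇒x∙y⁻¹≈ε eq)) In-0)

      private
        In-neg : ∀ {x} → In x → In (- x)
        In-neg x∈ = In-resp (-1*x≈-x _) (In-* (- 1#) x∈)

        ~-sym : ∀ {x y} → x ~ y → y ~ x
        ~-sym {x} {y} (congruent x~y) = congruent (In-resp (⁻¹-anti-homo‿- x y) (In-neg x~y))

        ~-trans : ∀ {x y z} → x ~ y → y ~ z → x ~ z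
        ~-trans {x} {y} {z} (congruent x~y) (congruent y~z) = congruent (In-resp eq (In-+ x~y y~z))
          where
          eq : (x - y) + (y - z) ≈ x - z
          eq = trans (sym (+-assoc (x - y) y (- z))) (+-congʳ (//-rightDividesˡ y x))

        +-~ : ∀ {x x′ y y′} → x ~ x′ → y ~ y′ → x + y ~ x′ + y′
        +-~ {x} {x′} {y} {y′} (congruent p) (congruent q) = congruent (In-resp
          (trans (interchange x (- x′) y (- y′)) (+-congˡ (⁻¹-∙-comm x′ y′))) (In-+ p q))

        *-~ : ∀ {x x′ y y′} → x ~ x′ → y ~ y′ → x * y ~ x′ * y′
        *-~ {x} {x′} {y} {y′} (congruent p) (congruent q) = ~-trans
          (congruent (In-resp (x[y-z]≈xy-xz x y y′) (In-* x q)))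
          (congruent (In-resp (trans (*-comm y′ (x - x′)) ([y-z]x≈yx-zx y′ x x′)) (In-* y′ p)))

        neg-~ : ∀ {x y} → x ~ y → - x ~ - y
        neg-~ {x} {y} (congruent p) = congruent (In-resp (sym (⁻¹-∙-comm x (- y))) (In-neg p))

      quotientRing : CommutativeRing c ℓ′
      quotientRing = record
        { Carrier = Carrier ; _≈_ = _~_ ; _+_ = _+_ ; _*_ = _*_ ; -_ = -_ ; 0# = 0# ; 1# = 1#
        ; isCommutativeRing = record
          { isRing = record
            { +-isAbelianGroup = record
              { isGroup = record
                { isMonoid = record
                  { isSemigroup = record
                    { isMagma = record
                      { isEquivalence = record { refl = ≈⇒~ refl ; sym = ~-sym ; trans = ~-trans }
                      ; ∙-cong = +-~ }
                    ; assoc = λ x y z → ≈⇒~ (+-assoc x y z) }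
                  ; identity = (λ x → ≈⇒~ (+-identityˡ x)) , (λ x → ≈⇒~ (+-identityʳ x)) }
                ; inverse = (λ x → ≈⇒~ (-‿inverseˡ x)) , (λ x → ≈⇒~ (-‿inverseʳ x))
                ; ⁻¹-cong = neg-~ }
              ; comm = λ x y → ≈⇒~ (+-comm x y) }
            ; *-cong = *-~
            ; *-assoc = λ x y z → ≈⇒~ (*-assoc x y z)
            ; *-identity = (λ x → ≈⇒~ (*-identityˡ x)) , (λ x → ≈⇒~ (*-identityʳ x))
            ; distrib = (λ x y z → ≈⇒~ (distribˡ x y z)) , (λ x y z → ≈⇒~ (distribʳ x y z))
            }
          ; *-comm = λ x y → ≈⇒~ (*-comm x y)
          }
        }

      -- Multiplication is literally the same, but powers recurse over a different semiring, hence
      -- the induction.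
      quotient-^ : ∀ x n → Exponentiation._^_ (CommutativeRing.semiring quotientRing) x n ≡
                           Exponentiation._^_ semiring x n
      quotient-^ x zero = ≡.refl
      quotient-^ x (suc n) = cong (x *_) (quotient-^ x n)

      quotient-× : ∀ n x → Multiplication._×_ (CommutativeRing.semiring quotientRing) n x ≡
                           Multiplication._×_ semiring n x
      quotient-× zero x = ≡.refl
      quotient-× (suc n) x = cong (x +_) (quotient-× n x)

      ~0⇒In : ∀ {x} → x ~ 0# → In x
      ~0⇒In {x} (congruent x~0) = In-resp (trans (+-congˡ ε⁻¹≈ε) (+-identityʳ x)) x~0
        where open import Algebra.Properties.Group +-group using (ε⁻¹≈ε)

      In⇒~0 : ∀ {x} → In x → x ~ 0#
      In⇒~0 {x} x∈ = congruent (In-resp (sym (trans (+-congˡ ε⁻¹≈ε) (+-identityʳ x))) x∈)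
        where open import Algebra.Properties.Group +-group using (ε⁻¹≈ε)

  module Idempotents {c ℓ} (R : CommutativeRing c ℓ) (m : ℕ) (periodic : Periodic R (2 ℕ.+ m))
                     (zero? : ∀ x → Dec (CommutativeRing._≈_ R x (CommutativeRing.0# R))) where
    open CommutativeRing R
    open import Algebra.Properties.CommutativeSemigroup *-commutativeSemigroup using (interchange; x∙yz≈y∙xz)
    open import Algebra.Properties.CommutativeSemiring.Exp commutativeSemiring
    open import Algebra.Properties.Ring ring using (x[y-z]≈xy-xz; [y-z]x≈yx-zx)
    open import Algebra.Properties.Group +-group using (x≈y⇒x∙y⁻¹≈ε; ε⁻¹≈ε)
    open import Relation.Binary.Reasoning.Setoid setoid

    private
      -- Since z * support z = z, this is the idempotent that generates the same ideal as z.
      support : Carrier → Carrier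
      support z = z ^ (1 ℕ.+ m)

      support-idempotent : ∀ z → support z * support z ≈ support z
      support-idempotent z = begin
        (z * z ^ m) * (z * z ^ m)    ≈⟨ *-assoc (z * z ^ m) z (z ^ m) ⟨
        (z * z ^ m) * z * z ^ m      ≈⟨ *-congʳ (*-comm (z * z ^ m) z) ⟩
        z ^ (2 ℕ.+ m) * z ^ m        ≈⟨ *-congʳ (periodic z) ⟩
        z * z ^ m                    ∎

      complement : ∀ {f} → f * f ≈ f → (1# - f) * f ≈ 0#
      complement {f} ff≈f = trans ([y-z]x≈yx-zx f 1# f)
        (trans (+-cong (*-identityˡ f) (-‿cong ff≈f)) (-‿inverseʳ f))

      complement-idempotent : ∀ {f} → f * f ≈ f → (1# - f) * (1# - f) ≈ 1# - f
      complement-idempotent {f} ff≈f = trans (x[y-z]≈xy-xz (1# - f) 1# f)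
        (trans (+-cong (*-identityʳ _) (trans (-‿cong (complement ff≈f)) ε⁻¹≈ε)) (+-identityʳ _))

      *-idempotent : ∀ {e f} → e * e ≈ e → f * f ≈ f → (f * e) * (f * e) ≈ f * e
      *-idempotent {e} {f} ee ff = trans (interchange f e f e) (*-cong ff ee)

    -- The supports z ^ (1 + m) are idempotents; e is cut down by each of them or by its complement
    -- while y * e stays nonzero.
    record Primitive (y : Carrier) (zs : List Carrier) : Set (c Level.⊔ ℓ) where
      field
        e : Carrier
        idempotent : e * e ≈ e
        nonzero : ¬ (y * e ≈ 0#)
        decided : All (λ z → support z * e ≈ 0# ⊎ support z * e ≈ e) zs

    cut-down : ∀ {y} → ¬ (y ≈ 0#) → ∀ zs → Primitive y zs
    cut-down {y} y≉0 [] = record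
      { e = 1# ; idempotent = *-identityˡ 1# ; nonzero = y≉0 ∘ trans (sym (*-identityʳ y)) ; decided = [] }
    cut-down {y} y≉0 (z ∷ zs) = refine (zero? (y * (f * e)))
      where
      open Primitive (cut-down y≉0 zs)
      f = support z
      ff≈f = support-idempotent z
      keep : ∀ g {z} → support z * e ≈ 0# ⊎ support z * e ≈ e →
             support z * (g * e) ≈ 0# ⊎ support z * (g * e) ≈ g * e
      keep g (inj₁ eq) = inj₁ (trans (x∙yz≈y∙xz _ g e) (trans (*-congˡ eq) (zeroʳ g)))
      keep g (inj₂ eq) = inj₂ (trans (x∙yz≈y∙xz _ g e) (*-congˡ eq))
      refine : Dec (y * (f * e) ≈ 0#) → Primitive y (z ∷ zs)
      refine (no yfe≉0) = record
        { e = f * e ; idempotent = *-idempotent idempotent ff≈f ; nonzero = yfe≉0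
        ; decided = inj₂ (trans (sym (*-assoc f f e)) (*-congʳ ff≈f)) ∷ All.map (keep f) decided }
      -- As y e = y f e + y (1 - f) e, the complement keeps y nonzero whenever f kills it.
      refine (yes yfe≈0) = record
        { e = (1# - f) * e
        ; idempotent = *-idempotent idempotent (complement-idempotent ff≈f)
        ; nonzero = λ eq → nonzero (begin
            y * e                                ≈⟨ *-congˡ (*-identityˡ e) ⟨
            y * (1# * e)                         ≈⟨ +-identityʳ _ ⟨
            y * (1# * e) + 0#                    ≈⟨ +-congˡ (trans (-‿cong yfe≈0) ε⁻¹≈ε) ⟨
            y * (1# * e) - y * (f * e)           ≈⟨ x[y-z]≈xy-xz y (1# * e) (f * e) ⟨
            y * (1# * e - f * e)                 ≈⟨ *-congˡ ([y-z]x≈yx-zx e 1# f) ⟨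
            y * ((1# - f) * e)                   ≈⟨ eq ⟩
            0#                                   ∎)
        ; decided = inj₁ (trans (sym (*-assoc f (1# - f) e))
                           (trans (*-congʳ (trans (*-comm f (1# - f)) (complement ff≈f))) (zeroˡ e)))
                    ∷ All.map (keep (1# - f)) decided }

    module ResidueField {y : Carrier} (y≉0 : ¬ (y ≈ 0#)) {M : ℕ} (enumerate : Fin M → Carrier)
             (enumerates : ∀ z → ∃ λ i → z ≈ enumerate i) where
      open Primitive (cut-down y≉0 (tabulate enumerate))

      private
        -- Every z equals a listed element, whose support has been decided; z = z * support z turns
        -- a vanishing support into a vanishing z.
        annihilates? : ∀ z → z * e ≈ 0# ⊎ support z * e ≈ e
        annihilates? z with enumerates z
        ... | i , z≈ with All.tabulate⁻ decided i
        ...   | inj₁ eq = inj₁ (begin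
          z * e                             ≈⟨ *-congʳ (periodic z) ⟨
          (z * support z) * e               ≈⟨ *-assoc z (support z) e ⟩
          z * (support z * e)               ≈⟨ *-congˡ (trans (*-congʳ (^-congˡ (1 ℕ.+ m) z≈)) eq) ⟩
          z * 0#                            ≈⟨ zeroʳ z ⟩
          0#                                ∎)
        ...   | inj₂ eq = inj₂ (trans (*-congʳ (^-congˡ (1 ℕ.+ m) z≈)) eq)

      -- The annihilator of e; its quotient is the ring eR with unit e, and membership is decidable
      -- by `zero?`.
      open Quotient.Ideal R (λ z → z * e ≈ 0#)
        (λ x≈y xe≈0 → trans (*-congʳ (sym x≈y)) xe≈0)
        (zeroˡ e)
        (λ xe≈0 ye≈0 → trans (distribʳ e _ _) (trans (+-cong xe≈0 ye≈0) (+-identityˡ 0#)))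
        (λ x ye≈0 → trans (*-assoc x _ e) (trans (*-congˡ ye≈0) (zeroʳ x)))
        public

      _~?_ : ∀ x y → Dec (x ~ y)
      x ~? y = map′ congruent difference (zero? ((x - y) * e))

      y≁0 : ¬ (y ~ 0#)
      y≁0 = nonzero ∘ ~0⇒In

      inverse : ∀ {z} → ¬ (z ~ 0#) → z * z ^ m ~ 1#
      inverse {z} z≉0 with annihilates? z
      ... | inj₁ ze≈0 = ⊥-elim (z≉0 (In⇒~0 ze≈0))
      ... | inj₂ eq = congruent (trans ([y-z]x≈yx-zx e (support z) 1#)
                        (x≈y⇒x∙y⁻¹≈ε (trans eq (sym (*-identityˡ e)))))

      -- The purpose of y: as it survives in the quotient, so does each of its factors, and one y
      -- can keep several elements nonzero.
      divisor≁0 : ∀ {a r} → y ≈ a * r → ¬ (a ~ 0#)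
      divisor≁0 {a} {r} y≈ar a~0 = y≁0 (In⇒~0 (begin
        y * e          ≈⟨ *-congʳ (trans y≈ar (*-comm a r)) ⟩
        (r * a) * e    ≈⟨ *-assoc r a e ⟩
        r * (a * e)    ≈⟨ *-congˡ (~0⇒In a~0) ⟩
        r * 0#         ≈⟨ zeroʳ r ⟩
        0#             ∎))

      divisor-~ : ∀ {a b r} → y ≈ (a - b) * r → ¬ (a ~ b)
      divisor-~ y≈ a~b = divisor≁0 y≈ (In⇒~0 (difference a~b))

-- Coordinates over the prime field: a residue field has exactly q^k elements.

module FieldCoordinates where

  open FiniteFields using (module Roots; FiniteField)
  open RingQuotients
  open import Algebra.Bundles using (CommutativeRing; RawRing)
  open import Algebra.Morphism.Structures using (IsRingMonomorphism)
  import Algebra.Morphism.RingMonomorphism as RingMonomorphism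
  import Algebra.Properties.Semiring.Exp as Exponentiation
  import Algebra.Properties.Semiring.Mult as Multiplication
  open import Data.Empty using (⊥-elim)
  open import Data.Fin as Fin using (Fin; zero; suc; toℕ; finToFun; funToFin; combine)
  import Data.Fin.Properties as Fin
  open import Data.Nat as ℕ using (ℕ; zero; suc)
  import Data.Nat.Properties as ℕ
  open import Data.Nat.Coprimality using (prime⇒coprime; coprime-Bézout)
  open import Data.Nat.GCD using (module Bézout)
  open import Data.Nat.Primality using (Prime; prime⇒nonZero)
  open import Data.Product using (_×_; _,_; proj₁; proj₂; ∃)
  open import Data.Sum using (_⊎_; inj₁; inj₂)
  open import Data.Vec using (tabulate)
  import Data.Vec.Relation.Unary.All.Properties as VecAll
  open import Function using (_∘_)
  open import Relation.Binary using (tri<; tri≈; tri>)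
  open import Relation.Binary.PropositionalEquality as ≡ using (_≡_; cong; subst)
  open import Relation.Nullary using (Dec; yes; no; ¬_)

  funToFin-cong : ∀ {m n} {f g : Fin m → Fin n} → (∀ i → f i ≡ g i) → funToFin f ≡ funToFin g
  funToFin-cong {zero} _ = ≡.refl
  funToFin-cong {suc m} f≗g = ≡.cong₂ combine (f≗g zero) (funToFin-cong (f≗g ∘ suc))

  finToFun-injective : ∀ {m n} {i j : Fin (n ℕ.^ m)} →
                       (∀ l → finToFun {n} {m} i l ≡ finToFun j l) → i ≡ j
  finToFun-injective {m} {n} {i} {j} eq =
    ≡.trans (≡.sym (Fin.funToFin-finToFin {m} {n} i))
            (≡.trans (funToFin-cong eq) (Fin.funToFin-finToFin {m} {n} j))

  module Coordinates {c ℓ} (K : CommutativeRing c ℓ) where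
    open CommutativeRing K hiding (zero; _≉_)
    open Exponentiation semiring

    module _
      {q k m : ℕ} (q-prime : Prime q) (q^k≡2+m : q ℕ.^ k ≡ 2 ℕ.+ m)
      (characteristic : HasCharacteristic K q)
      (_≟_ : ∀ a b → Dec (a ≈ b))
      (1≉0 : ¬ (1# ≈ 0#))
      (inverses : ∀ {a} → ¬ (a ≈ 0#) → ∃ λ b → a * b ≈ 1#)
      (fixed : Periodic K (q ℕ.^ k))
      (x : Carrier)
      (moved : ∀ {d} → 0 ℕ.< d → d ℕ.< k → ¬ (x ^ (q ℕ.^ d) ≈ x))
      where

      open Multiplication semiring using (×-homo-+; ×-congˡ; ×1-homo-*) renaming (_×_ to _•_)
      open Frobenius K q-prime characteristic using (freshman^)
      open Roots K using (eval; module Domain; x-y≈0⇒x≈y; x≈y⇒x-y≈0)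
      open import Algebra.Properties.CommutativeSemiring.Exp commutativeSemiring using (^-distrib-*)
      open import Algebra.Properties.Group +-group
        using (//-rightDividesˡ; //-rightDividesʳ) renaming (∙-cancelˡ to +-cancelˡ)
      open import Algebra.Properties.AbelianGroup +-abelianGroup using (⁻¹-∙-comm)
      open import Algebra.Properties.CommutativeSemigroup +-commutativeSemigroup using (interchange)
      open import Algebra.Properties.Ring ring using (x[y-z]≈xy-xz)
      open import Relation.Binary.Reasoning.Setoid setoid

      private
        instance
          q≢0 : ℕ.NonZero q
          q≢0 = prime⇒nonZero q-prime

        domain : ∀ {a b} → a * b ≈ 0# → a ≈ 0# ⊎ b ≈ 0#
        domain {a} {b} ab≈0 with a ≟ 0#
        ... | yes a≈0 = inj₁ a≈0
        ... | no a≉0 = let (a⁻¹ , aa⁻¹≈1) = inverses a≉0 in inj₂ (begin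
          b                 ≈⟨ *-identityˡ b ⟨
          1# * b            ≈⟨ *-congʳ (trans (*-comm a⁻¹ a) aa⁻¹≈1) ⟨
          (a⁻¹ * a) * b     ≈⟨ *-assoc a⁻¹ a b ⟩
          a⁻¹ * (a * b)     ≈⟨ *-congˡ ab≈0 ⟩
          a⁻¹ * 0#          ≈⟨ zeroʳ a⁻¹ ⟩
          0#                ∎)

        open Domain domain using (vanishing; few-fixed-points)

        ^-- : ∀ j a b → (a - b) ^ (q ℕ.^ j) ≈ a ^ (q ℕ.^ j) - b ^ (q ℕ.^ j)
        ^-- j a b = begin
          (a - b) ^ P                       ≈⟨ //-rightDividesʳ (b ^ P) ((a - b) ^ P) ⟨
          (a - b) ^ P + b ^ P - b ^ P       ≈⟨ +-congʳ (freshman^ j (a - b) b) ⟨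
          (a - b + b) ^ P - b ^ P           ≈⟨ +-congʳ (^-congˡ P (//-rightDividesˡ b a)) ⟩
          a ^ P - b ^ P                     ∎
          where P = q ℕ.^ j

        scalar : ℕ → Carrier
        scalar n = n • 1#

        -- Powers of Frobenius are additive and fix 0 and 1, so induction on n gives Fermat's little
        -- theorem.
        scalar-fixed : ∀ j n → scalar n ^ (q ℕ.^ j) ≈ scalar n
        scalar-fixed j zero = zero-power (q ℕ.^ j) {{ℕ.m^n≢0 q j}}
          where
          zero-power : ∀ n → .{{ℕ.NonZero n}} → 0# ^ n ≈ 0#
          zero-power (suc n) = zeroˡ _
        scalar-fixed j (suc n) = trans (freshman^ j 1# (scalar n))
                                           (+-cong (one-power (q ℕ.^ j)) (scalar-fixed j n))
          where
          one-power : ∀ n → 1# ^ n ≈ 1#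
          one-power zero = refl
          one-power (suc n) = trans (*-identityˡ _) (one-power n)

        -- A Bézout relation between q and d would write 1 in terms of two vanishing scalars.
        scalar≉0 : ∀ {d} → 0 ℕ.< d → d ℕ.< q → ¬ (scalar d ≈ 0#)
        scalar≉0 {d} 0<d d<q d≈0 with coprime-Bézout (prime⇒coprime q-prime {{ℕ.>-nonZero 0<d}} d<q)
        ... | Bézout.+- u v eq = 1≉0 (begin
          1#                            ≈⟨ +-identityʳ 1# ⟨
          1# + 0#                       ≈⟨ +-congˡ (trans (×1-homo-* v d) (trans (*-congˡ d≈0) (zeroʳ _))) ⟨
          scalar (1 ℕ.+ v ℕ.* d)        ≈⟨ ×-congˡ eq ⟩
          scalar (u ℕ.* q)              ≈⟨ trans (×1-homo-* u q) (trans (*-congˡ characteristic) (zeroʳ _)) ⟩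
          0#                            ∎)
        ... | Bézout.-+ u v eq = 1≉0 (begin
          1#                            ≈⟨ +-identityʳ 1# ⟨
          1# + 0#                       ≈⟨ +-congˡ (trans (×1-homo-* u q) (trans (*-congˡ characteristic) (zeroʳ _))) ⟨
          scalar (1 ℕ.+ u ℕ.* q)        ≈⟨ ×-congˡ eq ⟩
          scalar (v ℕ.* d)              ≈⟨ trans (×1-homo-* v d) (trans (*-congˡ d≈0) (zeroʳ _)) ⟩
          0#                            ∎)

        scalar-< : ∀ {a b} → a ℕ.< b → b ℕ.< q → ¬ (scalar a ≈ scalar b)
        scalar-< {a} {b} a<b b<q eq = scalar≉0 (ℕ.m<n⇒0<n∸m a<b) (ℕ.≤-<-trans (ℕ.m∸n≤m b a) b<q)
          (+-cancelˡ (scalar a) _ _ (begin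
            scalar a + scalar (b ℕ.∸ a)   ≈⟨ ×-homo-+ 1# a (b ℕ.∸ a) ⟨
            scalar (a ℕ.+ (b ℕ.∸ a))      ≈⟨ ×-congˡ (ℕ.m+[n∸m]≡n (ℕ.<⇒≤ a<b)) ⟩
            scalar b                      ≈⟨ eq ⟨
            scalar a                      ≈⟨ +-identityʳ (scalar a) ⟨
            scalar a + 0#                 ∎))

        scalar-injective : ∀ (i j : Fin q) → scalar (toℕ i) ≈ scalar (toℕ j) → i ≡ j
        scalar-injective i j eq with ℕ.<-cmp (toℕ i) (toℕ j)
        ... | tri< i<j _ _ = ⊥-elim (scalar-< i<j (Fin.toℕ<n j) eq)
        ... | tri≈ _ i≡j _ = Fin.toℕ-injective i≡j
        ... | tri> _ _ j<i = ⊥-elim (scalar-< j<i (Fin.toℕ<n i) (sym eq))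

        polynomial : ∀ {n} → (Fin n → Carrier) → Carrier → Carrier
        polynomial f t = eval (tabulate f) t

        polynomial-- : ∀ {n} (f g : Fin n → Carrier) t →
                       polynomial (λ i → f i - g i) t ≈ polynomial f t - polynomial g t
        polynomial-- {zero} f g t = sym (-‿inverseʳ 0#)
        polynomial-- {suc n} f g t = begin
          (f zero - g zero) + t * polynomial (λ i → f (suc i) - g (suc i)) t
            ≈⟨ +-congˡ (trans (*-congˡ (polynomial-- (f ∘ suc) (g ∘ suc) t)) (x[y-z]≈xy-xz t _ _)) ⟩
          (f zero - g zero) + (t * polynomial (f ∘ suc) t - t * polynomial (g ∘ suc) t)
            ≈⟨ trans (interchange _ _ _ _) (+-congˡ (⁻¹-∙-comm _ _)) ⟩
          polynomial f t - polynomial g t ∎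

        -- Frobenius passes through coefficients that it fixes; a root in x is thereby a root in
        -- every conjugate of x.
        polynomial-^ : ∀ j {n} (f : Fin n → Carrier) → (∀ i → f i ^ (q ℕ.^ j) ≈ f i) → ∀ t →
                       polynomial f t ^ (q ℕ.^ j) ≈ polynomial f (t ^ (q ℕ.^ j))
        polynomial-^ j {zero} f _ t = scalar-fixed j 0
        polynomial-^ j {suc n} f f-fixed t = begin
          (f zero + t * polynomial (f ∘ suc) t) ^ P
            ≈⟨ freshman^ j _ _ ⟩
          f zero ^ P + (t * polynomial (f ∘ suc) t) ^ P
            ≈⟨ +-cong (f-fixed zero)
                 (trans (^-distrib-* t _ P) (*-congˡ (polynomial-^ j (f ∘ suc) (f-fixed ∘ suc) t))) ⟩
          polynomial f (t ^ P) ∎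
          where P = q ℕ.^ j

        conjugate : ℕ → Carrier
        conjugate j = x ^ (q ℕ.^ j)

        ^q^+ : ∀ a i j → a ^ (q ℕ.^ (i ℕ.+ j)) ≈ (a ^ (q ℕ.^ i)) ^ (q ℕ.^ j)
        ^q^+ a i j = trans (^-congʳ a (ℕ.^-distribˡ-+-* q i j)) (sym (^-assocʳ a (q ℕ.^ i) (q ℕ.^ j)))

        -- Raising to the power q^(k-i) returns conjugate i to x, by periodicity, and conjugate j to
        -- x^(q^(j-i)); their equality would contradict `moved`.
        conjugate-< : ∀ {i j} → i ℕ.< j → j ℕ.< k → ¬ (conjugate i ≈ conjugate j)
        conjugate-< {i} {j} i<j j<k eq = moved (ℕ.m<n⇒0<n∸m i<j) (ℕ.≤-<-trans (ℕ.m∸n≤m j i) j<k) (sym (begin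
          x                                      ≈⟨ back ⟨
          w ^ (q ℕ.^ e)                          ≈⟨ ^-congˡ (q ℕ.^ e) (begin
            w                                    ≈⟨ eq ⟩
            conjugate j                          ≡⟨ cong conjugate (ℕ.m+[n∸m]≡n (ℕ.<⇒≤ i<j)) ⟨
            conjugate (i ℕ.+ d)                  ≈⟨ ^q^+ x i d ⟩
            w ^ (q ℕ.^ d)                        ∎) ⟩
          (w ^ (q ℕ.^ d)) ^ (q ℕ.^ e)            ≈⟨ ^q^+ w d e ⟨
          w ^ (q ℕ.^ (d ℕ.+ e))                  ≡⟨ cong (λ n → w ^ (q ℕ.^ n)) (ℕ.+-comm d e) ⟩
          w ^ (q ℕ.^ (e ℕ.+ d))                  ≈⟨ ^q^+ w e d ⟩
          (w ^ (q ℕ.^ e)) ^ (q ℕ.^ d)            ≈⟨ ^-congˡ (q ℕ.^ d) back ⟩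
          x ^ (q ℕ.^ d)                          ∎))
          where
          d = j ℕ.∸ i
          e = k ℕ.∸ i
          w = conjugate i
          back : w ^ (q ℕ.^ e) ≈ x
          back = begin
            w ^ (q ℕ.^ e)           ≈⟨ ^q^+ x i e ⟨
            conjugate (i ℕ.+ e)     ≡⟨ cong conjugate (ℕ.m+[n∸m]≡n (ℕ.<⇒≤ (ℕ.<-trans i<j j<k))) ⟩
            conjugate k             ≈⟨ fixed x ⟩
            x                       ∎

        conjugate-injective : ∀ {i j : Fin k} → conjugate (toℕ i) ≈ conjugate (toℕ j) → i ≡ j
        conjugate-injective {i} {j} eq with ℕ.<-cmp (toℕ i) (toℕ j)
        ... | tri< i<j _ _ = ⊥-elim (conjugate-< i<j (Fin.toℕ<n j) eq)
        ... | tri≈ _ i≡j _ = Fin.toℕ-injective i≡j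
        ... | tri> _ _ j<i = ⊥-elim (conjugate-< j<i (Fin.toℕ<n i) (sym eq))

        digits : Fin (q ℕ.^ k) → Fin k → Carrier
        digits i l = scalar (toℕ (finToFun i l))

        φ : Fin (q ℕ.^ k) → Carrier
        φ i = polynomial (digits i) x

        -- The difference polynomial has degree < k and vanishes at the k conjugates of x.
        φ-injective : ∀ {i j} → φ i ≈ φ j → i ≡ j
        φ-injective {i} {j} φi≈φj = finToFun-injective {k} {q} (λ l → scalar-injective _ _ (x-y≈0⇒x≈y
          (VecAll.tabulate⁻ (vanishing (tabulate diff) (λ l → conjugate (toℕ l)) conjugate-injective root) l)))
          where
          diff : Fin k → Carrier
          diff l = digits i l - digits j l
          root : ∀ l → polynomial diff (conjugate (toℕ l)) ≈ 0#
          root l = begin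
            polynomial diff (conjugate n)    ≈⟨ polynomial-^ n diff (λ l → trans (^-- n _ _)
                                                  (+-cong (scalar-fixed n (toℕ (finToFun i l)))
                                                          (-‿cong (scalar-fixed n (toℕ (finToFun j l)))))) x ⟨
            polynomial diff x ^ (q ℕ.^ n)    ≈⟨ ^-congˡ (q ℕ.^ n)
                                              (trans (polynomial-- (digits i) (digits j) x) (x≈y⇒x-y≈0 φi≈φj)) ⟩
            0# ^ (q ℕ.^ n)                   ≈⟨ scalar-fixed n 0 ⟩
            0#                               ∎
            where n = toℕ l

        -- Otherwise t ^ Q - t would have more than Q roots, for Q = q ^ k.
        φ-surjective : ∀ a → ∃ λ i → φ i ≈ a
        φ-surjective a with Fin.any? (λ i → φ i ≟ a)
        ... | yes found = found
        ... | no missed = ⊥-elim (1≉0 (few-fixed-points m roots roots-injective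
                            (λ i → subst (λ n → roots i ^ n ≈ roots i) q^k≡2+m (fixed (roots i)))))
          where
          cast : Fin (2 ℕ.+ m) → Fin (q ℕ.^ k)
          cast = Fin.cast (≡.sym q^k≡2+m)
          roots : Fin (3 ℕ.+ m) → Carrier
          roots zero = a
          roots (suc i) = φ (cast i)
          roots-injective : ∀ {i j} → roots i ≈ roots j → i ≡ j
          roots-injective {zero} {zero} _ = ≡.refl
          roots-injective {zero} {suc j} eq = ⊥-elim (missed (cast j , sym eq))
          roots-injective {suc i} {zero} eq = ⊥-elim (missed (cast i , eq))
          roots-injective {suc i} {suc j} eq = cong suc (Fin.toℕ-injective
            (≡.trans (≡.sym (Fin.toℕ-cast _ i)) (≡.trans (cong toℕ (φ-injective eq)) (Fin.toℕ-cast _ j))))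

        ψ : Carrier → Fin (q ℕ.^ k)
        ψ a = proj₁ (φ-surjective a)

        φψ : ∀ a → φ (ψ a) ≈ a
        φψ a = proj₂ (φ-surjective a)

        transported : RawRing _ _
        transported = record
          { Carrier = Fin (q ℕ.^ k) ; _≈_ = _≡_
          ; _+_ = λ i j → ψ (φ i + φ j) ; _*_ = λ i j → ψ (φ i * φ j) ; -_ = λ i → ψ (- φ i)
          ; 0# = ψ 0# ; 1# = ψ 1# }

        -- As ψ is a section of φ, φ respects the operations on numerals, and the ring laws pull
        -- back along it.
        isRingMonomorphism : IsRingMonomorphism transported rawRing φ
        isRingMonomorphism = record
          { isRingHomomorphism = record
            { isSemiringHomomorphism = record
              { isNearSemiringHomomorphism = record
                { +-isMonoidHomomorphism = record
                  { isMagmaHomomorphism = record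
                    { isRelHomomorphism = record { cong = reflexive ∘ cong φ }
                    ; homo = λ i j → φψ (φ i + φ j) }
                  ; ε-homo = φψ 0# }
                ; *-homo = λ i j → φψ (φ i * φ j) }
              ; 1#-homo = φψ 1# }
            ; -‿homo = λ i → φψ (- φ i) }
          ; injective = φ-injective }

      finiteField : FiniteField (q ℕ.^ k)
      finiteField = record
        { _+_ = λ i j → ψ (φ i + φ j) ; _*_ = λ i j → ψ (φ i * φ j) ; -_ = λ i → ψ (- φ i)
        ; 0# = ψ 0# ; 1# = ψ 1#
        ; isCommutativeRing = RingMonomorphism.isCommutativeRing isRingMonomorphism isCommutativeRing
        ; 1≢0 = λ eq → 1≉0 (trans (sym (φψ 1#)) (trans (reflexive (cong φ eq)) (φψ 0#)))
        ; inverse = λ {i} i≢0 →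
            let (b , φi*b≈1) = inverses (λ φi≈0 → i≢0 (φ-injective (trans φi≈0 (sym (φψ 0#))))) in
            ψ b , φ-injective (trans (φψ _) (trans (*-congˡ (φψ b)) (trans φi*b≈1 (sym (φψ 1#)))))
        ; fermat = λ i → φ-injective (trans (φ-^ i (q ℕ.^ k)) (fixed (φ i)))
        }
        where
        ring′ : CommutativeRing _ _
        ring′ = record { isCommutativeRing = RingMonomorphism.isCommutativeRing isRingMonomorphism isCommutativeRing }
        φ-^ : ∀ i n → φ (Exponentiation._^_ (CommutativeRing.semiring ring′) i n) ≈ φ i ^ n
        φ-^ i zero = φψ 1#
        φ-^ i (suc n) = trans (φψ _) (*-congˡ (φ-^ i n))

  module ResidueFieldOfOrder {c ℓ} (A : CommutativeRing c ℓ) where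
    open CommutativeRing A hiding (zero)
    open Exponentiation semiring

    module _
      {q k m : ℕ} (q-prime : Prime q) (q^k≡2+m : q ℕ.^ k ≡ 2 ℕ.+ m)
      (characteristic : HasCharacteristic A q)
      (zero? : ∀ a → Dec (a ≈ 0#))
      (fixed : Periodic A (q ℕ.^ k))
      {M : ℕ} (enumerate : Fin M → Carrier) (enumerates : ∀ a → ∃ λ i → a ≈ enumerate i)
      (x : Carrier) {y : Carrier} (y≉0 : ¬ (y ≈ 0#))
      (factor : ∀ {d} → 0 ℕ.< d → d ℕ.< k → ∃ λ r → y ≈ (x ^ (q ℕ.^ d) - x) * r)
      where

      private
        module Residue = Idempotents.ResidueField A m (subst (Periodic A) q^k≡2+m fixed)
                                  zero? y≉0 enumerate enumerates
        open Residue using (_~_; ≈⇒~)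

      finiteField : FiniteField (q ℕ.^ k)
      finiteField = Coordinates.finiteField Residue.quotientRing q-prime q^k≡2+m
        (subst (_~ 0#) (≡.sym (Residue.quotient-× q 1#)) (≈⇒~ characteristic))
        Residue._~?_
        -- The unit is a factor of y = 1 · y, so it is nonzero in the quotient.
        (Residue.divisor≁0 (sym (*-identityˡ y)))
        (λ {a} a≁0 → a ^ m , Residue.inverse a≁0)
        (λ a → subst (_~ a) (≡.sym (Residue.quotient-^ a (q ℕ.^ k))) (≈⇒~ (fixed a)))
        x
        (λ {d} 0<d d<k x^~x → Residue.divisor-~ (proj₂ (factor 0<d d<k))
          (subst (_~ x) (Residue.quotient-^ x (q ℕ.^ d)) x^~x))

-- Group rings of cyclic groups, and a field of every prime power order.

module GroupRings where

  open FiniteSums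
  open Weaving using (cyclicGroup; mod-+ᶜ; mod-toℕ; mod-cong; toℕ-mod-<)
  open FiniteFields using (FiniteField)
  open RingQuotients
  open FieldCoordinates
  open import Algebra.Bundles using (AbelianGroup; CommutativeRing)
  import Algebra.Properties.Semiring.Exp as Exponentiation
  import Algebra.Properties.Semiring.Mult as Multiplication
  import Algebra.Properties.Semiring.Sum as Summation
  open import Data.Empty using (⊥-elim)
  open import Data.Fin as Fin using (Fin; zero; suc; toℕ; finToFun; funToFin)
  import Data.Fin.Properties as Fin
  open import Data.Integer as ℤ using (ℤ; +_; 0ℤ; 1ℤ)
  open import Data.Integer.DivMod using (_%ℕ_; _/ℕ_; n%ℕd<d; a≡a%ℕn+[a/ℕn]*n)
  open import Data.Integer.Divisibility.Signed
    using (_∣_; divides; ∣⇒∣ᵤ; _∣?_; ∣m∣n⇒∣m+n; ∣n⇒∣m*n)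
  import Data.Integer.Properties as ℤ
  open import Data.Integer.Tactic.RingSolver using (solve-∀)
  open import Data.Nat as ℕ using (ℕ; zero; suc; s≤s; z≤n)
  import Data.Nat.Divisibility as ℕ
  open import Data.Nat.DivMod using (_mod_; _%_; [m+kn]%n≡m%n)
  import Data.Nat.Properties as ℕ
  open import Data.Nat.Primality using (Prime; prime⇒nonZero; prime⇒nonTrivial)
  open import Data.Product using (_×_; _,_; proj₁; ∃)
  open import Function using (_∘_; _↔_; mk↔ₛ′)
  open import Level using (0ℓ)
  open import Relation.Binary.PropositionalEquality
  open import Relation.Nullary using (Dec; yes; no; ¬_)
  open import Relation.Nullary.Decidable using (map′)

  ∣-∑ : {A : Set} {{_ : Finite A}} {q : ℤ} {f : A → ℤ} → (∀ i → q ∣ f i) → q ∣ ∑ f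
  ∣-∑ {q = q} q∣f = divides (∑ (λ i → _∣_.quotient (q∣f i)))
    (trans (∑-cong (λ i → _∣_.equality (q∣f i))) (∑-*ʳ q (λ i → _∣_.quotient (q∣f i))))

  module GroupRing (n : ℕ) where
    private
      N = suc n

    open AbelianGroup (cyclicGroup n) using (_∙_; ε; _⁻¹)
      renaming (_-_ to _//_; assoc to ∙-assoc; comm to ∙-comm; identityʳ to ∙-identityʳ)
    open import Algebra.Properties.AbelianGroup (cyclicGroup n)
      using (//-rightDividesˡ; //-rightDividesʳ; ⁻¹-anti-homo-∙; ⁻¹-anti-homo-//; ε⁻¹≈ε; ∙-cancelʳ)
    open ≡-Reasoning

    -- Coefficients are integers and reduction modulo q is a later quotient, so that leading
    -- coefficients are computed exactly.
    Element : Set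
    Element = Fin N → ℤ

    private
      -- The substitution that exchanges the two factors of a convolution; `translation` does the
      -- same service for associativity.
      reflection : Fin N → Fin N ↔ Fin N
      reflection k = mk↔ₛ′ (k //_) (k //_) involutive involutive
        where
        involutive : ∀ i → k // (k // i) ≡ i
        involutive i = begin
          k ∙ (k // i) ⁻¹   ≡⟨ cong (k ∙_) (⁻¹-anti-homo-// k i) ⟩
          k ∙ (i // k)      ≡⟨ ∙-comm k (i // k) ⟩
          (i // k) ∙ k      ≡⟨ //-rightDividesˡ k i ⟩
          i                 ∎

      translation : Fin N → Fin N ↔ Fin N
      translation j = mk↔ₛ′ (_∙ j) (_// j) (//-rightDividesˡ j) (//-rightDividesʳ j)

    opaque
      infixl 7 _⊛_
      _⊛_ : Element → Element → Element
      (f ⊛ g) k = ∑ (λ i → f i ℤ.* g (k // i))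

      ⊛-comm : ∀ f g k → (f ⊛ g) k ≡ (g ⊛ f) k
      ⊛-comm f g k = begin
        ∑ (λ i → f i ℤ.* g (k // i))                   ≡⟨ ∑-↔ (reflection k) (λ i → f i ℤ.* g (k // i)) ⟩
        ∑ (λ i → f (k // i) ℤ.* g (k // (k // i)))     ≡⟨ ∑-cong (λ i → trans (ℤ.*-comm (f (k // i)) _)

            (cong (λ j → g j ℤ.* f (k // i)) (Inverse.strictlyInverseˡ (reflection k) i))) ⟩
        ∑ (λ i → g i ℤ.* f (k // i))                   ∎
        where open import Function using (module Inverse)

      ⊛-assoc : ∀ f g h k → ((f ⊛ g) ⊛ h) k ≡ (f ⊛ (g ⊛ h)) k
      ⊛-assoc f g h k = begin
        ∑ (λ i → ∑ (λ j → f j ℤ.* g (i // j)) ℤ.* h (k // i))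
          ≡⟨ ∑-cong (λ i → trans (sym (∑-*ʳ (h (k // i)) (λ j → f j ℤ.* g (i // j))))
               (∑-cong (λ j → ℤ.*-assoc (f j) (g (i // j)) (h (k // i))))) ⟩
        ∑ (λ i → ∑ (λ j → f j ℤ.* (g (i // j) ℤ.* h (k // i))))
          ≡⟨ ∑-comm (λ i j → f j ℤ.* (g (i // j) ℤ.* h (k // i))) ⟩
        ∑ (λ j → ∑ (λ i → f j ℤ.* (g (i // j) ℤ.* h (k // i))))
          ≡⟨ ∑-cong (λ j → trans (∑-*ˡ (f j) (λ i → g (i // j) ℤ.* h (k // i))) (cong (f j ℤ.*_) (inner j))) ⟩
        ∑ (λ j → f j ℤ.* (g ⊛ h) (k // j)) ∎
        where
        inner : ∀ j → ∑ (λ i → g (i // j) ℤ.* h (k // i)) ≡ (g ⊛ h) (k // j)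
        inner j = trans (∑-↔ (translation j) (λ i → g (i // j) ℤ.* h (k // i)))
          (∑-cong (λ i → cong₂ (λ a b → g a ℤ.* h b) (//-rightDividesʳ j i)
            (trans (cong (k ∙_) (⁻¹-anti-homo-∙ i j)) (sym (∙-assoc k (j ⁻¹) (i ⁻¹))))))

      ⊛-identityˡ : ∀ f k → (δ ε ⊛ f) k ≡ f k
      ⊛-identityˡ f k = trans (∑-δ ε (λ i → f (k // i)))
        (cong f (trans (cong (k ∙_) ε⁻¹≈ε) (∙-identityʳ k)))

      ⊛-distribˡ : ∀ f g h k → (f ⊛ (λ i → g i ℤ.+ h i)) k ≡ (f ⊛ g) k ℤ.+ (f ⊛ h) k
      ⊛-distribˡ f g h k = trans (∑-cong (λ i → ℤ.*-distribˡ-+ (f i) (g (k // i)) (h (k // i))))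
        (∑-+ (λ i → f i ℤ.* g (k // i)) (λ i → f i ℤ.* h (k // i)))

      ⊛-cong : ∀ {f f′ g g′} → f ≗ f′ → g ≗ g′ → f ⊛ g ≗ f′ ⊛ g′
      ⊛-cong p q k = ∑-cong (λ i → cong₂ ℤ._*_ (p i) (q (k // i)))

      ⊛-negˡ : ∀ f g k → ((λ i → ℤ.- f i) ⊛ g) k ≡ ℤ.- (f ⊛ g) k
      ⊛-negˡ f g k = trans (∑-cong (λ i → sym (ℤ.neg-distribˡ-* (f i) (g (k // i)))))
                           (∑-neg (λ i → f i ℤ.* g (k // i)))

      δ-⊛ : ∀ j f k → (δ j ⊛ f) k ≡ f (k // j)
      δ-⊛ j f k = ∑-δ j (λ i → f (k // i))

      ∣-⊛ : ∀ {q} f {g} → (∀ i → q ∣ g i) → ∀ k → q ∣ (f ⊛ g) k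
      ∣-⊛ f q∣g k = ∣-∑ (λ i → ∣n⇒∣m*n (f i) (q∣g (k // i)))


    groupRing : CommutativeRing 0ℓ 0ℓ
    groupRing = record
      { Carrier = Element ; _≈_ = _≗_
      ; _+_ = λ f g i → f i ℤ.+ g i ; _*_ = _⊛_ ; -_ = λ f i → ℤ.- f i
      ; 0# = λ _ → 0ℤ ; 1# = δ ε
      ; isCommutativeRing = record
        { isRing = record
          { +-isAbelianGroup = record
            { isGroup = record
              { isMonoid = record
                { isSemigroup = record
                  { isMagma = record
                    { isEquivalence = record
                      { refl = λ _ → refl ; sym = λ p i → sym (p i) ; trans = λ p q i → trans (p i) (q i) }
                    ; ∙-cong = λ p q i → cong₂ ℤ._+_ (p i) (q i) }
                  ; assoc = λ f g h i → ℤ.+-assoc (f i) (g i) (h i) }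
                ; identity = (λ f i → ℤ.+-identityˡ (f i)) , (λ f i → ℤ.+-identityʳ (f i)) }
              ; inverse = (λ f i → ℤ.+-inverseˡ (f i)) , (λ f i → ℤ.+-inverseʳ (f i))
              ; ⁻¹-cong = λ p i → cong ℤ.-_ (p i) }
            ; comm = λ f g i → ℤ.+-comm (f i) (g i) }
          ; *-cong = ⊛-cong
          ; *-assoc = ⊛-assoc
          ; *-identity = ⊛-identityˡ , λ f k → trans (⊛-comm f (δ ε) k) (⊛-identityˡ f k)
          ; distrib = ⊛-distribˡ , λ f g h k → trans (⊛-comm (λ i → g i ℤ.+ h i) f k) (trans (⊛-distribˡ f g h k)
              (cong₂ ℤ._+_ (⊛-comm f g k) (⊛-comm f h k)))
          }
        ; *-comm = ⊛-comm
        }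
      }

    monomial : ℕ → Element
    monomial j = δ (j mod N)

    monomial-⊛ : ∀ j f k → (monomial j ⊛ f) k ≡ f (k // (j mod N))
    monomial-⊛ j f k = δ-⊛ (j mod N) f k

    monomial-+ : ∀ i j → (monomial i ⊛ monomial j) ≗ monomial (i ℕ.+ j)
    monomial-+ i j k = begin
      (monomial i ⊛ monomial j) k                       ≡⟨ monomial-⊛ i (monomial j) k ⟩
      δ (j mod N) (k // a)                              ≡⟨ δ-injective (_∙ a) (∙-cancelʳ a _ _) (j mod N) (k // a) ⟨
      δ ((j mod N) ∙ a) ((k // a) ∙ a)                  ≡⟨ cong₂ δ (trans (mod-+ᶜ n j i) (cong (_mod N) (ℕ.+-comm j i)))
                                                             (//-rightDividesˡ a k) ⟩
      monomial (i ℕ.+ j) k                              ∎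
      where a = i mod N

    -- No wrap-around occurs for j ≤ i, which is what lets degrees be spoken of in a group ring.
    toℕ-// : ∀ {j} i → j ℕ.≤ toℕ i → toℕ (i // (j mod N)) ≡ toℕ i ℕ.∸ j
    toℕ-// {j} i j≤i = trans (cong toℕ (∙-cancelʳ (j mod N) _ _ (begin
      (i // (j mod N)) ∙ (j mod N)              ≡⟨ //-rightDividesˡ (j mod N) i ⟩
      i                                         ≡⟨ mod-toℕ n i ⟨
      toℕ i mod N                               ≡⟨ cong (_mod N) (ℕ.m∸n+n≡m j≤i) ⟨
      (toℕ i ℕ.∸ j ℕ.+ j) mod N                 ≡⟨ mod-+ᶜ n (toℕ i ℕ.∸ j) j ⟨
      ((toℕ i ℕ.∸ j) mod N) ∙ (j mod N)         ∎)))
      (toℕ-mod-< n (ℕ.≤-<-trans (ℕ.m∸n≤m (toℕ i) j) (Fin.toℕ<n i)))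

    open CommutativeRing groupRing public using (semiring; _-_)
    open Exponentiation semiring public using (_^_)
    open Multiplication semiring public using () renaming (_×_ to _•_)
    open Summation semiring public using (sum)

    x : Element
    x = monomial 1

    x^ : ∀ j → x ^ j ≗ monomial j
    x^ zero i = cong (λ k → δ k i) (sym (mod-toℕ n ε))
    x^ (suc j) i = trans (CommutativeRing.*-congˡ groupRing {x} (x^ j) i) (monomial-+ 1 j i)

    •-coefficient : ∀ m f i → (m • f) i ≡ + m ℤ.* f i
    •-coefficient zero f i = refl
    •-coefficient (suc m) f i = trans (cong (ℤ._+_ (f i)) (•-coefficient m f i)) (sym (ℤ.suc-* (+ m) (f i)))

    opaque
      unfolding ∑
      sum-coefficient : ∀ {m} (t : Fin m → Element) i → sum t i ≡ ∑ (λ j → t j i)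
      sum-coefficient {zero} t i = refl
      sum-coefficient {suc m} t i = cong (ℤ._+_ (t zero i)) (sum-coefficient (t ∘ suc) i)

    -- The degree refers to the exponents 0, ..., N - 1. For D ≥ N both clauses hold vacuously; the
    -- bound D < N is imposed where the leading coefficient is read off.
    MonicOfDegree : ℕ → Element → Set
    MonicOfDegree D f = (∀ i → toℕ i ≡ D → f i ≡ 1ℤ) × (∀ i → D ℕ.< toℕ i → f i ≡ 0ℤ)

    -- The coefficient at i is f(i - j) - f(i - 1). For i ≥ D + j with j ≥ 2 the index i - 1 exceeds
    -- D, so only the first term is left.
    monic-step : ∀ {D f j} → 2 ℕ.≤ j → MonicOfDegree D f → MonicOfDegree (D ℕ.+ j) ((monomial j - x) ⊛ f)
    monic-step {D} {f} {j} 2≤j (lead , above) =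
      (λ i eq → trans (coefficient i) (cong₂ ℤ._-_
        (lead _ (trans (toℕ-// i (subst (j ℕ.≤_) (sym eq) (ℕ.m≤n+m j D)))
                       (trans (cong (ℕ._∸ j) eq) (ℕ.m+n∸n≡m D j))))
        (vanish-x i (ℕ.≤-reflexive (sym eq))))) ,
      (λ i lt → trans (coefficient i) (cong₂ ℤ._-_
        (above _ (subst (D ℕ.<_) (sym (toℕ-// i (ℕ.<⇒≤ (ℕ.≤-<-trans (ℕ.m≤n+m j D) lt))))
                    (ℕ.m+n≤o⇒m≤o∸n (suc D) lt)))
        (vanish-x i (ℕ.<⇒≤ lt))))
      where
      coefficient : ∀ i → ((monomial j - x) ⊛ f) i ≡ f (i // (j mod N)) ℤ.- f (i // (1 mod N))
      coefficient i = trans (CommutativeRing.distribʳ groupRing f (monomial j) (λ k → ℤ.- x k) i)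
        (cong₂ ℤ._+_ (monomial-⊛ j f i)
          (trans (⊛-negˡ x f i) (cong ℤ.-_ (monomial-⊛ 1 f i))))
      vanish-x : ∀ i → D ℕ.+ j ℕ.≤ toℕ i → f (i // (1 mod N)) ≡ 0ℤ
      vanish-x i le = above _ (subst (D ℕ.<_) (sym (toℕ-// i
                         (ℕ.≤-trans (s≤s z≤n) (ℕ.≤-trans 2≤j (ℕ.≤-trans (ℕ.m≤n+m j D) le)))))
                         (ℕ.m+n≤o⇒m≤o∸n (suc D) (subst (ℕ._≤ toℕ i) (ℕ.+-suc D 1) D+2≤i)))
        where
        D+2≤i : D ℕ.+ 2 ℕ.≤ toℕ i
        D+2≤i = ℕ.≤-trans (ℕ.+-monoʳ-≤ D 2≤j) le

  module FieldOfOrder {q : ℕ} (q-prime : Prime q) (k m : ℕ) (q^[1+k]≡2+m : q ℕ.^ suc k ≡ 2 ℕ.+ m) where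
    private
      N = suc m
      Q = q ℕ.^ suc k
      instance
        q≢0 : ℕ.NonZero q
        q≢0 = prime⇒nonZero q-prime
      2≤q : 2 ℕ.≤ q
      2≤q = ℕ.nonTrivial⇒n>1 q {{prime⇒nonTrivial q-prime}}

    open GroupRing m
    private module Z = CommutativeRing groupRing

    open Quotient.Ideal groupRing (λ f → ∀ i → + q ∣ f i)
      (λ f≗g q∣f i → subst (+ q ∣_) (f≗g i) (q∣f i))
      (λ i → divides 0ℤ refl)
      (λ q∣f q∣g i → ∣m∣n⇒∣m+n (q∣f i) (q∣g i))
      (λ f q∣g → ∣-⊛ f q∣g)
      using ()
      renaming (quotientRing to A; congruent to congruentᴬ; difference to differenceᴬ; _~_ to _≈ᴬ_
               ; ≈⇒~ to ≗⇒≈ᴬ; ~0⇒In to ≈0⇒∣; quotient-^ to ^ᴬ≡^; quotient-× to ×ᴬ≡•)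

    private
      module A where
        open CommutativeRing A public
        open Exponentiation (CommutativeRing.semiring A) public

      characteristic : HasCharacteristic A q
      characteristic = subst (_≈ᴬ A.0#) (sym (×ᴬ≡• q A.1#))
        (congruentᴬ λ i → divides (A.1# i) (trans (ℤ.+-identityʳ _)
          (trans (•-coefficient q A.1# i) (ℤ.*-comm (+ q) (A.1# i)))))

      open Frobenius A q-prime characteristic using (freshman^)

      Fixed : Element → Set
      Fixed f = f A.^ Q ≈ᴬ f

      Fixed-0 : Fixed A.0#
      Fixed-0 = A.trans (A.^-congʳ A.0# q^[1+k]≡2+m) (A.zeroˡ _)

      Fixed-+ : ∀ f g → Fixed f → Fixed g → Fixed (f A.+ g)
      Fixed-+ f g fix-f fix-g = A.trans (freshman^ (suc k) f g) (A.+-cong fix-f fix-g)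

      Fixed-• : ∀ c f → Fixed f → Fixed (c • f)
      Fixed-• zero f fix = Fixed-0
      Fixed-• (suc c) f fix = Fixed-+ f (c • f) fix (Fixed-• c f fix)

      Fixed-sum : ∀ {l} (t : Fin l → Element) → (∀ i → Fixed (t i)) → Fixed (sum t)
      Fixed-sum {zero} t fix = Fixed-0
      Fixed-sum {suc l} t fix = Fixed-+ (t zero) (sum (t ∘ suc)) (fix zero) (Fixed-sum (t ∘ suc) (fix ∘ suc))

      -- Q = 1 + N, so jQ and j are the same exponent modulo N.
      Fixed-monomial : ∀ j → Fixed (monomial j)
      Fixed-monomial j = A.trans (A.reflexive (^ᴬ≡^ (monomial j) Q)) (≗⇒≈ᴬ (λ i → begin
        (monomial j ^ Q) i       ≡⟨ Exp.^-congˡ Q (λ l → sym (x^ j l)) i ⟩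
        ((x ^ j) ^ Q) i          ≡⟨ Exp.^-assocʳ x j Q i ⟩
        (x ^ (j ℕ.* Q)) i        ≡⟨ x^ (j ℕ.* Q) i ⟩
        monomial (j ℕ.* Q) i     ≡⟨ cong (λ l → δ l i) (mod-cong m {j ℕ.* Q} {j}
                                    (trans (cong (_% N) jQ) ([m+kn]%n≡m%n j j N))) ⟩
        monomial j i             ∎))
        where
        open ≡-Reasoning
        module Exp = Exponentiation semiring
        jQ : j ℕ.* Q ≡ j ℕ.+ j ℕ.* N
        jQ = trans (cong (j ℕ.*_) q^[1+k]≡2+m) (ℕ.*-suc j N)

      -- Remainders modulo q serve as coefficients because they are natural numbers: the element
      -- becomes an iterated sum of monomials.
      expansion : Element → Element
      expansion f = sum (λ i → (f i %ℕ q) • monomial (toℕ i))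

      expansion-coefficient : ∀ f i → expansion f i ≡ + (f i %ℕ q)
      expansion-coefficient f i = begin
        expansion f i                                       ≡⟨ sum-coefficient (λ j → (f j %ℕ q) • monomial (toℕ j)) i ⟩
        ∑ (λ j → ((f j %ℕ q) • monomial (toℕ j)) i)         ≡⟨ ∑-cong term ⟩
        ∑ (λ j → δ i j ℤ.* + (f j %ℕ q))                    ≡⟨ ∑-δ i (λ j → + (f j %ℕ q)) ⟩
        + (f i %ℕ q)                                        ∎
        where
        open ≡-Reasoning
        term : ∀ j → ((f j %ℕ q) • monomial (toℕ j)) i ≡ δ i j ℤ.* + (f j %ℕ q)
        term j = trans (•-coefficient (f j %ℕ q) (monomial (toℕ j)) i)
          (trans (ℤ.*-comm (+ (f j %ℕ q)) _)
                 (cong (ℤ._* + (f j %ℕ q)) (trans (cong (λ l → δ l i) (mod-toℕ m j)) (δ-sym j i))))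

      residue-∣ : ∀ c → + q ∣ c ℤ.- + (c %ℕ q)
      residue-∣ c = divides (c /ℕ q)
        (trans (cong (ℤ._- + (c %ℕ q)) (a≡a%ℕn+[a/ℕn]*n c q)) (cancel (+ (c %ℕ q)) _))
        where
        cancel : ∀ r s → r ℤ.+ s ℤ.- r ≡ s
        cancel = solve-∀

      -- Modulo q every element is its expansion, and the additive map of raising to the power Q
      -- fixes each monomial in it.
      fixed : ∀ f → Fixed f
      fixed f = A.trans (A.^-congˡ Q f≈)
        (A.trans (Fixed-sum _ (λ i → Fixed-• (f i %ℕ q) _ (Fixed-monomial (toℕ i)))) (A.sym f≈))
        where
        f≈ : f ≈ᴬ expansion f
        f≈ = congruentᴬ λ i → subst (λ c → + q ∣ f i ℤ.- c) (sym (expansion-coefficient f i)) (residue-∣ (f i))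

      enumerate : Fin (q ℕ.^ N) → Element
      enumerate c i = + toℕ (finToFun {q} {N} c i)

      enumerates : ∀ f → ∃ λ c → f ≈ᴬ enumerate c
      enumerates f = funToFin digits , congruentᴬ λ i → subst (λ c → + q ∣ f i ℤ.- + c)
        (sym (trans (cong toℕ (Fin.finToFun-funToFin digits i)) (Fin.toℕ-fromℕ< (n%ℕd<d (f i) q))))
        (residue-∣ (f i))
        where
        digits : Fin N → Fin q
        digits i = Fin.fromℕ< (n%ℕd<d (f i) q)

      zero? : ∀ f → Dec (f ≈ᴬ A.0#)
      zero? f = map′ congruentᴬ differenceᴬ (Fin.all? (λ i → + q ∣? _))

      conjugateProduct : ℕ → Element
      conjugateProduct zero = A.1#
      conjugateProduct (suc j) = (monomial (q ℕ.^ suc j) - x) ⊛ conjugateProduct j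

      degree : ℕ → ℕ
      degree zero = 0
      degree (suc j) = degree j ℕ.+ q ℕ.^ suc j

      conjugateProduct-monic : ∀ j → MonicOfDegree (degree j) (conjugateProduct j)
      conjugateProduct-monic zero =
        (λ i i≡0 → δ-≡ (sym (Fin.toℕ-injective i≡0))) , (λ i 0<i → δ-≢ (λ eq → ℕ.<⇒≢ 0<i (cong toℕ eq)))
      conjugateProduct-monic (suc j) =
        monic-step (ℕ.≤-trans 2≤q (ℕ.m≤m*n q (q ℕ.^ j) {{ℕ.m^n≢0 q j}})) (conjugateProduct-monic j)

      -- With q ≥ 2 the next power is at least double the last. At j = k this puts the degree below
      -- N = q^(1+k) - 1.
      degree-< : ∀ j → suc (degree j) ℕ.< q ℕ.^ suc j
      degree-< zero = subst (1 ℕ.<_) (sym (ℕ.*-identityʳ q)) 2≤q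
      degree-< (suc j) = begin-strict
        suc (degree j) ℕ.+ P      <⟨ ℕ.+-monoˡ-< P (degree-< j) ⟩
        P ℕ.+ P                   ≡⟨ cong (P ℕ.+_) (ℕ.+-identityʳ P) ⟨
        2 ℕ.* P                   ≤⟨ ℕ.*-monoˡ-≤ P 2≤q ⟩
        q ℕ.* P                   ∎
        where
        P = q ℕ.^ suc j
        open ℕ.≤-Reasoning

      -- Its degree being below N, the leading coefficient 1 sits at an actual exponent, and q does
      -- not divide 1.
      conjugateProduct≉0 : ¬ (conjugateProduct k ≈ᴬ A.0#)
      conjugateProduct≉0 eq = ℕ.<⇒≱ 2≤q (ℕ.∣⇒≤ (∣⇒∣ᵤ (subst (+ q ∣_)
        (proj₁ (conjugateProduct-monic k) (Fin.fromℕ< degree<N) (Fin.toℕ-fromℕ< degree<N))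
        (≈0⇒∣ eq (Fin.fromℕ< degree<N)))))
        where
        degree<N : degree k ℕ.< N
        degree<N = ℕ.≤-pred (subst (suc (degree k) ℕ.<_) q^[1+k]≡2+m (degree-< k))

      factor : ∀ {d} → 0 ℕ.< d → ∀ j → d ℕ.≤ j →
               ∃ λ r → conjugateProduct j ≈ᴬ (x A.^ (q ℕ.^ d) A.- x) A.* r
      factor 0<d zero d≤0 = ⊥-elim (ℕ.<⇒≱ 0<d d≤0)
      factor {d} 0<d (suc j) d≤1+j with d ℕ.≟ suc j
      ... | yes refl = conjugateProduct j , A.*-congʳ (A.+-congʳ (A.trans
              (≗⇒≈ᴬ (λ i → sym (x^ (q ℕ.^ d) i))) (A.reflexive (sym (^ᴬ≡^ x (q ℕ.^ d))))))
      ... | no d≢1+j = let (r , eq) = factor 0<d j (ℕ.≤-pred (ℕ.≤∧≢⇒< d≤1+j d≢1+j)) in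
              (monomial (q ℕ.^ suc j) - x) ⊛ r ,
              A.trans (A.*-congˡ eq) (x∙yz≈y∙xz (monomial (q ℕ.^ suc j) - x) (x A.^ (q ℕ.^ d) A.- x) r)
        where
        open import Algebra.Properties.CommutativeSemigroup (CommutativeRing.*-commutativeSemigroup A)
          using (x∙yz≈y∙xz)

    fieldOfOrder : FiniteField (q ℕ.^ suc k)
    fieldOfOrder = ResidueFieldOfOrder.finiteField A q-prime q^[1+k]≡2+m characteristic
      zero? fixed enumerate enumerates x conjugateProduct≉0 (λ 0<d d<1+k → factor 0<d k (ℕ.≤-pred d<1+k))

-- Even and odd prime powers, and the theorem.

open import Data.Nat using (ℕ; _+_; _*_; _∸_; _^_; _<_)
open import Data.Nat.DivMod using (_/_)
open FiniteSums
open WeighingMatrices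
open Weaving
open Concatenation
open FiniteFields
open GroupRings
open import Data.Empty using (⊥-elim)
open import Data.Fin using (Fin)
open import Data.Nat using (zero; suc; _≤_; z<s; NonZero; >-nonZero⁻¹)
import Data.Nat.Properties as ℕ
open import Data.Nat.Divisibility using (_∣_; divides)
open import Data.Nat.DivMod using (m*n/n≡m)
open import Data.Nat.Primality using (Prime; euclidsLemma; prime⇒irreducible; prime[2])
open import Data.Nat.Tactic.RingSolver using (solve-∀)
open import Data.Product using (_,_; ∃)
open import Data.Sum using (_⊎_; inj₁; inj₂)
open import Data.Unit using (⊤)
open import Relation.Binary.PropositionalEquality
open import Relation.Nullary using (yes; no)

Exists : ℕ → ℕ → ℕ → Set
Exists p c m = WeighingMatrixExists (geometric p m * c + 1) (p ^ (m + 1))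

module _ {k t c : ℕ} (2^k≡1+t : 2 ^ k ≡ suc t) (t≤c : t ≤ c) (W : WeighingMatrixExists (suc c) (suc t)) where

  sylvester-power : ∀ j → WeighingMatrixExists (suc t ^ j) (suc t ^ j)
  sylvester-power j = subst (λ n → WeighingMatrixExists n n)
    (trans (sym (ℕ.^-*-assoc 2 k j)) (cong (_^ j) 2^k≡1+t)) (sylvester (k * j))

  powerOfTwo : 0 < c → ∀ m → Exists (suc t) c m
  powerOfTwo 0<c zero = subst₂ WeighingMatrixExists
    (trans (ℕ.+-comm 1 c) (cong (_+ 1) (sym (ℕ.+-identityʳ c)))) (sym (ℕ.*-identityʳ (suc t))) W
  powerOfTwo z<s (suc m) = subst (WeighingMatrixExists _) (ℕ.*-comm (suc t ^ (m + 1)) (suc t))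
    -- The first row has the order of the previous matrix, every other row 1 + vt = p^(m+1); the
    -- first column has order n, every other column order p.
    (weave-circulants v _ t t≤c (powerOfTwo z<s m)
      (subst (λ n → WeighingMatrixExists n (suc t ^ (m + 1))) (sym (1+geometric*t≡power t m))
             (sylvester-power (m + 1)))
      W
      (subst (λ n → WeighingMatrixExists n n) (ℕ.*-identityʳ (suc t)) (sylvester-power 1)))
    where
    v = geometric (suc t) m

module _ {t : ℕ} (F : FiniteField (suc t)) where
  private
    p = suc t
    g = geometric p

  extendBy : ∀ m {c d} → Weighing (Fin (g m)) (Fin (g m)) (p ^ m) → p + d ≡ suc c → Split (Fin c) p d →
             Exists p c m
  extendBy m {c} {d} A p+d≡1+c split = subst (WeighingMatrixExists _) power
    (toMatrix rows (ℕ.+-comm 1 (g m * c)) (concatenate (simplexCode F m) A split weight))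
    where
    power : p ^ m * p ≡ p ^ (m + 1)
    power = trans (ℕ.*-comm (p ^ m) p) (cong (p ^_) (ℕ.+-comm 1 m))
    -- Squareness: codewords and rows of A ⊗ E together are as many as the columns, because p + d is
    -- the order of the given matrix.
    rows : p ^ suc m + g m * d ≡ g m * c + 1
    rows = trans (cong (λ n → n + g m * d) (trans (cong (p ^_) (ℕ.+-comm 1 m)) (sym (1+geometric*t≡power t m))))
      (trans (collect (g m) t d) (cong (λ n → g m * n + 1) (ℕ.suc-injective p+d≡1+c)))
      where
      collect : ∀ g t d → suc (g * t) + g * d ≡ g * (t + d) + 1
      collect = solve-∀
    weight : 1 + g m * p ≡ p ^ m * p + g m
    weight = trans (collect (g m) t) (cong (_+ g m) (trans (1+geometric*t≡power t m) (sym power)))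
      where
      collect : ∀ g t → 1 + g * suc t ≡ suc (g * t) + g
      collect = solve-∀

  balanced : Split (Fin p) p 1 → ∀ m → Weighing (Fin (g m)) (Fin (g m)) (p ^ m)
  balanced paley zero = identity (Fin 1)
  balanced paley (suc m) = subst (Weighing _ _) (cong (p ^_) (ℕ.+-comm m 1))
    -- Starting from order p + 1, the extension has order `g m * p + 1`, which is `g (suc m)` by
    -- definition: the matrix A required one level up.
    (fromMatrix refl refl (extendBy m (balanced paley m) (ℕ.+-comm p 1) paley))

oddPower : ∀ {t c} h → suc t ≡ 3 + (h + h) → FiniteField (suc t) →
           WeighingMatrixExists (suc c) (suc t) → ∀ m → Exists (suc t) c m
oddPower {c = c} h refl F W m =
  let (d , p+d≡1+c , split) = splitFirst (fromMatrix {R = Fin (suc c)} {C = ⊤ ⊎ Fin c} refl refl W)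
  in extendBy F m (balanced F (QuadraticCharacter.paley h F) m) p+d≡1+c split

-- A column has p = t + 1 nonzero entries among c + 1. The circulants of size c need this room for
-- their t ones per row.
weight-≤ : ∀ {c t} → WeighingMatrixExists (suc c) (suc t) → t ≤ c
weight-≤ {c} {t} W =
  let (d , p+d≡1+c , _) = splitFirst (fromMatrix {R = Fin (suc c)} {C = ⊤ ⊎ Fin c} refl refl W)
  in subst (t ≤_) (ℕ.suc-injective p+d≡1+c) (ℕ.m≤m+n t d)

parity : ∀ n → (∃ λ j → n ≡ j * 2) ⊎ (∃ λ j → n ≡ suc (j + j))
parity zero = inj₁ (0 , refl)
parity (suc n) with parity n
... | inj₁ (j , refl) = inj₂ (j , cong suc (trans (ℕ.*-comm j 2) (cong (j +_) (ℕ.+-identityʳ j))))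
... | inj₂ (j , refl) = inj₁ (suc j , cong (λ i → suc (suc i))
    (trans (cong (j +_) (sym (ℕ.+-identityʳ j))) (ℕ.*-comm 2 j)))

2∣q^k⇒2∣q : ∀ q k → 2 ∣ q ^ k → 2 ∣ q
2∣q^k⇒2∣q q zero (divides zero ())
2∣q^k⇒2∣q q zero (divides (suc _) ())
2∣q^k⇒2∣q q (suc k) 2∣ with euclidsLemma q (q ^ k) prime[2] 2∣
... | inj₁ 2∣q = 2∣q
... | inj₂ 2∣q^k = 2∣q^k⇒2∣q q k 2∣q^k

-- An even power of q would make 2 a divisor of the prime q; the odd value 1 is excluded by `0 < t`.
odd-form : ∀ {q} → Prime q → q ≢ 2 → ∀ {t} k → 0 < t → q ^ suc k ≡ suc t → ∃ λ h → suc t ≡ 3 + (h + h)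
odd-form {q} q-prime q≢2 {t} k 0<t eq with parity (suc t)
... | inj₂ (suc h , eq′) = h , trans eq′ (cong (λ i → suc (suc i)) (ℕ.+-suc h h))
... | inj₂ (zero , eq′) = ⊥-elim (ℕ.<⇒≢ 0<t (sym (ℕ.suc-injective eq′)))
... | inj₁ (j , eq′) with prime⇒irreducible q-prime (2∣q^k⇒2∣q q (suc k) (divides j (trans eq eq′)))
...   | inj₂ 2≡q = ⊥-elim (q≢2 (sym 2≡q))

primePower : ∀ {q} → Prime q → ∀ k {t c} → 0 < t → q ^ suc k ≡ suc t →
             WeighingMatrixExists (suc c) (suc t) → ∀ m → Exists (suc t) c m
primePower {q} q-prime k {t} {c} 0<t eq W m with q ℕ.≟ 2
... | yes refl = powerOfTwo {suc k} eq (weight-≤ W) W (ℕ.<-≤-trans 0<t (weight-≤ W)) m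
... | no q≢2 = let (h , odd) = odd-form q-prime q≢2 k 0<t eq in
  oddPower h odd (field′ 0<t eq) W m
  where
  -- Matching t as `suc s` gives q^(1+k) = 2 + s, so the cyclic group has order 1 + s.
  field′ : ∀ {t} → 0 < t → q ^ suc k ≡ suc t → FiniteField (suc t)
  field′ {suc s} _ eq = subst FiniteField eq (FieldOfOrder.fieldOfOrder q-prime k s eq)

geometric-quotient : ∀ p m .{{_ : NonZero (p ∸ 1)}} → (p ^ (m + 1) ∸ 1) / (p ∸ 1) ≡ geometric p m
geometric-quotient (suc t) m =
  trans (cong (λ n → (n ∸ 1) / t) (sym (1+geometric*t≡power t m))) (m*n/n≡m (geometric (suc t) m) t)

theorem4 : (p n : ℕ) (p-pp : IsPrimePower p) → 0 < n →
    WeighingMatrixExists n p →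
    (m : ℕ) → 0 < m →
    let instance p∸1≢0 = isPrimePower⇒pred-nonZero p-pp in
    WeighingMatrixExists ((p ^ (m + 1) ∸ 1) / (p ∸ 1) * (n ∸ 1) + 1) (p ^ (m + 1))
theorem4 p (suc c) p-pp@(q , suc k , q-prime , z<s , p≡q^k) z<s W m _ =
  subst (λ v → WeighingMatrixExists (v * c + 1) (p ^ (m + 1)))
    (sym (geometric-quotient p m {{isPrimePower⇒pred-nonZero p-pp}}))
    (go p (isPrimePower⇒pred-nonZero p-pp) p≡q^k W)
  where
  -- Generalising over p allows matching it as `suc t`; that p - 1 is nonzero becomes `0 < t`.
  go : ∀ p → NonZero (p ∸ 1) → p ≡ q ^ suc k → WeighingMatrixExists (suc c) p → Exists p c m
  go (suc t) t≢0 eq W = primePower q-prime k (>-nonZero⁻¹ t {{t≢0}}) (sym eq) W m
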